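{- Let $n=4$ or $n=6$. If $v_1<\cdots<v_n$ are positive integers satisfying $v_n>4v_{n-1}^4$, then either $\mathrm{ML}(v_1,\ldots,v_n)=\frac{s}{ns+1}$ for some $s\in\mathbb{N}$, or $\mathrm{ML}(v_1,\ldots,v_n)\ge\frac1n$.
   Context: For a real number $x$, $\Vert x\Vert$ denotes the distance from $x$ to the nearest integer. For positive integers $v_1,\ldots,v_n$, the maximum loneliness is $\mathrm{ML}(v_1,\ldots,v_n)=\max_{t\in\mathbb{R}}\min_{1\le i\le n}\Vert t v_i\Vert$. Here $\mathbb{N}=\{1,2,3,\ldots\}$. -}

module Defs where

open import Data.Nat as ℕ using (ℕ; zero; suc)
import Data.Nat.Properties as ℕ
import Data.Nat.Coprimality as Coprimality
open import Data.Integer as ℤ using (ℤ; +_)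
import Data.Integer.Properties as ℤ
import Data.Integer.DivMod as ℤ
open import Data.Rational
open import Data.Rational.Properties
open import Data.Rational.Solver using (module +-*-Solver)
open import Data.Fin using (Fin; zero; suc)
open import Data.Product using (∃-syntax; _×_; _,_; proj₁; proj₂)
open import Data.Sum using (inj₁; inj₂; [_,_]′)
open import Function using (_∘_)
open import Relation.Nullary using (yes; no)
open import Relation.Binary.PropositionalEquality using (_≡_; refl; sym; trans; cong; subst; subst₂)

abs-≤ : ∀ {p q} → p ≤ q → - p ≤ q → ∣ p ∣ ≤ q
abs-≤ {p} {q} p≤q -p≤q with ∣p∣≡p∨∣p∣≡-p p
... | inj₁ eq = subst (_≤ q) (sym eq) p≤q
... | inj₂ eq = subst (_≤ q) (sym eq) -p≤q

p≤∣p∣ : ∀ p → p ≤ ∣ p ∣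
p≤∣p∣ p with ≤-total 0ℚ p
... | inj₁ 0≤p = ≤-reflexive (sym (0≤p⇒∣p∣≡p 0≤p))
... | inj₂ p≤0 = ≤-trans p≤0 (0≤∣p∣ p)

∣p-q∣≡∣q-p∣ : ∀ p q → ∣ p - q ∣ ≡ ∣ q - p ∣
∣p-q∣≡∣q-p∣ p q = trans (sym (∣-p∣≡∣p∣ (p - q)))
  (cong ∣_∣ (solve 2 (λ a b → :- (a :- b) := b :- a) refl p q))
  where open +-*-Solver

≤+⇒-≤ : ∀ {p q r} → p ≤ q + r → p - q ≤ r
≤+⇒-≤ {p} {q} {r} h = subst (p - q ≤_)
  (solve 2 (λ a b → a :+ b :- a := b) refl q r) (+-monoˡ-≤ (- q) h)
  where open +-*-Solver

-≤⇒≤+ : ∀ {p q r} → p - q ≤ r → p ≤ q + r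
-≤⇒≤+ {p} {q} {r} h = subst (_≤ q + r)
  (solve 2 (λ a b → a :+ (b :- a) := b) refl q p) (+-monoʳ-≤ q h)
  where open +-*-Solver

p≤q+∣p-q∣ : ∀ p q → p ≤ q + ∣ p - q ∣
p≤q+∣p-q∣ p q = -≤⇒≤+ (p≤∣p∣ (p - q))

∣-∣-≤ : ∀ {p q r} → p ≤ q + r → q ≤ p + r → ∣ p - q ∣ ≤ r
∣-∣-≤ {p} {q} {r} h₁ h₂ = abs-≤ (≤+⇒-≤ h₁) (subst (_≤ r)
  (solve 2 (λ a b → b :- a := :- (a :- b)) refl p q) (≤+⇒-≤ h₂))
  where open +-*-Solver

triangle : ∀ p q r → ∣ p - r ∣ ≤ ∣ p - q ∣ + ∣ q - r ∣
triangle p q r = subst (λ z → ∣ z ∣ ≤ ∣ p - q ∣ + ∣ q - r ∣)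
  (solve 3 (λ a b c → (a :- b) :+ (b :- c) := a :- c) refl p q r)
  (∣p+q∣≤∣p∣+∣q∣ (p - q) (q - r))
  where open +-*-Solver

half-pos : ∀ {ε} → 0ℚ < ε → 0ℚ < ε * ½
half-pos {ε} ε>0 = subst (_< ε * ½) (*-zeroˡ ½) (*-monoˡ-<-pos ½ ε>0)

half+half : ∀ ε → ε * ½ + ε * ½ ≡ ε
half+half ε = trans (sym (*-distribˡ-+ ε ½ ½)) (*-identityʳ ε)

-- The nearest integer to p is one of ⌊p⌋ and ⌊p⌋ + 1.
‖_‖ℚ : ℚ → ℚ
‖ p ‖ℚ = ∣ p - floor p / 1 ∣ ⊓ ∣ p - ℤ.suc (floor p) / 1 ∣

/1-def : ∀ i → i / 1 ≡ mkℚ i 0 (Coprimality.sym (Coprimality.1-coprimeTo ℤ.∣ i ∣))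
/1-def i = ↥p/↧p≡p (mkℚ i 0 (Coprimality.sym (Coprimality.1-coprimeTo ℤ.∣ i ∣)))

/1-mono : ∀ {i j} → i ℤ.≤ j → i / 1 ≤ j / 1
/1-mono {i} {j} i≤j rewrite /1-def i | /1-def j = *≤* (ℤ.*-monoʳ-≤-nonNeg (+ 1) i≤j)

floor-≤ : ∀ p → floor p / 1 ≤ p
floor-≤ p@(mkℚ n d _) rewrite /1-def (floor p) =
  *≤* (subst (floor p ℤ.* + suc d ℤ.≤_) (sym (ℤ.*-identityʳ n)) (ℤ.[n/d]*d≤n n (+ suc d)))

≤-suc-floor : ∀ p → p ≤ ℤ.suc (floor p) / 1
≤-suc-floor p@(mkℚ n d _) rewrite /1-def (ℤ.suc (floor p)) =
  *≤* (subst₂ ℤ._≤_ (sym (ℤ.*-identityʳ n))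
    (cong (λ i → ℤ.suc i ℤ.* + suc d) (sym (ℤ.div-pos-is-/ℕ n (suc d))))
    (ℤ.<⇒≤ (ℤ.n<s[n/ℕd]*d n (suc d))))

nearest : ∀ p → ∃[ k ] ‖ p ‖ℚ ≡ ∣ p - k / 1 ∣
nearest p with ⊓-sel ∣ p - floor p / 1 ∣ ∣ p - ℤ.suc (floor p) / 1 ∣
... | inj₁ eq = floor p , eq
... | inj₂ eq = ℤ.suc (floor p) , eq

dist-mono : ∀ {p q r} → p ≤ q → q ≤ r → ∣ r - q ∣ ≤ ∣ r - p ∣
dist-mono {p} {q} {r} p≤q q≤r = subst (_≤ ∣ r - p ∣)
  (sym (0≤p⇒∣p∣≡p (subst (_≤ r - q) (+-inverseʳ q) (+-monoˡ-≤ (- q) q≤r))))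
  (≤-trans (+-monoʳ-≤ r (neg-antimono-≤ p≤q)) (p≤∣p∣ (r - p)))

dist-mono′ : ∀ {p q r} → p ≤ q → q ≤ r → ∣ p - q ∣ ≤ ∣ p - r ∣
dist-mono′ {p} {q} {r} p≤q q≤r = subst₂ _≤_ (∣p-q∣≡∣q-p∣ q p) (∣p-q∣≡∣q-p∣ r p)
  (subst (_≤ ∣ r - p ∣)
    (sym (0≤p⇒∣p∣≡p (subst (_≤ q - p) (+-inverseʳ p) (+-monoˡ-≤ (- p) p≤q))))
    (≤-trans (+-monoˡ-≤ (- p) q≤r) (p≤∣p∣ (r - p))))

‖‖ℚ-minimal : ∀ p k → ‖ p ‖ℚ ≤ ∣ p - k / 1 ∣
‖‖ℚ-minimal p k with k ℤ.≤? floor p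
... | yes k≤f = ≤-trans (p⊓q≤p ∣ p - floor p / 1 ∣ _) (dist-mono (/1-mono k≤f) (floor-≤ p))
... | no  k≰f = ≤-trans (p⊓q≤q ∣ p - floor p / 1 ∣ _)
  (dist-mono′ (≤-suc-floor p) (/1-mono (ℤ.i<j⇒suc[i]≤j (ℤ.≰⇒> k≰f))))

‖‖ℚ-≤ : ∀ p q → ‖ p ‖ℚ ≤ ‖ q ‖ℚ + ∣ p - q ∣
‖‖ℚ-≤ p q with nearest q
... | k , eq = ≤-trans (‖‖ℚ-minimal p k) (≤-trans (triangle p q (k / 1))
  (≤-reflexive (trans (+-comm ∣ p - q ∣ _) (cong (_+ ∣ p - q ∣) (sym eq)))))

record ℝ : Set where
  field
    seq    : ℕ → ℚ
    cauchy : ∀ ε → 0ℚ < ε → ∃[ N ] (∀ m n → N ℕ.≤ m → N ℕ.≤ n → ∣ seq m - seq n ∣ < ε)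

open ℝ public

infix 4 _≤ᵣ_ _≃ᵣ_

_≤ᵣ_ : ℝ → ℝ → Set
x ≤ᵣ y = ∀ ε → 0ℚ < ε → ∃[ N ] (∀ n → N ℕ.≤ n → seq x n ≤ seq y n + ε)

-- Distinct sequences may represent the same real: ≃ᵣ, not ≡, is equality of reals.
_≃ᵣ_ : ℝ → ℝ → Set
x ≃ᵣ y = x ≤ᵣ y × y ≤ᵣ x

fromℚ : ℚ → ℝ
fromℚ q = record
  { seq    = λ _ → q
  ; cauchy = λ ε ε>0 → 0 , λ _ _ _ _ → subst (λ z → ∣ z ∣ < ε) (sym (+-inverseʳ q)) ε>0
  }

liftLipschitz : (f : ℚ → ℚ) → (∀ p q → ∣ f p - f q ∣ ≤ ∣ p - q ∣) → ℝ → ℝ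
liftLipschitz f lip x = record
  { seq    = λ n → f (seq x n)
  ; cauchy = λ ε ε>0 → let N , h = cauchy x ε ε>0 in
      N , λ m n N≤m N≤n → ≤-<-trans (lip (seq x m) (seq x n)) (h m n N≤m N≤n)
  }

‖_‖ : ℝ → ℝ
‖_‖ = liftLipschitz ‖_‖ℚ λ p q → ∣-∣-≤ (‖‖ℚ-≤ p q)
  (subst (λ z → ‖ q ‖ℚ ≤ ‖ p ‖ℚ + z) (∣p-q∣≡∣q-p∣ q p) (‖‖ℚ-≤ q p))

infixr 7 _·_

_·_ : ℕ → ℝ → ℝ
v · x = record { seq = λ n → c * seq x n ; cauchy = cau }
  where
  open +-*-Solver
  c L : ℚ
  c = + v / 1
  L = 1ℚ + ∣ c ∣
  instance
    L-pos : Positive L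
    L-pos = positive (<-≤-trans (positive⁻¹ 1ℚ) (+-monoʳ-≤ 1ℚ (0≤∣p∣ c)))
    L-nz : NonZero L
    L-nz = pos⇒nonZero L
    1/L-pos : Positive (1/ L)
    1/L-pos = 1/pos⇒pos L
  cau : ∀ ε → 0ℚ < ε →
    ∃[ N ] (∀ m n → N ℕ.≤ m → N ℕ.≤ n → ∣ c * seq x m - c * seq x n ∣ < ε)
  cau ε ε>0 = proj₁ N,h , λ m n N≤m N≤n → let d = ∣ seq x m - seq x n ∣ in begin-strict
    ∣ c * seq x m - c * seq x n ∣
      ≡⟨ cong ∣_∣ (solve 3 (λ a p q → a :* p :- a :* q := a :* (p :- q)) refl c (seq x m) (seq x n)) ⟩
    ∣ c * (seq x m - seq x n) ∣
      ≡⟨ ∣p*q∣≡∣p∣*∣q∣ c _ ⟩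
    ∣ c ∣ * d
      ≤⟨ *-monoʳ-≤-nonNeg d {{nonNegative (0≤∣p∣ (seq x m - seq x n))}}
           (subst (_≤ L) (+-identityˡ ∣ c ∣) (+-monoˡ-≤ ∣ c ∣ (<⇒≤ (positive⁻¹ 1ℚ)))) ⟩
    L * d
      <⟨ *-monoʳ-<-pos L (proj₂ N,h m n N≤m N≤n) ⟩
    L * (ε * 1/ L)
      ≡⟨ solve 3 (λ a e b → a :* (e :* b) := e :* (a :* b)) refl L ε (1/ L) ⟩
    ε * (L * 1/ L)
      ≡⟨ cong (ε *_) (*-inverseʳ L) ⟩
    ε * 1ℚ
      ≡⟨ *-identityʳ ε ⟩
    ε ∎
    where
    open ≤-Reasoning
    N,h = cauchy x (ε * 1/ L)
      (subst (_< ε * 1/ L) (*-zeroˡ (1/ L)) (*-monoˡ-<-pos (1/ L) ε>0))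

⊓-≤ : ∀ p q p′ q′ → p ⊓ q ≤ p′ ⊓ q′ + (∣ p - p′ ∣ ⊔ ∣ q - q′ ∣)
⊓-≤ p q p′ q′ with ⊓-sel p′ q′
... | inj₁ eq rewrite eq = ≤-trans (p⊓q≤p p q)
  (≤-trans (p≤q+∣p-q∣ p p′) (+-monoʳ-≤ p′ (p≤p⊔q _ _)))
... | inj₂ eq rewrite eq = ≤-trans (p⊓q≤q p q)
  (≤-trans (p≤q+∣p-q∣ q q′) (+-monoʳ-≤ q′ (p≤q⊔p ∣ p - p′ ∣ _)))

infixl 7 _⊓ᵣ_

_⊓ᵣ_ : ℝ → ℝ → ℝ
x ⊓ᵣ y = record
  { seq    = λ n → seq x n ⊓ seq y n
  ; cauchy = λ ε ε>0 →
      let N , h = cauchy x ε ε>0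
          M , g = cauchy y ε ε>0
      in N ℕ.⊔ M , λ m n l₁ l₂ → ≤-<-trans
        (∣-∣-≤ (⊓-≤ (seq x m) (seq y m) (seq x n) (seq y n))
          (subst₂ (λ a b → seq x n ⊓ seq y n ≤ seq x m ⊓ seq y m + (a ⊔ b))
            (∣p-q∣≡∣q-p∣ (seq x n) (seq x m)) (∣p-q∣≡∣q-p∣ (seq y n) (seq y m))
            (⊓-≤ (seq x n) (seq y n) (seq x m) (seq y m))))
        (⊔-< (h m n (ℕ.m⊔n≤o⇒m≤o N M l₁) (ℕ.m⊔n≤o⇒m≤o N M l₂))
             (g m n (ℕ.m⊔n≤o⇒n≤o N M l₁) (ℕ.m⊔n≤o⇒n≤o N M l₂)))
  }
  where
  ⊔-< : ∀ {p q r} → p < r → q < r → p ⊔ q < r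
  ⊔-< {p} {q} {r} p<r q<r = [ (λ eq → subst (_< r) (sym eq) p<r)
                            , (λ eq → subst (_< r) (sym eq) q<r) ]′ (⊔-sel p q)

minimum : ∀ {k} → (Fin (suc k) → ℝ) → ℝ
minimum {zero}  f = f zero
minimum {suc k} f = f zero ⊓ᵣ minimum (f ∘ suc)

dist : ℝ → ℤ → ℝ
dist x k = liftLipschitz (λ p → ∣ p - k / 1 ∣)
  (λ p q → ∣-∣-≤ (step p q)
    (subst (λ z → ∣ q - k / 1 ∣ ≤ ∣ p - k / 1 ∣ + z) (∣p-q∣≡∣q-p∣ q p) (step q p))) x
  where
  step : ∀ p q → ∣ p - k / 1 ∣ ≤ ∣ q - k / 1 ∣ + ∣ p - q ∣
  step p q = ≤-trans (triangle p q (k / 1)) (≤-reflexive (+-comm ∣ p - q ∣ _))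

-- ‖ x ‖ is the infimum of ∣ x - k ∣ over integers k. (Which integer attains
-- it cannot be decided constructively for x near a half-integer.)
‖‖-lowerBound : ∀ x k → ‖ x ‖ ≤ᵣ dist x k
‖‖-lowerBound x k ε ε>0 = 0 , λ n _ → ≤-trans (‖‖ℚ-minimal (seq x n) k)
  (subst (_≤ seq (dist x k) n + ε) (+-identityʳ _) (+-monoʳ-≤ (seq (dist x k) n) (<⇒≤ ε>0)))

‖‖-greatest : ∀ x y → (∀ k → y ≤ᵣ dist x k) → y ≤ᵣ ‖ x ‖
‖‖-greatest x y h ε ε>0 = N ℕ.⊔ M , λ n l →
  let n≥N = ℕ.m⊔n≤o⇒m≤o N M l
      n≥M = ℕ.m⊔n≤o⇒n≤o N M l
      d<δ = g n N n≥N ℕ.≤-refl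
      d′<δ = g N n ℕ.≤-refl n≥N
      near : ∣ seq x n - k / 1 ∣ ≤ δ + (‖ seq x n ‖ℚ + δ)
      near = ≤-trans (triangle (seq x n) (seq x N) (k / 1)) (+-mono-≤ (<⇒≤ d<δ)
        (≤-trans (≤-reflexive (sym eq))
          (≤-trans (‖‖ℚ-≤ (seq x N) (seq x n)) (+-monoʳ-≤ ‖ seq x n ‖ℚ (<⇒≤ d′<δ)))))
  in begin
    seq y n                               ≤⟨ u n n≥M ⟩
    ∣ seq x n - k / 1 ∣ + ε * ½           ≤⟨ +-monoˡ-≤ (ε * ½) near ⟩
    δ + (‖ seq x n ‖ℚ + δ) + ε * ½        ≡⟨ solve 3 (λ a b c → a :+ (b :+ a) :+ c := b :+ ((a :+ a) :+ c)) refl δ ‖ seq x n ‖ℚ (ε * ½) ⟩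
    ‖ seq x n ‖ℚ + ((δ + δ) + ε * ½)      ≡⟨ cong (λ z → ‖ seq x n ‖ℚ + (z + ε * ½)) (half+half (ε * ½)) ⟩
    ‖ seq x n ‖ℚ + (ε * ½ + ε * ½)        ≡⟨ cong (λ z → ‖ seq x n ‖ℚ + z) (half+half ε) ⟩
    ‖ seq x n ‖ℚ + ε                      ∎
  where
  open ≤-Reasoning
  open +-*-Solver using (solve; _:+_; _:=_)
  δ = ε * ½ * ½
  N,g = cauchy x δ (half-pos (half-pos ε>0))
  N = proj₁ N,g
  g = proj₂ N,g
  k,eq = nearest (seq x N)
  k = proj₁ k,eq
  eq = proj₂ k,eq
  M,u = h k (ε * ½) (half-pos ε>0)
  M = proj₁ M,u
  u = proj₂ M,u

IsMaximum : (ℝ → ℝ) → ℝ → Set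
IsMaximum f m = (∃[ t ] f t ≃ᵣ m) × (∀ t → f t ≤ᵣ m)

-- IsML v m says that ML(v₁, …, vₙ) = m.
IsML : ∀ {k} → (Fin (suc k) → ℕ) → ℝ → Set
IsML v = IsMaximum (λ t → minimum (λ i → ‖ v i · t ‖))

≤ᵣ-trans : ∀ x y z → x ≤ᵣ y → y ≤ᵣ z → x ≤ᵣ z
≤ᵣ-trans x y z x≤y y≤z ε ε>0 =
  let N , h = x≤y (ε * ½) (half-pos ε>0)
      M , g = y≤z (ε * ½) (half-pos ε>0)
  in N ℕ.⊔ M , λ n l → ≤-trans (h n (ℕ.m⊔n≤o⇒m≤o N M l))
       (≤-trans (+-monoˡ-≤ (ε * ½) (g n (ℕ.m⊔n≤o⇒n≤o N M l)))
         (≤-reflexive (trans (+-assoc (seq z n) _ _) (cong (λ w → seq z n + w) (half+half ε)))))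

IsMaximum-unique : ∀ f m m′ → IsMaximum f m → IsMaximum f m′ → m ≃ᵣ m′
IsMaximum-unique f m m′ ((t , _ , m≤ft) , ub) ((t′ , _ , m′≤ft′) , ub′) =
  ≤ᵣ-trans m (f t) m′ m≤ft (ub′ t) , ≤ᵣ-trans m′ (f t′) m m′≤ft′ (ub t′)

{-# OPTIONS --safe #-}
module Submission where

-- Let v₁ < … < vₖ be the slow speeds and W the fast one, n = k + 1.
--
-- Suppose first that the slow runners are at some time all at distance > 1/n from 0. Such times contain an
-- interval whose ends have denominators at most n vₖ, so it is long enough for W to reach distance 1/n.
--
-- Otherwise the slow speeds are tight, and for k = 3, 5 they are multiples g·c of (1,2,3), (1,2,3,4,5) or
-- (1,3,4,5,9). If W is not a multiple g n m of g n, a time j/(g n) puts all runners at distance ≥ 1/n;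
-- if it is, comparing the runners g, (n−1) g and W near time 1/(g n) gives ML = m/(n m + 1).
--
-- The classification of tight k-tuples is proved together with the Lonely Runner Conjecture, by induction on
-- k ≤ 5. Suppose that at some time all coprime speeds are within 2/(k(k+1)) of the integers, at a position e
-- not parallel to v. In the plane spanned by v and e there is a line on which two of the runners have opposite
-- speeds and none stands still, so the case k − 1 gives a point of that line with loneliness 1/k, and
-- replacing that point by an actual time costs less than 1/k − 1/(k+1). Hence v is not tight. By Dirichlet's theorem such a
-- time exists as soon as some speed exceeds (k(k+1)/2)^(k−1). On the other hand, for each prime p in a suitable
-- list a search over residues modulo p, 2p, 4p, … shows that either v is not tight, or v is one of
-- the known tuples, or p divides some speed. The product of the listed primes exceeds what the bound on the
-- speeds allows.

open import Defs
open import Data.Bool using (Bool; true; _∧_; _∨_; T; T?)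
open import Data.Bool.ListAction using (all; any)
open import Data.Bool.Properties using (T-∧; T-∨)
open import Data.Empty using (⊥; ⊥-elim)
open import Data.Fin as Fin using (Fin; zero; suc; fromℕ; inject₁) renaming (_<_ to _<ᶠ_)
import Data.Fin.Properties as Fin
open import Data.Fin.Relation.Unary.Top using (view; ‵fromℕ; ‵inject₁)
open import Data.Integer as ℤ using (ℤ; +_; -[1+_])
import Data.Integer.DivMod as ℤ
import Data.Integer.Properties as ℤ
open import Data.Integer.Tactic.RingSolver using (solve-∀)
open import Data.List using (List; []; _∷_; map; length; foldr; filterᵇ; applyUpTo; tabulate; _++_)
open import Data.List.Membership.Propositional using (_∈_)
open import Data.List.Membership.Propositional.Properties using (∈-map⁺; ∈-map⁻; ∈-applyUpTo⁺; ∈-tabulate⁺; ∈-tabulate⁻)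
open import Data.List.Properties using (length-map; length-tabulate)
open import Data.List.Relation.Binary.Permutation.Propositional using (_↭_; ↭-refl; ↭-sym; ↭-trans; prep; swap)
open import Data.List.Relation.Binary.Permutation.Propositional.Properties as Perm using (All-resp-↭; ∈-resp-↭; ↭-length)
open import Data.List.Relation.Binary.Pointwise as Pointwise using (Pointwise; []; _∷_)
open import Data.List.Relation.Unary.All as All using (All; []; _∷_)
import Data.List.Relation.Unary.All.Properties as All
open import Data.List.Relation.Unary.Any as Any using (Any; here; there)
open import Data.List.Relation.Unary.Any.Properties using (any⁻)
open import Data.Nat as ℕ using (ℕ; zero; suc; pred; _+_; _*_; _^_; _∸_; _⊓_; _≤_; _<_; z≤n; s≤s; _<ᵇ_; _≡ᵇ_; ⌊_/2⌋)
open import Data.Nat.Coprimality as Coprime using (Coprime; coprime-Bézout; coprime-divisor)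
import Data.Nat.DivMod as ℕ
open import Data.Nat.Divisibility as ∣ using (_∣_; divides; ∣⇒≤; _∣?_; _∣0)
open import Data.Nat.GCD using (gcd; gcd-greatest; gcd[m,n]∣m; gcd[m,n]∣n; gcd[m,n]≢0; c*gcd[m,n]≡gcd[cm,cn]; module Bézout)
open import Data.Nat.ListAction using (product)
open import Data.Nat.Primality using (Prime; prime?; euclidsLemma; prime⇒nonTrivial; prime⇒irreducible)
import Data.Nat.Properties as ℕ
import Data.Nat.Tactic.RingSolver as ℕRing
open import Data.Product using (∃-syntax; _×_; _,_; proj₁; proj₂)
open import Data.Rational as ℚ using (ℚ; _/_)
import Data.Rational.Properties as ℚ
open import Data.Rational.Solver using (module +-*-Solver)
open import Data.Rational.Unnormalised as ℚᵘ using (ℚᵘ; mkℚᵘ; ↥_; ↧_; ↧ₙ_; *≡*; *<*; *≤*; _≃_)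
import Data.Rational.Unnormalised.Properties as ℚᵘ
open import Data.Sum as Sum using (_⊎_; inj₁; inj₂)
open import Data.Unit using (⊤; tt)
open import Function using (_∘_; Equivalence)
open import Relation.Binary.Definitions using (tri<; tri≈; tri>)
open import Relation.Binary.PropositionalEquality using (_≡_; _≢_; refl; sym; trans; cong; cong₂; subst; subst₂; module ≡-Reasoning)
open import Relation.Nullary using (Dec; yes; no; ¬_; contradiction; ¬?; _×-dec_)
open import Relation.Nullary.Decidable using (True; toWitness; from-yes)

-- An index `k` stands for the smaller case: statements indexed by `k` speak of `suc k` speeds and
-- the threshold 1/(k + 2). Times are fractions t/N and inequalities are cleared of denominators,
-- because the classification ends in a Boolean search that has to be evaluated. Residues modulo p
-- carry no information about a speed that p divides, so the search modulo one prime leaves a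
-- loophole. Counting closes it: if every listed prime divides some speed, their product divides the
-- product of the speeds, which is bounded once no speed is large. Both arguments use that the
-- speeds are coprime; a common factor only rescales time. The other obstacle is constructive: ML
-- has to be exhibited as a real number that is attained before it can be compared with 1/n. The
-- loneliness at rational times is maximised on a finite grid. Real times then need no further
-- analysis, because the operations on reals act term by term on Cauchy sequences.

-- Away c q N x says ‖ x / N ‖ ≥ c / (q N).
record Away (c q N : ℕ) (x : ℤ) : Set where
  constructor away
  field bound : ∀ z → c ≤ q * ℤ.∣ x ℤ.- z ℤ.* + N ∣

open Away

away-cong : ∀ {c q N x} k → Away c q N x → Away c q N (x ℤ.+ k ℤ.* + N)
away-cong {c} {q} {N} {x} k (away h) = away λ z →
  subst (λ y → c ≤ q * ℤ.∣ y ∣) (eq x k z (+ N)) (h (z ℤ.- k))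
  where
  eq : ∀ x k z n → x ℤ.- (z ℤ.- k) ℤ.* n ≡ (x ℤ.+ k ℤ.* n) ℤ.- z ℤ.* n
  eq = solve-∀

away-neg : ∀ {c q N x} → Away c q N x → Away c q N (ℤ.- x)
away-neg {c} {q} {N} {x} (away h) = away λ z →
  subst (λ m → c ≤ q * m) (trans (sym (ℤ.∣-i∣≡∣i∣ (x ℤ.- (ℤ.- z) ℤ.* + N))) (cong ℤ.∣_∣ (eq x z (+ N)))) (h (ℤ.- z))
  where
  eq : ∀ x z n → ℤ.- (x ℤ.- (ℤ.- z) ℤ.* n) ≡ (ℤ.- x) ℤ.- z ℤ.* n
  eq = solve-∀

away-abs : ∀ {c q N} d x → Away c q N (+ ℤ.∣ d ∣ ℤ.* x) → Away c q N (d ℤ.* x)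
away-abs {c} {q} {N} d x h with ℤ.+∣i∣≡i⊎+∣i∣≡-i d
... | inj₁ eq = subst (λ y → Away c q N (y ℤ.* x)) eq h
... | inj₂ eq = subst (Away c q N)
  (trans (cong (λ y → ℤ.- (y ℤ.* x)) eq) (negneg d x)) (away-neg h)
  where
  negneg : ∀ d x → ℤ.- ((ℤ.- d) ℤ.* x) ≡ d ℤ.* x
  negneg = solve-∀

away-scale : ∀ {c q N x} g → Away c q N x → Away (g * c) q (g * N) (+ g ℤ.* x)
away-scale {c} {q} {N} {x} g (away h) = away λ z → begin
  g * c                                          ≤⟨ ℕ.*-monoʳ-≤ g (h z) ⟩
  g * (q * ℤ.∣ x ℤ.- z ℤ.* + N ∣)                ≡⟨ swap* g q _ ⟩
  q * (g * ℤ.∣ x ℤ.- z ℤ.* + N ∣)                ≡⟨ cong (q *_) (ℤ.abs-* (+ g) _) ⟨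
  q * ℤ.∣ + g ℤ.* (x ℤ.- z ℤ.* + N) ∣            ≡⟨ cong (λ y → q * ℤ.∣ y ∣) (eq (+ g) x z (+ N)) ⟩
  q * ℤ.∣ + g ℤ.* x ℤ.- z ℤ.* (+ g ℤ.* + N) ∣    ≡⟨ cong (λ y → q * ℤ.∣ + g ℤ.* x ℤ.- z ℤ.* y ∣) (ℤ.pos-* g N) ⟨
  q * ℤ.∣ + g ℤ.* x ℤ.- z ℤ.* + (g * N) ∣        ∎
  where
  open ℕ.≤-Reasoning
  swap* : ∀ a b c → a * (b * c) ≡ b * (a * c)
  swap* = ℕRing.solve-∀
  eq : ∀ g x z n → g ℤ.* (x ℤ.- z ℤ.* n) ≡ g ℤ.* x ℤ.- z ℤ.* (g ℤ.* n)
  eq = solve-∀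

StrictlyLonely : ℕ → List ℕ → Set
StrictlyLonely q vs = ∃[ N ] ∃[ t ] 0 < N × All (λ v → Away (suc N) q N (+ v ℤ.* t)) vs

Lonely : ℕ → List ℕ → Set
Lonely q vs = ∃[ N ] ∃[ t ] 0 < N × All (λ v → Away N q N (+ v ℤ.* t)) vs

LonelyRunner : ℕ → Set
LonelyRunner k = ∀ vs → length vs ≡ k → All (0 <_) vs → Lonely (suc k) vs

-- From k + 1 runners to k: gaps between slopes e/v

-- With no slope strictly between i and j, the mediant of i and j differs from every slope. Other
-- runners may share the slope i or j.
Gap : List ℚᵘ → Set
Gap ps = ∃[ i ] ∃[ j ] ∃[ rest ] ps ↭ i ∷ j ∷ rest × j ℚᵘ.< i ×
  All (λ k → i ℚᵘ.≤ k ⊎ k ℚᵘ.≤ j) rest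

-- Slopes are inserted one at a time. A new slope that falls inside the current gap shrinks it by
-- becoming its lower end.
constant-or-gap : ∀ p ps → All (_≃ p) ps ⊎ Gap (p ∷ ps)
constant-or-gap p [] = inj₁ []
constant-or-gap p (x ∷ ps) with constant-or-gap p ps
... | inj₁ ps≃p with ℚᵘ.<-cmp x p
...   | tri≈ _ x≃p _ = inj₁ (x≃p ∷ ps≃p)
...   | tri< x<p _ _ = inj₂ (p , x , ps , ↭-refl , x<p ,
          All.map (inj₁ ∘ ℚᵘ.≤-reflexive ∘ ℚᵘ.≃-sym) ps≃p)
...   | tri> _ _ p<x = inj₂ (x , p , ps , swap p x ↭-refl , p<x ,
          All.map (inj₂ ∘ ℚᵘ.≤-reflexive) ps≃p)
constant-or-gap p (x ∷ ps) | inj₂ (i , j , rest , perm , j<i , out) = inj₂ split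
  where
  toFront : p ∷ x ∷ ps ↭ i ∷ j ∷ x ∷ rest
  toFront = ↭-trans (swap p x ↭-refl) (↭-trans (prep x perm)
    (↭-trans (swap x i ↭-refl) (prep i (swap x j ↭-refl))))
  split : Gap (p ∷ x ∷ ps)
  split with i ℚᵘ.≤? x | x ℚᵘ.≤? j
  ... | yes i≤x | _       = i , j , x ∷ rest , toFront , j<i , inj₁ i≤x ∷ out
  ... | no _    | yes x≤j = i , j , x ∷ rest , toFront , j<i , inj₂ x≤j ∷ out
  ... | no i≰x  | no x≰j  = i , x , j ∷ rest , ↭-trans toFront (prep i (swap j x ↭-refl)) ,
    ℚᵘ.≰⇒> i≰x , inj₂ (ℚᵘ.<⇒≤ (ℚᵘ.≰⇒> x≰j)) ∷
    All.map (Sum.map₂ (λ k≤j → ℚᵘ.≤-trans k≤j (ℚᵘ.<⇒≤ (ℚᵘ.≰⇒> x≰j)))) out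

-- combination i j k vanishes on the mediant of i and j, hence at no k outside the gap,
-- and takes opposite values at i and j.
combination : ℚᵘ → ℚᵘ → ℚᵘ → ℤ
combination i j k = ↧ k ℤ.* (↥ i ℤ.+ ↥ j) ℤ.- ↥ k ℤ.* (↧ i ℤ.+ ↧ j)

combination-i : ∀ i j → combination i j i ≡ ℤ.- combination i j j
combination-i i j = eq (↧ i) (↥ i) (↧ j) (↥ j)
  where
  eq : ∀ a b c d → a ℤ.* (b ℤ.+ d) ℤ.- b ℤ.* (a ℤ.+ c) ≡ ℤ.- (c ℤ.* (b ℤ.+ d) ℤ.- d ℤ.* (a ℤ.+ c))
  eq = solve-∀

<⇒≢0 : ∀ {x y} → x ℤ.< y → 0 < ℤ.∣ y ℤ.- x ∣
<⇒≢0 {x} {y} x<y with ℤ.∣ y ℤ.- x ∣ in eq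
... | suc _ = s≤s z≤n
... | zero  = contradiction (sym (ℤ.i-j≡0⇒i≡j y x (ℤ.∣i∣≡0⇒i≡0 eq))) (ℤ.<⇒≢ x<y)

combination-outside : ∀ {i j k} → j ℚᵘ.< i → i ℚᵘ.≤ k ⊎ k ℚᵘ.≤ j → 0 < ℤ.∣ combination i j k ∣
combination-outside {i} {j} {k} j<i (inj₁ i≤k) =
  subst (0 <_) (ℤ.∣i-j∣≡∣j-i∣ (↥ k ℤ.* (↧ i ℤ.+ ↧ j)) _) (<⇒≢0 (subst₂ ℤ._<_
    (eq₁ (↥ i) (↥ j) (↧ k)) (eq₂ (↥ k) (↧ i) (↧ j))
    (ℤ.+-mono-≤-< (ℚᵘ.drop-*≤* i≤k) (ℚᵘ.drop-*<* (ℚᵘ.<-≤-trans j<i i≤k)))))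
  where
  eq₁ : ∀ a b c → a ℤ.* c ℤ.+ b ℤ.* c ≡ c ℤ.* (a ℤ.+ b)
  eq₁ = solve-∀
  eq₂ : ∀ a b c → a ℤ.* b ℤ.+ a ℤ.* c ≡ a ℤ.* (b ℤ.+ c)
  eq₂ = solve-∀
combination-outside {i} {j} {k} j<i (inj₂ k≤j) =
  <⇒≢0 (subst₂ ℤ._<_ (eq₂ (↥ k) (↧ i) (↧ j)) (eq₁ (↥ i) (↥ j) (↧ k))
    (ℤ.+-mono-<-≤ (ℚᵘ.drop-*<* (ℚᵘ.≤-<-trans k≤j j<i)) (ℚᵘ.drop-*≤* k≤j)))
  where
  eq₁ : ∀ a b c → a ℤ.* c ℤ.+ b ℤ.* c ≡ c ℤ.* (a ℤ.+ b)
  eq₁ = solve-∀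
  eq₂ : ∀ a b c → a ℤ.* b ℤ.+ a ℤ.* c ≡ a ℤ.* (b ℤ.+ c)
  eq₂ = solve-∀

round-div : ∀ x N → 0 < N → ∃[ k ] 2 * ℤ.∣ k ℤ.* + N ℤ.- x ∣ ≤ N
round-div x N@(suc n) _ with 2 * r ℕ.≤? N
  where r = x ℤ.%ℕ N
... | yes 2r≤N = x ℤ./ℕ N , subst (λ m → 2 * m ≤ N) (sym eq) 2r≤N
  where
  r = x ℤ.%ℕ N
  neg : ∀ a r → a ℤ.- (r ℤ.+ a) ≡ ℤ.- r
  neg = solve-∀
  eq : ℤ.∣ x ℤ./ℕ N ℤ.* + N ℤ.- x ∣ ≡ r
  eq = trans (cong (λ y → ℤ.∣ x ℤ./ℕ N ℤ.* + N ℤ.- y ∣) (ℤ.a≡a%ℕn+[a/ℕn]*n x N))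
    (trans (cong ℤ.∣_∣ (neg (x ℤ./ℕ N ℤ.* + N) (+ r))) (ℤ.∣-i∣≡∣i∣ (+ r)))
... | no 2r≰N = ℤ.suc (x ℤ./ℕ N) , subst (λ m → 2 * m ≤ N) (sym eq) small
  where
  r = x ℤ.%ℕ N
  r≤N : r ≤ N
  r≤N = ℕ.<⇒≤ (ℤ.n%ℕd<d x N)
  diff : ∀ a r n → (ℤ.1ℤ ℤ.+ a) ℤ.* n ℤ.- (r ℤ.+ a ℤ.* n) ≡ n ℤ.- r
  diff = solve-∀
  eq : ℤ.∣ ℤ.suc (x ℤ./ℕ N) ℤ.* + N ℤ.- x ∣ ≡ N ∸ r
  eq = trans (cong (λ y → ℤ.∣ ℤ.suc (x ℤ./ℕ N) ℤ.* + N ℤ.- y ∣) (ℤ.a≡a%ℕn+[a/ℕn]*n x N))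
    (trans (cong ℤ.∣_∣ (diff (x ℤ./ℕ N) (+ r) (+ N)))
    (trans (cong ℤ.∣_∣ (trans (ℤ.[+m]-[+n]≡m⊖n N r) (ℤ.⊖-≥ r≤N))) refl))
  small : 2 * (N ∸ r) ≤ N
  small = ℕ.+-cancelʳ-≤ (2 * r) _ _ (begin
    2 * (N ∸ r) + 2 * r   ≡⟨ ℕ.*-distribˡ-+ 2 (N ∸ r) r ⟨
    2 * (N ∸ r + r)       ≡⟨ cong (2 *_) (ℕ.m∸n+n≡m r≤N) ⟩
    2 * N                 ≡⟨ cong (λ m → N + m) (ℕ.+-identityʳ N) ⟩
    N + N                 ≤⟨ ℕ.+-monoʳ-≤ N (ℕ.<⇒≤ (ℕ.≰⇒> 2r≰N)) ⟩
    N + 2 * r             ∎)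
    where open ℕ.≤-Reasoning

-- The slack between the thresholds 1/k and 1/(k+1) absorbs an error B E, where B/N ≤ 1/2
-- and E/M < 2/(k(k+1)).
rounding-slack : ∀ k N M A B E X → 0 < k → 0 < N → N ≤ k * A → 2 * B ≤ N → k * suc k * E < 2 * M →
                 M * A ≤ X + B * E → suc (N * M) ≤ suc k * X
rounding-slack k@(suc _) N@(suc _) M A B E X _ _ N≤kA 2B≤N kE<2M MA≤X+BE =
  ℕ.*-cancelˡ-< k (N * M) (suc k * X) (ℕ.+-cancelʳ-< (N * M) (k * (N * M)) (k * (suc k * X)) (begin-strict
    k * (N * M) + N * M                    ≡⟨ e₁ k N M ⟩
    suc k * (M * N)                        ≤⟨ ℕ.*-monoʳ-≤ (suc k) (ℕ.*-monoʳ-≤ M N≤kA) ⟩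
    suc k * (M * (k * A))                  ≡⟨ e₂ k M A ⟩
    k * suc k * (M * A)                    ≤⟨ ℕ.*-monoʳ-≤ (k * suc k) MA≤X+BE ⟩
    k * suc k * (X + B * E)                ≡⟨ e₃ k X (B * E) ⟩
    k * (suc k * X) + k * suc k * (B * E)  <⟨ ℕ.+-monoʳ-< (k * (suc k * X)) err ⟩
    k * (suc k * X) + N * M                ∎))
  where
  open ℕ.≤-Reasoning
  e₁ : ∀ k N M → k * (N * M) + N * M ≡ suc k * (M * N)
  e₁ = ℕRing.solve-∀
  e₂ : ∀ k M A → suc k * (M * (k * A)) ≡ k * suc k * (M * A)
  e₂ = ℕRing.solve-∀
  e₃ : ∀ k X Y → k * suc k * (X + Y) ≡ k * (suc k * X) + k * suc k * Y
  e₃ = ℕRing.solve-∀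
  e₄ : ∀ k B E → 2 * (k * suc k * (B * E)) ≡ (2 * B) * (k * suc k * E)
  e₄ = ℕRing.solve-∀
  e₅ : ∀ N M → N * (2 * M) ≡ 2 * (N * M)
  e₅ = ℕRing.solve-∀
  err : k * suc k * (B * E) < N * M
  err = ℕ.*-cancelˡ-< 2 _ _ (begin-strict
    2 * (k * suc k * (B * E))  ≡⟨ e₄ k B E ⟩
    (2 * B) * (k * suc k * E)  ≤⟨ ℕ.*-monoˡ-≤ (k * suc k * E) 2B≤N ⟩
    N * (k * suc k * E)        <⟨ ℕ.*-monoʳ-< N kE<2M ⟩
    N * (2 * M)                ≡⟨ e₅ N M ⟩
    2 * (N * M)                ∎)

-- At time a / M, runner v is at e / M, within 2/(k(k+1)) of the start.
Near : (k : ℕ) (a : ℤ) (M : ℕ) → ℕ → ℤ → Set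
Near k a M v e = (∃[ w ] + v ℤ.* a ≡ w ℤ.* + M ℤ.+ e) × k * suc k * ℤ.∣ e ∣ < 2 * M

strictlyLonely-resp-↭ : ∀ {q vs ws} → vs ↭ ws → StrictlyLonely q vs → StrictlyLonely q ws
strictlyLonely-resp-↭ perm (N , t , 0<N , h) = N , t , 0<N , All-resp-↭ perm h

-- In the plane spanned by the v's and the e's there is a line through 0 along which runners i and j
-- have opposite speeds and no runner has speed 0: effectively k runners, hence loneliness ≥ 1/(k+1).
-- A point of the plane becomes a time by rounding its e-coordinate to a multiple of 1/M.
gap⇒strictlyLonely : ∀ k a M → LonelyRunner k → 0 < M → ∀ ps → length ps ≡ suc k →
  All (λ p → Near (suc k) a M (↧ₙ p) (↥ p)) ps → Gap ps → StrictlyLonely (2 + k) (map ↧ₙ_ ps)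
gap⇒strictlyLonely k a M lr 0<M ps len near (i , j , rest , perm , j<i , out)
  = strictlyLonely-resp-↭ (Perm.map⁺ ↧ₙ_ (↭-sym perm)) strict
  where
  d : ℚᵘ → ℤ
  d = combination i j
  -- `d p` equals v α + e β for the runner p = e/v: it is the speed of p along the direction α v + β
  -- e of the plane.
  α β : ℤ
  α = ↥ i ℤ.+ ↥ j
  β = ℤ.- (↧ i ℤ.+ ↧ j)
  len′ : length (map (λ p → ℤ.∣ d p ∣) (j ∷ rest)) ≡ k
  len′ = trans (length-map _ (j ∷ rest)) (ℕ.suc-injective (trans (sym (↭-length perm)) len))
  nonzero : All (λ p → 0 < ℤ.∣ d p ∣) (j ∷ rest)
  nonzero = combination-outside {i} {j} {j} j<i (inj₂ ℚᵘ.≤-refl) ∷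
    All.map (λ {p} → combination-outside {i} {j} {p} j<i) out
  lonely : Lonely (suc k) (map (λ p → ℤ.∣ d p ∣) (j ∷ rest))
  lonely = lr _ len′ (All.map⁺ {f = λ p → ℤ.∣ d p ∣} nonzero)
  N : ℕ
  N = proj₁ lonely
  x : ℤ
  x = proj₁ (proj₂ lonely)
  0<N : 0 < N
  0<N = proj₁ (proj₂ (proj₂ lonely))
  jrest-away : All (λ p → Away N (suc k) N (d p ℤ.* x)) (j ∷ rest)
  jrest-away = All.map (λ {p} → away-abs (d p) x) (All.map⁻ (proj₂ (proj₂ (proj₂ lonely))))
  neg* : ∀ y x → ℤ.- (y ℤ.* x) ≡ (ℤ.- y) ℤ.* x
  neg* = solve-∀
  i-away : Away N (suc k) N (d i ℤ.* x)
  i-away = subst (Away N (suc k) N) (trans (neg* (d j) x) (cong (ℤ._* x) (sym (combination-i i j))))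
    (away-neg (All.head jrest-away))
  -- The e-coordinate x β / N of the lonely point is rounded to l / M. Such a coordinate is realised
  -- by a time: at time l a / M the runner p stands at l e / M modulo 1.
  K : ∃[ l ] 2 * ℤ.∣ l ℤ.* + N ℤ.- + M ℤ.* x ℤ.* β ∣ ≤ N
  K = round-div (+ M ℤ.* x ℤ.* β) N 0<N
  l t : ℤ
  l = proj₁ K
  t = α ℤ.* x ℤ.* + M ℤ.+ l ℤ.* a ℤ.* + N
  split : ∀ v e al x m l a n z w si → v ℤ.* a ≡ w ℤ.* m ℤ.+ e →
    m ℤ.* ((v ℤ.* al ℤ.- e ℤ.* si) ℤ.* x ℤ.- (z ℤ.- l ℤ.* w) ℤ.* n)
    ≡ (v ℤ.* (al ℤ.* x ℤ.* m ℤ.+ l ℤ.* a ℤ.* n) ℤ.- z ℤ.* (n ℤ.* m)) ℤ.- (l ℤ.* n ℤ.- m ℤ.* x ℤ.* (ℤ.- si)) ℤ.* e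
  split v e al x m l a n z w si eq = trans (e₁ v e al x m l n z w si)
    (trans (cong (λ y → v ℤ.* al ℤ.* x ℤ.* m ℤ.+ l ℤ.* n ℤ.* y ℤ.- z ℤ.* (n ℤ.* m) ℤ.- (l ℤ.* n ℤ.- m ℤ.* x ℤ.* (ℤ.- si)) ℤ.* e) (sym eq))
      (e₂ v e al x m l a n z si))
    where
    e₁ : ∀ v e al x m l n z w si → m ℤ.* ((v ℤ.* al ℤ.- e ℤ.* si) ℤ.* x ℤ.- (z ℤ.- l ℤ.* w) ℤ.* n)
      ≡ v ℤ.* al ℤ.* x ℤ.* m ℤ.+ l ℤ.* n ℤ.* (w ℤ.* m ℤ.+ e) ℤ.- z ℤ.* (n ℤ.* m) ℤ.- (l ℤ.* n ℤ.- m ℤ.* x ℤ.* (ℤ.- si)) ℤ.* e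
    e₁ = solve-∀
    e₂ : ∀ v e al x m l a n z si → v ℤ.* al ℤ.* x ℤ.* m ℤ.+ l ℤ.* n ℤ.* (v ℤ.* a) ℤ.- z ℤ.* (n ℤ.* m) ℤ.- (l ℤ.* n ℤ.- m ℤ.* x ℤ.* (ℤ.- si)) ℤ.* e
      ≡ (v ℤ.* (al ℤ.* x ℤ.* m ℤ.+ l ℤ.* a ℤ.* n) ℤ.- z ℤ.* (n ℤ.* m)) ℤ.- (l ℤ.* n ℤ.- m ℤ.* x ℤ.* (ℤ.- si)) ℤ.* e
    e₂ = solve-∀
  keep : ∀ {p} → Near (suc k) a M (↧ₙ p) (↥ p) × Away N (suc k) N (d p ℤ.* x) →
         Away (suc (N * M)) (2 + k) (N * M) (↧ p ℤ.* t)
  keep {p} (((w , eq) , small) , away h) = away λ z →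
    rounding-slack (suc k) N M ℤ.∣ d p ℤ.* x ℤ.- (z ℤ.- l ℤ.* w) ℤ.* + N ∣
      ℤ.∣ l ℤ.* + N ℤ.- + M ℤ.* x ℤ.* β ∣ ℤ.∣ ↥ p ∣ ℤ.∣ ↧ p ℤ.* t ℤ.- z ℤ.* + (N * M) ∣
      (s≤s z≤n) 0<N (h (z ℤ.- l ℤ.* w)) (proj₂ K) small (begin
        M * ℤ.∣ d p ℤ.* x ℤ.- (z ℤ.- l ℤ.* w) ℤ.* + N ∣
          ≡⟨ ℤ.abs-* (+ M) _ ⟨
        ℤ.∣ + M ℤ.* (d p ℤ.* x ℤ.- (z ℤ.- l ℤ.* w) ℤ.* + N) ∣
          ≡⟨ cong ℤ.∣_∣ (split (↧ p) (↥ p) α x (+ M) l a (+ N) z w (↧ i ℤ.+ ↧ j) eq) ⟩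
        ℤ.∣ (↧ p ℤ.* t ℤ.- z ℤ.* (+ N ℤ.* + M)) ℤ.- (l ℤ.* + N ℤ.- + M ℤ.* x ℤ.* β) ℤ.* ↥ p ∣
          ≤⟨ ℤ.∣i-j∣≤∣i∣+∣j∣ (↧ p ℤ.* t ℤ.- z ℤ.* (+ N ℤ.* + M)) ((l ℤ.* + N ℤ.- + M ℤ.* x ℤ.* β) ℤ.* ↥ p) ⟩
        ℤ.∣ ↧ p ℤ.* t ℤ.- z ℤ.* (+ N ℤ.* + M) ∣ + ℤ.∣ (l ℤ.* + N ℤ.- + M ℤ.* x ℤ.* β) ℤ.* ↥ p ∣
          ≡⟨ cong₂ _+_ (cong (λ y → ℤ.∣ ↧ p ℤ.* t ℤ.- z ℤ.* y ∣) (sym (ℤ.pos-* N M)))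
               (ℤ.abs-* (l ℤ.* + N ℤ.- + M ℤ.* x ℤ.* β) (↥ p)) ⟩
        ℤ.∣ ↧ p ℤ.* t ℤ.- z ℤ.* + (N * M) ∣ + ℤ.∣ l ℤ.* + N ℤ.- + M ℤ.* x ℤ.* β ∣ * ℤ.∣ ↥ p ∣ ∎)
    where open ℕ.≤-Reasoning
  strict : StrictlyLonely (2 + k) (map ↧ₙ_ (i ∷ j ∷ rest))
  strict = N * M , t , ℕ.*-mono-< 0<N 0<M ,
    All.map⁺ (All.map (λ {p} → keep {p}) (All.zip (All-resp-↭ perm near , i-away ∷ jrest-away)))

-- Unnormalised fractions e/v keep the speed and the position themselves, and their order is that of
-- the slopes.
slopes : ∀ {R : ℕ → ℤ → Set} {vs es} → All (0 <_) vs → Pointwise R vs es →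
         ∃[ ps ] vs ≡ map ↧ₙ_ ps × es ≡ map ↥_ ps × All (λ p → R (↧ₙ p) (↥ p)) ps
slopes [] [] = [] , refl , refl , []
slopes {vs = suc v ∷ _} {e ∷ _} (_ ∷ pos) (r ∷ rs) with slopes pos rs
... | ps , refl , refl , h = mkℚᵘ e v ∷ ps , refl , refl , r ∷ h

map-pointwise : ∀ {R : ℕ → ℤ → Set} {ps} → All (λ p → R (↧ₙ p) (↥ p)) ps → Pointwise R (map ↧ₙ_ ps) (map ↥_ ps)
map-pointwise [] = []
map-pointwise (h ∷ hs) = h ∷ map-pointwise hs

near⇒strictlyLonely∨parallel : ∀ k a M → LonelyRunner k → 0 < M → ∀ {v₀ e₀ vs es} →
  All (0 <_) (v₀ ∷ vs) → length (v₀ ∷ vs) ≡ suc k → Pointwise (Near (suc k) a M) (v₀ ∷ vs) (e₀ ∷ es) →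
  StrictlyLonely (2 + k) (v₀ ∷ vs) ⊎ Pointwise (λ v e → e ℤ.* + v₀ ≡ e₀ ℤ.* + v) vs es
near⇒strictlyLonely∨parallel k a M lr 0<M pos len near with slopes pos near
... | p ∷ ps , refl , refl , h with constant-or-gap p ps
...   | inj₁ const = inj₂ (map-pointwise (All.map (λ { (*≡* eq) → eq }) const))
...   | inj₂ gap = inj₁ (gap⇒strictlyLonely k a M lr 0<M (p ∷ ps)
          (trans (sym (length-map ↧ₙ_ (p ∷ ps))) len) h gap)

gcdₗ : List ℕ → ℕ
gcdₗ = foldr gcd 0

∣-gcdₗ* : ∀ {d a vs} → All (λ v → d ∣ v * a) vs → d ∣ gcdₗ vs * a
∣-gcdₗ* [] = _ ∣0
∣-gcdₗ* {d} {a} {v ∷ vs} (h ∷ hs) = subst (d ∣_)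
  (trans (cong₂ gcd (ℕ.*-comm v a) (ℕ.*-comm (gcdₗ vs) a))
    (trans (sym (c*gcd[m,n]≡gcd[cm,cn] a v (gcdₗ vs))) (ℕ.*-comm a (gcd v (gcdₗ vs)))))
  (gcd-greatest h (∣-gcdₗ* {vs = vs} hs))

∣m-n∣<o : ∀ {m n o} → m < o → n < o → ℤ.∣ + m ℤ.- + n ∣ < o
∣m-n∣<o {m} {n} m<o n<o = ℕ.≤-<-trans
  (ℕ.≤-trans (ℕ.≤-reflexive (cong ℤ.∣_∣ (ℤ.[+m]-[+n]≡m⊖n m n))) (ℤ.∣m⊝n∣≤m⊔n m n)) (ℕ.⊔-lub m<o n<o)

divMod : ∀ m n → + m ≡ + (m ℕ./ suc n) ℤ.* + suc n ℤ.+ + (m ℕ.% suc n)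
divMod m n = begin
  + m                                                  ≡⟨ cong +_ (ℕ.m≡m%n+[m/n]*n m (suc n)) ⟩
  + (m ℕ.% suc n + m ℕ./ suc n * suc n)                ≡⟨ cong +_ (ℕ.+-comm (m ℕ.% suc n) _) ⟩
  + (m ℕ./ suc n * suc n) ℤ.+ + (m ℕ.% suc n)          ≡⟨ cong (ℤ._+ + (m ℕ.% suc n)) (ℤ.pos-* (m ℕ./ suc n) (suc n)) ⟩
  + (m ℕ./ suc n) ℤ.* + suc n ℤ.+ + (m ℕ.% suc n)      ∎
  where open ≡-Reasoning

-- Dirichlet approximation

module _ (D n : ℕ) where
  private V = suc n

  digit< : ∀ x → 0 < D → D * (x ℕ.% V) ℕ./ V < D
  digit< x 0<D = ℕ.m<n*o⇒m/o<n (ℕ.*-monoʳ-< D {{ℕ.>-nonZero 0<D}} (ℕ.m%n<n x V))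

  -- The digit `D * (x % V) / V` is ⌊D {x / V}⌋, so a cell is a box of side 1/D in the torus of
  -- fractional parts of u q / V.
  cell : 0 < D → (us : List ℕ) → ℕ → Fin (D ^ length us)
  cell 0<D []       q = Fin.zero
  cell 0<D (u ∷ us) q = Fin.combine (Fin.fromℕ< (digit< (u * q) 0<D)) (cell 0<D us q)

  -- The equal quotients cancel in D x′ - D x, which leaves a difference of two remainders below V.
  sameDigit⇒close : ∀ u q q′ → D * ((u * q) ℕ.% V) ℕ./ V ≡ D * ((u * q′) ℕ.% V) ℕ./ V →
    ∃[ w ] ∃[ e ] + u ℤ.* (+ q′ ℤ.- + q) ≡ w ℤ.* + V ℤ.+ e × D * ℤ.∣ e ∣ < V
  sameDigit⇒close u q q′ eq =
    + (u * q′ ℕ./ V) ℤ.- + (u * q ℕ./ V) , + x′ ℤ.- + x ,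
    (begin
      + u ℤ.* (+ q′ ℤ.- + q)                   ≡⟨ distrib (+ u) (+ q′) (+ q) ⟩
      + u ℤ.* + q′ ℤ.- + u ℤ.* + q             ≡⟨ cong₂ ℤ._-_ (sym (ℤ.pos-* u q′)) (sym (ℤ.pos-* u q)) ⟩
      + (u * q′) ℤ.- + (u * q)                 ≡⟨ cong₂ ℤ._-_ (divMod (u * q′) n) (divMod (u * q) n) ⟩
      (+ (u * q′ ℕ./ V) ℤ.* + V ℤ.+ + x′) ℤ.- (+ (u * q ℕ./ V) ℤ.* + V ℤ.+ + x)
        ≡⟨ collect (+ (u * q′ ℕ./ V)) (+ (u * q ℕ./ V)) (+ V) (+ x′) (+ x) ⟩
      (+ (u * q′ ℕ./ V) ℤ.- + (u * q ℕ./ V)) ℤ.* + V ℤ.+ (+ x′ ℤ.- + x) ∎) ,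
    subst (_< V) scaled (∣m-n∣<o (ℕ.m%n<n (D * x′) V) (ℕ.m%n<n (D * x) V))
    where
    open ≡-Reasoning
    x x′ : ℕ
    x  = (u * q) ℕ.% V
    x′ = (u * q′) ℕ.% V
    distrib : ∀ u a b → u ℤ.* (a ℤ.- b) ≡ u ℤ.* a ℤ.- u ℤ.* b
    distrib = solve-∀
    collect : ∀ a b v x y → (a ℤ.* v ℤ.+ x) ℤ.- (b ℤ.* v ℤ.+ y) ≡ (a ℤ.- b) ℤ.* v ℤ.+ (x ℤ.- y)
    collect = solve-∀
    cancel : ∀ a x y → (a ℤ.+ x) ℤ.- (a ℤ.+ y) ≡ x ℤ.- y
    cancel = solve-∀
    scaled : ℤ.∣ + ((D * x′) ℕ.% V) ℤ.- + ((D * x) ℕ.% V) ∣ ≡ D * ℤ.∣ + x′ ℤ.- + x ∣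
    scaled = begin
      ℤ.∣ + ((D * x′) ℕ.% V) ℤ.- + ((D * x) ℕ.% V) ∣
        ≡⟨ cong ℤ.∣_∣ (cancel (+ (D * x′ ℕ./ V) ℤ.* + V) (+ ((D * x′) ℕ.% V)) (+ ((D * x) ℕ.% V))) ⟨
      ℤ.∣ (+ (D * x′ ℕ./ V) ℤ.* + V ℤ.+ + ((D * x′) ℕ.% V)) ℤ.- (+ (D * x′ ℕ./ V) ℤ.* + V ℤ.+ + ((D * x) ℕ.% V)) ∣
        ≡⟨ cong (λ y → ℤ.∣ (+ (D * x′ ℕ./ V) ℤ.* + V ℤ.+ + ((D * x′) ℕ.% V)) ℤ.- (+ y ℤ.* + V ℤ.+ + ((D * x) ℕ.% V)) ∣) (sym eq) ⟩
      ℤ.∣ (+ (D * x′ ℕ./ V) ℤ.* + V ℤ.+ + ((D * x′) ℕ.% V)) ℤ.- (+ (D * x ℕ./ V) ℤ.* + V ℤ.+ + ((D * x) ℕ.% V)) ∣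
        ≡⟨ cong₂ (λ y z → ℤ.∣ y ℤ.- z ∣) (divMod (D * x′) n) (divMod (D * x) n) ⟨
      ℤ.∣ + (D * x′) ℤ.- + (D * x) ∣
        ≡⟨ cong₂ (λ y z → ℤ.∣ y ℤ.- z ∣) (ℤ.pos-* D x′) (ℤ.pos-* D x) ⟩
      ℤ.∣ + D ℤ.* + x′ ℤ.- + D ℤ.* + x ∣
        ≡⟨ cong ℤ.∣_∣ (distrib (+ D) (+ x′) (+ x)) ⟨
      ℤ.∣ + D ℤ.* (+ x′ ℤ.- + x) ∣
        ≡⟨ ℤ.abs-* (+ D) (+ x′ ℤ.- + x) ⟩
      D * ℤ.∣ + x′ ℤ.- + x ∣ ∎

  sameCell⇒close : ∀ (0<D : 0 < D) us q q′ → cell 0<D us q ≡ cell 0<D us q′ →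
    All (λ u → ∃[ w ] ∃[ e ] + u ℤ.* (+ q′ ℤ.- + q) ≡ w ℤ.* + V ℤ.+ e × D * ℤ.∣ e ∣ < V) us
  sameCell⇒close 0<D []       q q′ eq = []
  sameCell⇒close 0<D (u ∷ us) q q′ eq with Fin.combine-injective {m = D} _ (cell 0<D us q) _ (cell 0<D us q′) eq
  ... | eq₁ , eq₂ = sameDigit⇒close u q q′ (Fin.fromℕ<-injective _ _ _ _ eq₁) ∷ sameCell⇒close 0<D us q q′ eq₂

  dirichlet : 0 < D → ∀ us → D ^ length us < V → ∃[ a ] 0 < a × a < V ×
    All (λ u → ∃[ w ] ∃[ e ] + u ℤ.* + a ≡ w ℤ.* + V ℤ.+ e × D * ℤ.∣ e ∣ < V) us
  dirichlet 0<D us D^<V with Fin.pigeonhole (ℕ.n<1+n _) (cell 0<D us ∘ Fin.toℕ {suc (D ^ length us)})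
  ... | i , j , i<j , eq = Fin.toℕ j ∸ Fin.toℕ i , ℕ.m<n⇒0<n∸m i<j ,
    ℕ.≤-<-trans (ℕ.m∸n≤m (Fin.toℕ j) (Fin.toℕ i)) (ℕ.≤-<-trans (ℕ.≤-pred (Fin.toℕ<n j)) D^<V) ,
    subst (λ a → All (λ u → ∃[ w ] ∃[ e ] + u ℤ.* a ≡ w ℤ.* + V ℤ.+ e × D * ℤ.∣ e ∣ < V) us)
      (trans (ℤ.[+m]-[+n]≡m⊖n (Fin.toℕ j) (Fin.toℕ i)) (ℤ.⊖-≥ (ℕ.<⇒≤ i<j)))
      (sameCell⇒close 0<D us (Fin.toℕ i) (Fin.toℕ j) eq)

unzipAll : ∀ {R : ℕ → ℤ → Set} {us} → All (λ u → ∃[ e ] R u e) us → ∃[ es ] Pointwise R us es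
unzipAll [] = [] , []
unzipAll ((e , r) ∷ h) with unzipAll h
... | es , rs = e ∷ es , r ∷ rs

-- The time has the large speed V itself as denominator, so V is exactly at the start (e = 0). A
-- position parallel to the speeds would put every runner at the start, and coprimality would give V
-- ∣ a, although 0 < a < V. With D = (k + 1)(k + 2)/2 the bound D |e| < V of Dirichlet's theorem is
-- exactly the required nearness.
largeSpeed⇒strictlyLonely : ∀ k D → 2 * D ≡ suc k * suc (suc k) → LonelyRunner k → ∀ {V us} →
  All (0 <_) (V ∷ us) → length us ≡ k → gcdₗ (V ∷ us) ≡ 1 → D ^ k < V → StrictlyLonely (2 + k) (V ∷ us)
largeSpeed⇒strictlyLonely k D eqD lr {V@(suc n)} {us} pos refl gcd≡1 D^<V
  with dirichlet D n 0<D us D^<V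
  where
  0<D : 0 < D
  0<D = ℕ.n≢0⇒n>0 λ { refl → contradiction eqD λ () }
... | a , 0<a , a<V , close with unzipAll (All.map (λ {u} → near {u}) close)
  where
  near : ∀ {u} → ∃[ w ] ∃[ e ] + u ℤ.* + a ≡ w ℤ.* + V ℤ.+ e × D * ℤ.∣ e ∣ < V → ∃[ e ] Near (suc k) (+ a) V u e
  near (w , e , eq , small) = e , (w , eq) ,
    subst (_< 2 * V) (trans (sym (ℕ.*-assoc 2 D _)) (cong (_* ℤ.∣ e ∣) eqD)) (ℕ.*-monoʳ-< 2 small)
... | es , near with near⇒strictlyLonely∨parallel k (+ a) V lr (s≤s z≤n) pos refl (near₀ ∷ near)
  where
  eq₀ : ∀ v a → v ℤ.* a ≡ a ℤ.* v ℤ.+ ℤ.0ℤ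
  eq₀ = solve-∀
  near₀ : Near (suc k) (+ a) V V ℤ.0ℤ
  near₀ = (+ a , eq₀ (+ V) (+ a)) , subst (_< 2 * V) (sym (ℕ.*-zeroʳ (suc k * suc (suc k)))) (s≤s z≤n)
...   | inj₁ strict = strict
...   | inj₂ par = contradiction (∣⇒≤ {{ℕ.>-nonZero 0<a}} V∣a) (ℕ.<⇒≱ a<V)
  where
  multiples : ∀ {us es} → Pointwise (Near (suc k) (+ a) V) us es →
    Pointwise (λ v e → e ℤ.* + V ≡ ℤ.0ℤ ℤ.* + v) us es → All (λ v → V ∣ v * a) us
  multiples [] [] = []
  multiples {u ∷ _} {e ∷ _} (((w , eq) , _) ∷ near) (par ∷ pars) = divides ℤ.∣ w ∣
    (trans (sym (ℤ.abs-* (+ u) (+ a))) (trans (cong ℤ.∣_∣ (trans eq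
      (trans (cong (λ y → w ℤ.* + V ℤ.+ y) e≡0) (ℤ.+-identityʳ (w ℤ.* + V))))) (ℤ.abs-* w (+ V)))) ∷ multiples near pars
    where
    e≡0 : e ≡ ℤ.0ℤ
    e≡0 = ℤ.*-cancelʳ-≡ e ℤ.0ℤ (+ V) par
  V∣a : V ∣ a
  V∣a = subst (V ∣_) (trans (cong (_* a) gcd≡1) (ℕ.*-identityˡ a))
    (∣-gcdₗ* {vs = V ∷ us} (divides a (ℕ.*-comm V a) ∷ multiples near par))

-- Residues modulo primes

∧⇒ : ∀ {x y} → T (x ∧ y) → T x × T y
∧⇒ {x} {y} = Equivalence.to (T-∧ {x} {y})

∨⇒ : ∀ {x y} → T (x ∨ y) → T x ⊎ T y
∨⇒ {x} {y} = Equivalence.to (T-∨ {x} {y})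

∈ᵇ⇒∈ : ∀ c xs → T (any (c ≡ᵇ_) xs) → c ∈ xs
∈ᵇ⇒∈ c xs h = Any.map (ℕ.≡ᵇ⇒≡ c _) (any⁻ (c ≡ᵇ_) xs h)

-- Residues are taken up to sign, since the distance to the integers is an even function; this lets
-- the search work with representatives up to N/2.
data Residue (N : ℕ) (r : ℕ) : ℤ → Set where
  plus  : ∀ z → Residue N r (z ℤ.* + N ℤ.+ + r)
  minus : ∀ z → Residue N r (z ℤ.* + N ℤ.- + r)

residue-* : ∀ {N r x} j → Residue N r x → Residue N (r * j) (x ℤ.* + j)
residue-* {N} {r} j (plus z) = subst (Residue N (r * j))
  (trans (cong (λ y → z ℤ.* + j ℤ.* + N ℤ.+ y) (ℤ.pos-* r j)) (eq z (+ N) (+ r) (+ j))) (plus (z ℤ.* + j))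
  where
  eq : ∀ z n r j → z ℤ.* j ℤ.* n ℤ.+ r ℤ.* j ≡ (z ℤ.* n ℤ.+ r) ℤ.* j
  eq = solve-∀
residue-* {N} {r} j (minus z) = subst (Residue N (r * j))
  (trans (cong (λ y → z ℤ.* + j ℤ.* + N ℤ.- y) (ℤ.pos-* r j)) (eq z (+ N) (+ r) (+ j))) (minus (z ℤ.* + j))
  where
  eq : ∀ z n r j → z ℤ.* j ℤ.* n ℤ.- r ℤ.* j ≡ (z ℤ.* n ℤ.- r) ℤ.* j
  eq = solve-∀

residue-% : ∀ {n r x} → Residue (suc n) r x → Residue (suc n) (r ℕ.% suc n) x
residue-% {n} {r} (plus z) = subst (Residue (suc n) (r ℕ.% suc n))
  (trans (eq z (+ (r ℕ./ suc n)) (+ suc n) (+ (r ℕ.% suc n))) (cong (λ y → z ℤ.* + suc n ℤ.+ y) (sym (divMod r n))))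
  (plus (z ℤ.+ + (r ℕ./ suc n)))
  where
  eq : ∀ z y n r → (z ℤ.+ y) ℤ.* n ℤ.+ r ≡ z ℤ.* n ℤ.+ (y ℤ.* n ℤ.+ r)
  eq = solve-∀
residue-% {n} {r} (minus z) = subst (Residue (suc n) (r ℕ.% suc n))
  (trans (eq z (+ (r ℕ./ suc n)) (+ suc n) (+ (r ℕ.% suc n))) (cong (λ y → z ℤ.* + suc n ℤ.- y) (sym (divMod r n))))
  (minus (z ℤ.- + (r ℕ./ suc n)))
  where
  eq : ∀ z y n r → (z ℤ.- y) ℤ.* n ℤ.- r ≡ z ℤ.* n ℤ.- (y ℤ.* n ℤ.+ r)
  eq = solve-∀

-- Both signs have the same two lifts, because N - r = 2 N - (N + r).
residue-double : ∀ {N r x} → Residue N r x → ∃[ s ] (s ≡ r ⊎ s ≡ N + r) × Residue (N + N) s x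
residue-double {N} {r} (plus z) with z ℤ.%ℕ 2 | ℤ.n%ℕd<d z 2 | ℤ.a≡a%ℕn+[a/ℕn]*n z 2
... | 0 | _ | eq = r , inj₁ refl , subst (Residue (N + N) r)
  (trans (e (z ℤ./ℕ 2) (+ N) (+ r)) (cong (λ y → y ℤ.* + N ℤ.+ + r) (sym eq))) (plus (z ℤ./ℕ 2))
  where
  e : ∀ y n r → y ℤ.* (n ℤ.+ n) ℤ.+ r ≡ (+ 0 ℤ.+ y ℤ.* + 2) ℤ.* n ℤ.+ r
  e = solve-∀
... | 1 | _ | eq = N + r , inj₂ refl , subst (Residue (N + N) (N + r))
  (trans (e (z ℤ./ℕ 2) (+ N) (+ r)) (cong (λ y → y ℤ.* + N ℤ.+ + r) (sym eq))) (plus (z ℤ./ℕ 2))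
  where
  e : ∀ y n r → y ℤ.* (n ℤ.+ n) ℤ.+ (n ℤ.+ r) ≡ (+ 1 ℤ.+ y ℤ.* + 2) ℤ.* n ℤ.+ r
  e = solve-∀
... | suc (suc _) | s≤s (s≤s ()) | _
residue-double {N} {r} (minus z) with z ℤ.%ℕ 2 | ℤ.n%ℕd<d z 2 | ℤ.a≡a%ℕn+[a/ℕn]*n z 2
... | 0 | _ | eq = r , inj₁ refl , subst (Residue (N + N) r)
  (trans (e (z ℤ./ℕ 2) (+ N) (+ r)) (cong (λ y → y ℤ.* + N ℤ.- + r) (sym eq))) (minus (z ℤ./ℕ 2))
  where
  e : ∀ y n r → y ℤ.* (n ℤ.+ n) ℤ.- r ≡ (+ 0 ℤ.+ y ℤ.* + 2) ℤ.* n ℤ.- r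
  e = solve-∀
... | 1 | _ | eq = N + r , inj₂ refl , subst (Residue (N + N) (N + r))
  (trans (e (z ℤ./ℕ 2) (+ N) (+ r)) (cong (λ y → y ℤ.* + N ℤ.- + r) (sym eq))) (minus (z ℤ./ℕ 2 ℤ.+ + 1))
  where
  e : ∀ y n r → (y ℤ.+ + 1) ℤ.* (n ℤ.+ n) ℤ.- (n ℤ.+ r) ≡ (+ 1 ℤ.+ y ℤ.* + 2) ℤ.* n ℤ.- r
  e = solve-∀
... | suc (suc _) | s≤s (s≤s ()) | _

residue-shift : ∀ {N r x} k → Residue N r x → Residue N r (x ℤ.+ k ℤ.* + N)
residue-shift {N} {r} k (plus z) = subst (Residue N r) (e z k (+ N) (+ r)) (plus (z ℤ.+ k))
  where
  e : ∀ z k n r → (z ℤ.+ k) ℤ.* n ℤ.+ r ≡ (z ℤ.* n ℤ.+ r) ℤ.+ k ℤ.* n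
  e = solve-∀
residue-shift {N} {r} k (minus z) = subst (Residue N r) (e z k (+ N) (+ r)) (minus (z ℤ.+ k))
  where
  e : ∀ z k n r → (z ℤ.+ k) ℤ.* n ℤ.- r ≡ (z ℤ.* n ℤ.- r) ℤ.+ k ℤ.* n
  e = solve-∀

n≤1+2⌊n/2⌋ : ∀ n → n ≤ suc (⌊ n /2⌋ + ⌊ n /2⌋)
n≤1+2⌊n/2⌋ 0 = z≤n
n≤1+2⌊n/2⌋ 1 = s≤s z≤n
n≤1+2⌊n/2⌋ (suc (suc n)) = s≤s (subst (suc n ≤_) (cong suc (sym (ℕ.+-suc ⌊ n /2⌋ ⌊ n /2⌋))) (s≤s (n≤1+2⌊n/2⌋ n)))

small-residue : ∀ n x → ¬ suc n ∣ x → ∃[ r ] r ∈ applyUpTo suc ⌊ suc n /2⌋ × Residue (suc n) r (+ x)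
small-residue n x N∤x with ρ ℕ.≤? ⌊ N /2⌋
  where
  N = suc n
  ρ = x ℕ.% N
... | yes ρ≤h = ρ , member ρ≤h ρ≢0 , subst (Residue (suc n) ρ) (sym (divMod x n)) (plus (+ (x ℕ./ suc n)))
  where
  ρ = x ℕ.% suc n
  ρ≢0 : ρ ≢ 0
  ρ≢0 eq = N∤x (∣.m%n≡0⇒n∣m x (suc n) eq)
  member : ∀ {r h} → r ≤ h → r ≢ 0 → r ∈ applyUpTo suc h
  member {zero}  _ r≢0 = contradiction refl r≢0
  member {suc r} r<h _ = ∈-applyUpTo⁺ suc r<h
... | no ρ≰h = N ∸ ρ , member , subst (Residue N (N ∸ ρ)) eq (minus (+ (x ℕ./ N) ℤ.+ + 1))
  where
  N = suc n
  ρ = x ℕ.% N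
  ρ<N : ρ < N
  ρ<N = ℕ.m%n<n x N
  N∸ρ≤h : N ∸ ρ ≤ ⌊ N /2⌋
  N∸ρ≤h = ℕ.m≤n+o⇒m∸n≤o N ρ (ℕ.≤-trans (n≤1+2⌊n/2⌋ N) (ℕ.+-monoˡ-≤ ⌊ N /2⌋ (ℕ.≰⇒> ρ≰h)))
  member : N ∸ ρ ∈ applyUpTo suc ⌊ N /2⌋
  member with N ∸ ρ | ℕ.m<n⇒0<n∸m ρ<N | N∸ρ≤h
  ... | suc r | _ | r<h = ∈-applyUpTo⁺ suc r<h
  d-eq : + (N ∸ ρ) ≡ + N ℤ.- + ρ
  d-eq = sym (trans (ℤ.[+m]-[+n]≡m⊖n N ρ) (ℤ.⊖-≥ (ℕ.<⇒≤ ρ<N)))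
  e : ∀ y n r → (y ℤ.+ + 1) ℤ.* n ℤ.- (n ℤ.- r) ≡ y ℤ.* n ℤ.+ r
  e = solve-∀
  eq : (+ (x ℕ./ N) ℤ.+ + 1) ℤ.* + N ℤ.- + (N ∸ ρ) ≡ + x
  eq = trans (cong (λ y → (+ (x ℕ./ N) ℤ.+ + 1) ℤ.* + N ℤ.- y) d-eq)
    (trans (e (+ (x ℕ./ N)) (+ N) (+ ρ)) (sym (divMod x n)))

inverse : ∀ {v p} → Coprime v p → ∃[ a ] Residue p 1 (+ v ℤ.* + a)
inverse {v} {p} cop with coprime-Bézout cop
... | Bézout.+- x y eq = x , subst (Residue p 1) (trans (cong (ℤ._+ + 1) (sym (ℤ.pos-* y p)))
  (trans (cong +_ (trans (ℕ.+-comm (y * p) 1) (trans eq (ℕ.*-comm x v)))) (ℤ.pos-* v x))) (plus (+ y))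
... | Bézout.-+ x y eq = x , subst (Residue p 1) (trans (cong (ℤ._- + 1) (trans (sym (ℤ.pos-* y p)) (cong +_ (sym eq))))
  (trans (cancel (+ (x * v))) (trans (cong +_ (ℕ.*-comm x v)) (ℤ.pos-* v x)))) (minus (+ y))
  where
  cancel : ∀ m → (+ 1 ℤ.+ m) ℤ.- + 1 ≡ m
  cancel = solve-∀

prime∤⇒coprime : ∀ {p m} → Prime p → ¬ p ∣ m → Coprime p m
prime∤⇒coprime pr p∤m (d∣p , d∣m) with prime⇒irreducible pr d∣p
... | inj₁ d≡1  = d≡1
... | inj₂ refl = contradiction d∣m p∤m

-- An even inverse becomes odd by adding the odd p. Oddness is wanted because coprime speeds times
-- an odd number are not all even, which prunes the lifts to moduli 2 p, 4 p, ....
odd-inverse : ∀ {v p} → ¬ 2 ∣ p → Coprime v p → ∃[ a ] ¬ 2 ∣ a × Residue p 1 (+ v ℤ.* + a)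
odd-inverse {v} {p} 2∤p cop with inverse cop
... | a , res with 2 ∣? a
...   | no 2∤a  = a , 2∤a , res
...   | yes 2∣a = a + p , (λ 2∣a+p → 2∤p (∣.∣m+n∣m⇒∣n 2∣a+p 2∣a)) ,
        subst (Residue p 1) (e (+ v) (+ a) (+ p)) (residue-shift (+ v) res)
  where
  e : ∀ v a p → v ℤ.* a ℤ.+ v ℤ.* p ≡ v ℤ.* (a ℤ.+ p)
  e = solve-∀

residue-1⇒∤ : ∀ {v p a} → 1 < p → Residue p 1 (+ v ℤ.* + a) → ¬ p ∣ a
residue-1⇒∤ {v} {p} {a} 1<p res (divides q a≡qp) = let m , eq = unit (+ v ℤ.* + q) res va in ℕ.<⇒≢ 1<p (sym (ℕ.m*n≡1⇒n≡1 m p eq))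
  where
  va : + v ℤ.* + a ≡ (+ v ℤ.* + q) ℤ.* + p
  va = trans (cong (λ y → + v ℤ.* y) (trans (cong +_ a≡qp) (ℤ.pos-* q p))) (sym (ℤ.*-assoc (+ v) (+ q) (+ p)))
  e₁ : ∀ y z p → y ℤ.* p ≡ z ℤ.* p ℤ.+ + 1 → (y ℤ.- z) ℤ.* p ≡ + 1
  e₁ y z p eq = trans (d y z p) (trans (cong (ℤ._- z ℤ.* p) eq) (c (z ℤ.* p)))
    where
    d : ∀ y z p → (y ℤ.- z) ℤ.* p ≡ y ℤ.* p ℤ.- z ℤ.* p
    d = solve-∀
    c : ∀ x → (x ℤ.+ + 1) ℤ.- x ≡ + 1
    c = solve-∀
  e₂ : ∀ y z p → y ℤ.* p ≡ z ℤ.* p ℤ.- + 1 → (z ℤ.- y) ℤ.* p ≡ + 1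
  e₂ y z p eq = trans (d y z p) (trans (cong (λ x → z ℤ.* p ℤ.- x) eq) (c (z ℤ.* p)))
    where
    d : ∀ y z p → (z ℤ.- y) ℤ.* p ≡ z ℤ.* p ℤ.- y ℤ.* p
    d = solve-∀
    c : ∀ x → x ℤ.- (x ℤ.- + 1) ≡ + 1
    c = solve-∀
  unit : ∀ {x} y → Residue p 1 x → x ≡ y ℤ.* + p → ∃[ m ] m * p ≡ 1
  unit y (plus z)  eq = ℤ.∣ y ℤ.- z ∣ , trans (sym (ℤ.abs-* (y ℤ.- z) (+ p))) (cong ℤ.∣_∣ (e₁ y z (+ p) (sym eq)))
  unit y (minus z) eq = ℤ.∣ z ℤ.- y ∣ , trans (sym (ℤ.abs-* (z ℤ.- y) (+ p))) (cong ℤ.∣_∣ (e₂ y z (+ p) (sym eq)))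

far : (q n x : ℕ) → Bool
far q n x = (suc n <ᵇ q * (x ℕ.% suc n)) ∧ (suc n <ᵇ q * (suc n ∸ x ℕ.% suc n))

norm : (n x : ℕ) → ℕ
norm n x = (x ℕ.% suc n) ⊓ (suc n ∸ x ℕ.% suc n)

residue-away : ∀ {c q N r} → r ≤ N → c ≤ q * r → c ≤ q * (N ∸ r) → Away c q N (+ r)
residue-away {c} {q} {N} {r} r≤N h₁ h₂ = away λ
  { (+ 0)      → subst (λ y → c ≤ q * ℤ.∣ y ∣) (zero* (+ r) (+ N)) h₁
  ; (+ suc z)  → ℕ.≤-trans h₂ (ℕ.*-monoʳ-≤ q (subst (N ∸ r ≤_) (cong ℤ.∣_∣ (pos z)) (ℕ.≤-trans (ℕ.m≤m+n (N ∸ r) (z * N)) (ℕ.≤-reflexive (sym (ℤ.∣-i∣≡∣i∣ (+ (N ∸ r + z * N))))))))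
  ; (-[1+ z ]) → ℕ.≤-trans h₁ (ℕ.*-monoʳ-≤ q (subst (r ≤_) (cong ℤ.∣_∣ (neg z)) (ℕ.m≤m+n r (suc z * N))))
  }
  where
  zero* : ∀ r n → r ≡ r ℤ.- ℤ.0ℤ ℤ.* n
  zero* = solve-∀
  e₁ : ∀ d z n → ℤ.- (d ℤ.+ z ℤ.* n) ≡ (n ℤ.- d) ℤ.- (+ 1 ℤ.+ z) ℤ.* n
  e₁ = solve-∀
  r-eq : + N ℤ.- + (N ∸ r) ≡ + r
  r-eq = trans (ℤ.[+m]-[+n]≡m⊖n N (N ∸ r)) (trans (ℤ.⊖-≥ (ℕ.m∸n≤m N r)) (cong +_ (ℕ.m∸[m∸n]≡n r≤N)))
  pos : ∀ z → ℤ.- (+ (N ∸ r + z * N)) ≡ + r ℤ.- + suc z ℤ.* + N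
  pos z = trans (cong (λ y → ℤ.- (+ (N ∸ r) ℤ.+ y)) (ℤ.pos-* z N))
    (trans (e₁ (+ (N ∸ r)) (+ z) (+ N)) (cong (λ y → y ℤ.- + suc z ℤ.* + N) r-eq))
  e₂ : ∀ r z n → r ℤ.+ z ℤ.* n ≡ r ℤ.- (ℤ.- z) ℤ.* n
  e₂ = solve-∀
  neg : ∀ z → + (r + suc z * N) ≡ + r ℤ.- -[1+ z ] ℤ.* + N
  neg z = trans (cong (λ y → + r ℤ.+ y) (ℤ.pos-* (suc z) N)) (e₂ (+ r) (+ suc z) (+ N))

far⇒away : ∀ {q n r x} → T (far q n r) → Residue (suc n) r x → Away (2 + n) q (suc n) x
far⇒away {q} {n} {r} f res = go (residue-% res)
  where
  N = suc n
  base : Away (suc N) q N (+ (r ℕ.% N))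
  base = residue-away (ℕ.<⇒≤ (ℕ.m%n<n r N)) (ℕ.<ᵇ⇒< N _ (proj₁ (∧⇒ f))) (ℕ.<ᵇ⇒< N _ (proj₂ (∧⇒ {suc n <ᵇ q * (r ℕ.% suc n)} f)))
  go : ∀ {x} → Residue N (r ℕ.% N) x → Away (suc N) q N x
  go (plus z)  = subst (Away (suc N) q N) (ℤ.+-comm (+ (r ℕ.% N)) (z ℤ.* + N)) (away-cong z base)
  go (minus z) = subst (Away (suc N) q N) (ℤ.+-comm (ℤ.- + (r ℕ.% N)) (z ℤ.* + N)) (away-cong z (away-neg base))

residue-norm : ∀ {n r x} → Residue (suc n) r x → ∃[ e ] (∃[ w ] x ≡ w ℤ.* + suc n ℤ.+ e) × ℤ.∣ e ∣ ≡ norm n r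
residue-norm {n} {r} res = go (residue-% res)
  where
  N = suc n
  ρ = r ℕ.% N
  ρ≤N : ρ ≤ N
  ρ≤N = ℕ.<⇒≤ (ℕ.m%n<n r N)
  d-eq : + (N ∸ ρ) ≡ + N ℤ.- + ρ
  d-eq = sym (trans (ℤ.[+m]-[+n]≡m⊖n N ρ) (ℤ.⊖-≥ ρ≤N))
  go : ∀ {x} → Residue N ρ x → ∃[ e ] (∃[ w ] x ≡ w ℤ.* + N ℤ.+ e) × ℤ.∣ e ∣ ≡ norm n r
  go (plus z) with ℕ.≤-total ρ (N ∸ ρ)
  ... | inj₁ le = + ρ , (z , refl) , sym (ℕ.m≤n⇒m⊓n≡m le)
  ... | inj₂ ge = ℤ.- + (N ∸ ρ) , (z ℤ.+ + 1 , trans (e z (+ N) (+ ρ)) (cong (λ y → (z ℤ.+ + 1) ℤ.* + N ℤ.- y) (sym d-eq))) ,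
        trans (ℤ.∣-i∣≡∣i∣ (+ (N ∸ ρ))) (sym (ℕ.m≥n⇒m⊓n≡n ge))
    where
    e : ∀ z n r → z ℤ.* n ℤ.+ r ≡ (z ℤ.+ + 1) ℤ.* n ℤ.- (n ℤ.- r)
    e = solve-∀
  go (minus z) with ℕ.≤-total ρ (N ∸ ρ)
  ... | inj₁ le = ℤ.- + ρ , (z , refl) , trans (ℤ.∣-i∣≡∣i∣ (+ ρ)) (sym (ℕ.m≤n⇒m⊓n≡m le))
  ... | inj₂ ge = + (N ∸ ρ) , (z ℤ.- + 1 , trans (e z (+ N) (+ ρ)) (cong (λ y → (z ℤ.- + 1) ℤ.* + N ℤ.+ y) (sym d-eq))) ,
        sym (ℕ.m≥n⇒m⊓n≡n ge)
    where
    e : ∀ z n r → z ℤ.* n ℤ.- r ≡ (z ℤ.- + 1) ℤ.* n ℤ.+ (n ℤ.- r)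
    e = solve-∀

-- `vs` and the multiples g c are compared as sets, so the order in which the search meets the
-- runners does not matter.
Tight : List (List ℕ) → List ℕ → Set
Tight excs vs = ∃[ cs ] cs ∈ excs × ∃[ g ] 0 < g × All (λ c → g * c ∈ vs) cs × All (_∈ map (g *_) cs) vs

range : ℕ → List ℕ
range = applyUpTo suc

-- The search over residues and its soundness

module Sieve (k : ℕ) (excs : List (List ℕ)) where

  Outcome : List ℕ → Set
  Outcome vs = StrictlyLonely (2 + k) vs ⊎ Tight excs vs

  outcome-resp-↭ : ∀ {vs ws} → vs ↭ ws → Outcome vs → Outcome ws
  outcome-resp-↭ perm (inj₁ strict) = inj₁ (strictlyLonely-resp-↭ perm strict)
  outcome-resp-↭ perm (inj₂ (cs , cs∈ , g , 0<g , h₁ , h₂)) =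
    inj₂ (cs , cs∈ , g , 0<g , All.map (∈-resp-↭ perm) h₁ , All-resp-↭ perm h₂)

  -- Tests on the vector w of distances to the integers at a time when all of them are short; speeds
  -- parallel to w are impossible if w is mixed, and known if it is exceptional.
  exceptional : List ℕ → Bool
  exceptional w = any (1 ≡ᵇ_) w ∧ any (λ cs → all (λ c → any (c ≡ᵇ_) w) cs ∧ all (λ c → any (c ≡ᵇ_) cs) w) excs

  mixed : List ℕ → Bool
  mixed w = any (0 ≡ᵇ_) w ∧ any (0 <ᵇ_) w

  -- At time j/(n + 1), `good` shows strict loneliness directly. `short` is the premise of the
  -- dichotomy between strict loneliness and a position parallel to the speeds; in the parallel case
  -- the vector of norms decides.
  good short : (n : ℕ) → List ℕ → ℕ → Bool
  good n rs j = all (λ r → far (2 + k) n (r * j)) rs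
  short n rs j = all (λ r → suc k * suc (suc k) * norm n (r * j) <ᵇ 2 * suc n) rs ∧
    (let w = map (λ r → norm n (r * j)) rs in mixed w ∨ exceptional w)

  settled : (n : ℕ) → List ℕ → Bool
  settled n rs = any (good n rs) (range ⌊ suc n /2⌋) ∨ any (short n rs) (range ⌊ suc n /2⌋)

  -- The continuation receives one lift at a time, so the 2^(length rs) lifts need not be collected
  -- in a list.
  lifts : ℕ → List ℕ → (List ℕ → Bool) → Bool
  lifts N []       κ = κ []
  lifts N (r ∷ rs) κ = lifts N rs (λ ss → κ (r ∷ ss)) ∧ lifts N rs (λ ss → κ (N + r ∷ ss))

  -- Residues modulo n + 1 that are not settled are lifted to modulus 2 (n + 1); they cannot all be even,
  -- because the speeds are coprime and are multiplied by an odd number.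
  resolve : (depth n : ℕ) → List ℕ → Bool
  resolve zero    n rs = settled n rs
  resolve (suc d) n rs = settled n rs ∨
    lifts (suc n) rs (λ ss → all (λ s → s ℕ.% 2 ≡ᵇ 0) ss ∨ resolve d (n + suc n) ss)

  -- rs are residues up to sign of the runners fixed so far, m runners remain, and js are the times at which
  -- all of rs are far from 0. If such a j exists, one of the remaining runners must be close to 0 at time j.
  search : (n m : ℕ) → List ℕ → List ℕ → Bool
  -- At most five doublings, that is moduli up to 32 p, are enough for all the listed primes.
  search n zero    []       rs = resolve 5 n rs
  search n zero    (_ ∷ _)  rs = true
  search n (suc m) []       rs = all (λ r → search n m [] (r ∷ rs)) (range ⌊ suc n /2⌋)
  search n (suc m) (j ∷ js) rs = all (λ r → far (2 + k) n (r * j) ∨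
    search n m (filterᵇ (λ i → far (2 + k) n (r * i)) js) (r ∷ rs)) (range ⌊ suc n /2⌋)

  -- `n` is p - 1. Multiplying time by an inverse of one speed gives that runner the residue 1 and
  -- leaves k runners to place; times beyond p/2 are mirror images.
  sieve : ℕ → Bool
  sieve n = search n k (filterᵇ (λ i → far (2 + k) n (1 * i)) (range ⌊ suc n /2⌋)) (1 ∷ [])

  -- A record, so that comparing two instances of this type does not run the search.
  record Sifted (ps : List ℕ) : Set where
    constructor sifted
    field runs : all (sieve ∘ pred) ps ≡ true

  -- As speeds are positive, a zero entry forces c₀ = 0, and then every entry vanishes.
  parallel-mixed : ∀ {v₀ c₀ vs w} → 0 < v₀ → All (0 <_) vs →
    Pointwise (λ v c → c * v₀ ≡ c₀ * v) vs w → T (mixed w) → Outcome vs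
  parallel-mixed {v₀} {c₀} {vs} {w} 0<v₀ pos par mix =
    contradiction (hasZero pos par (∈ᵇ⇒∈ 0 w (proj₁ (∧⇒ mix))))
      (λ c₀≡0 → noPos c₀≡0 par (any⁻ (0 <ᵇ_) w (proj₂ (∧⇒ {any (0 ≡ᵇ_) w} mix))))
    where
    hasZero : ∀ {vs w} → All (0 <_) vs → Pointwise (λ v c → c * v₀ ≡ c₀ * v) vs w → 0 ∈ w → c₀ ≡ 0
    hasZero (0<v ∷ _) (eq ∷ _) (here refl) with ℕ.m*n≡0⇒m≡0∨n≡0 c₀ (sym eq)
    ... | inj₁ c₀≡0 = c₀≡0
    ... | inj₂ refl = contradiction 0<v λ ()
    hasZero (_ ∷ pos) (_ ∷ par) (there z) = hasZero pos par z
    noPos : c₀ ≡ 0 → ∀ {vs w} → Pointwise (λ v c → c * v₀ ≡ c₀ * v) vs w → ¬ Any (λ c → T (0 <ᵇ c)) w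
    noPos refl {w = c ∷ _} (eq ∷ _) (here 0<c) with ℕ.m*n≡0⇒m≡0∨n≡0 c eq
    ... | inj₁ refl = 0<c
    ... | inj₂ refl = contradiction 0<v₀ λ ()
    noPos eq₀ (_ ∷ par) (there p) = noPos eq₀ par p

  parallel-exceptional : ∀ {v₀ c₀ vs w} → 0 < v₀ →
    Pointwise (λ v c → c * v₀ ≡ c₀ * v) vs w → T (exceptional w) → Outcome vs
  parallel-exceptional {v₀} {c₀} {vs} {w} 0<v₀ par exc
    with unit par (∈ᵇ⇒∈ 1 w (proj₁ (∧⇒ exc)))
    where
    -- The speed of the runner with entry 1 is the common factor g.
    unit : ∀ {vs w} → Pointwise (λ v c → c * v₀ ≡ c₀ * v) vs w → 1 ∈ w → ∃[ g ] v₀ ≡ c₀ * g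
    unit {v ∷ _} (eq ∷ _) (here refl) = v , trans (sym (ℕ.*-identityˡ v₀)) eq
    unit (_ ∷ par) (there i) = unit par i
  ... | g , refl = inj₂ (cs , cs∈ , g , 0<g ,
      All.map (λ {c} h → ∈-vs multiples (∈ᵇ⇒∈ c w h)) (All.all⁺ _ cs (proj₁ (∧⇒ both))) ,
      vs-∈ multiples (All.all⁺ _ w (proj₂ (∧⇒ {all (λ c → any (c ≡ᵇ_) w) cs} both))))
    where
    match : ∃[ cs ] cs ∈ excs × T (all (λ c → any (c ≡ᵇ_) w) cs ∧ all (λ c → any (c ≡ᵇ_) cs) w)
    match = find excs (any⁻ _ excs (proj₂ (∧⇒ {any (1 ≡ᵇ_) w} exc)))
      where
      find : ∀ {P : List ℕ → Set} xs → Any P xs → ∃[ x ] x ∈ xs × P x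
      find (x ∷ _) (here p) = x , here refl , p
      find (_ ∷ xs) (there p) with find xs p
      ... | x , i , q = x , there i , q
    cs = proj₁ match
    cs∈ = proj₁ (proj₂ match)
    both = proj₂ (proj₂ match)
    instance
      c₀≢0 : ℕ.NonZero c₀
      c₀≢0 = ℕ.m*n≢0⇒m≢0 c₀ {{ℕ.>-nonZero 0<v₀}}
    0<g : 0 < g
    0<g = ℕ.>-nonZero⁻¹ g {{ℕ.m*n≢0⇒n≢0 c₀ {{ℕ.>-nonZero 0<v₀}}}}
    multiples : Pointwise (λ v c → v ≡ g * c) vs w
    multiples = Pointwise.map (λ {v} {c} eq → ℕ.*-cancelˡ-≡ v (g * c) c₀ (trans (sym eq) (swap* c c₀ g))) par
      where
      swap* : ∀ c d g → c * (d * g) ≡ d * (g * c)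
      swap* = ℕRing.solve-∀
    ∈-vs : ∀ {vs w c} → Pointwise (λ v c → v ≡ g * c) vs w → c ∈ w → g * c ∈ vs
    ∈-vs (eq ∷ _) (here refl) = here (sym eq)
    ∈-vs (_ ∷ m) (there i) = there (∈-vs m i)
    vs-∈ : ∀ {vs w} → Pointwise (λ v c → v ≡ g * c) vs w → All (λ c → T (any (c ≡ᵇ_) cs)) w → All (_∈ map (g *_) cs) vs
    vs-∈ [] [] = []
    vs-∈ {w = c ∷ _} (refl ∷ m) (h ∷ hs) = ∈-map⁺ (g *_) (∈ᵇ⇒∈ c cs h) ∷ vs-∈ m hs

  parallel-sound : ∀ {v₀} c₀ {vs} w → 0 < v₀ → All (0 <_) vs →
    Pointwise (λ v c → c * v₀ ≡ c₀ * v) vs w → T (mixed w ∨ exceptional w) → Outcome vs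
  parallel-sound c₀ w 0<v₀ pos par h with ∨⇒ {mixed w} h
  ... | inj₁ mix = parallel-mixed {c₀ = c₀} {w = w} 0<v₀ pos par mix
  ... | inj₂ exc = parallel-exceptional {c₀ = c₀} {w = w} 0<v₀ par exc

  module _ (lr : LonelyRunner k) where

    settled-sound : ∀ n a {vs rs} → All (0 <_) vs → length vs ≡ suc k →
      Pointwise (λ v r → Residue (suc n) r (+ v ℤ.* + a)) vs rs → T (settled n rs) → Outcome vs
    settled-sound n a {vs} {rs} pos len res h with ∨⇒ {any (good n rs) (range ⌊ suc n /2⌋)} h
    ... | inj₁ isGood with Any.satisfied (any⁻ (good n rs) (range ⌊ suc n /2⌋) isGood)
    ...   | j , isGoodⱼ = inj₁ (suc n , + a ℤ.* + j , s≤s z≤n , go res (All.all⁺ _ rs isGoodⱼ))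
      where
      go : ∀ {vs rs} → Pointwise (λ v r → Residue (suc n) r (+ v ℤ.* + a)) vs rs →
           All (λ r → T (far (2 + k) n (r * j))) rs →
           All (λ v → Away (2 + n) (2 + k) (suc n) (+ v ℤ.* (+ a ℤ.* + j))) vs
      go [] [] = []
      go {v ∷ _} (r ∷ rs) (f ∷ fs) = subst (Away (2 + n) (2 + k) (suc n)) (ℤ.*-assoc (+ v) (+ a) (+ j))
        (far⇒away f (residue-* j r)) ∷ go rs fs
    settled-sound n a {v₀ ∷ vs} {r₀ ∷ rs} pos len res h | inj₂ isShort
      with Any.satisfied (any⁻ (short n (r₀ ∷ rs)) (range ⌊ suc n /2⌋) isShort)
    ...   | j , isShortⱼ with collect res (All.all⁺ _ (r₀ ∷ rs) (proj₁ (∧⇒ {all (λ r → suc k * suc (suc k) * norm n (r * j) <ᵇ 2 * suc n) (r₀ ∷ rs)} isShortⱼ)))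
      where
      collect : ∀ {vs rs} → Pointwise (λ v r → Residue (suc n) r (+ v ℤ.* + a)) vs rs →
        All (λ r → T (suc k * suc (suc k) * norm n (r * j) <ᵇ 2 * suc n)) rs →
        ∃[ es ] Pointwise (Near (suc k) (+ a ℤ.* + j) (suc n)) vs es ×
                Pointwise (λ e c → ℤ.∣ e ∣ ≡ c) es (map (λ r → norm n (r * j)) rs)
      collect [] [] = [] , [] , []
      collect {v ∷ _} {r ∷ _} (res ∷ ress) (s ∷ ss) with residue-norm (residue-* j res) | collect ress ss
      ... | e , (w , eq) , abs | es , nears , abss = e ∷ es ,
        ((w , trans (sym (ℤ.*-assoc (+ v) (+ a) (+ j))) eq) ,
          ℕ.<ᵇ⇒< (suc k * suc (suc k) * ℤ.∣ e ∣) (2 * suc n) (subst (λ m → T (suc k * suc (suc k) * m <ᵇ 2 * suc n)) (sym abs) s)) ∷ nears ,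
        abs ∷ abss
    ... | e₀ ∷ es , nears , abs₀ ∷ abss
      with near⇒strictlyLonely∨parallel k (+ a ℤ.* + j) (suc n) lr (s≤s z≤n) pos len nears
    ...   | inj₁ strict = inj₁ strict
    ...   | inj₂ par = parallel-sound (norm n (r₀ * j)) (map (λ r → norm n (r * j)) (r₀ ∷ rs)) (All.head pos) pos
      (refl ∷ absolute par abss)
      (proj₂ (∧⇒ {all (λ r → suc k * suc (suc k) * norm n (r * j) <ᵇ 2 * suc n) (r₀ ∷ rs)} isShortⱼ))
      where
      absolute : ∀ {vs es w} → Pointwise (λ v e → e ℤ.* + v₀ ≡ e₀ ℤ.* + v) vs es →
        Pointwise (λ e c → ℤ.∣ e ∣ ≡ c) es w → Pointwise (λ v c → c * v₀ ≡ norm n (r₀ * j) * v) vs w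
      absolute [] [] = []
      absolute {v ∷ _} {e ∷ _} (p ∷ ps) (refl ∷ as) = trans (sym (ℤ.abs-* e (+ v₀)))
        (trans (cong ℤ.∣_∣ p) (trans (ℤ.abs-* e₀ (+ v)) (cong (_* v) abs₀))) ∷ absolute ps as

    lifts-sound : ∀ N {rs ss} κ → T (lifts N rs κ) → Pointwise (λ r s → s ≡ r ⊎ s ≡ N + r) rs ss → T (κ ss)
    lifts-sound N κ h [] = h
    lifts-sound N {r ∷ rs} κ h (inj₁ refl ∷ ps) = lifts-sound N (κ ∘ (r ∷_)) (proj₁ (∧⇒ h)) ps
    lifts-sound N {r ∷ rs} κ h (inj₂ refl ∷ ps) =
      lifts-sound N (κ ∘ ((N + r) ∷_)) (proj₂ (∧⇒ {lifts N rs (λ ss → κ (r ∷ ss))} h)) ps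

    residue-even : ∀ {N s v a} → s ℕ.% 2 ≡ 0 → Residue (N + N) s (+ v ℤ.* + a) → 2 ∣ v * a
    residue-even {N} {s} {v} {a} s%2≡0 res with + v ℤ.* + a in eq | res
    ... | _ | plus z  = divides ℤ.∣ z ℤ.* + N ℤ.+ + t ∣ (trans (sym (ℤ.abs-* (+ v) (+ a))) (trans (cong ℤ.∣_∣
            (trans eq (trans (cong (λ y → z ℤ.* + (N + N) ℤ.+ + y) s≡) (trans (cong (λ y → z ℤ.* + (N + N) ℤ.+ y) (ℤ.pos-* t 2)) (e z (+ N) (+ t))))))
            (ℤ.abs-* (z ℤ.* + N ℤ.+ + t) (+ 2))))
      where
      t = s ℕ./ 2
      s≡ : s ≡ t * 2
      s≡ = trans (ℕ.m≡m%n+[m/n]*n s 2) (cong (_+ t * 2) s%2≡0)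
      e : ∀ z n t → z ℤ.* (n ℤ.+ n) ℤ.+ t ℤ.* + 2 ≡ (z ℤ.* n ℤ.+ t) ℤ.* + 2
      e = solve-∀
    ... | _ | minus z = divides ℤ.∣ z ℤ.* + N ℤ.- + t ∣ (trans (sym (ℤ.abs-* (+ v) (+ a))) (trans (cong ℤ.∣_∣
            (trans eq (trans (cong (λ y → z ℤ.* + (N + N) ℤ.- + y) s≡) (trans (cong (λ y → z ℤ.* + (N + N) ℤ.- y) (ℤ.pos-* t 2)) (e z (+ N) (+ t))))))
            (ℤ.abs-* (z ℤ.* + N ℤ.- + t) (+ 2))))
      where
      t = s ℕ./ 2
      s≡ : s ≡ t * 2
      s≡ = trans (ℕ.m≡m%n+[m/n]*n s 2) (cong (_+ t * 2) s%2≡0)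
      e : ∀ z n t → z ℤ.* (n ℤ.+ n) ℤ.- t ℤ.* + 2 ≡ (z ℤ.* n ℤ.- t) ℤ.* + 2
      e = solve-∀

    resolve-sound : ∀ d n a {vs rs} → All (0 <_) vs → length vs ≡ suc k → ¬ All (λ v → 2 ∣ v * a) vs →
      Pointwise (λ v r → Residue (suc n) r (+ v ℤ.* + a)) vs rs → T (resolve d n rs) → Outcome vs
    resolve-sound zero    n a pos len odd res h = settled-sound n a pos len res h
    resolve-sound (suc d) n a {vs} {rs} pos len odd res h with ∨⇒ {settled n rs} h
    ... | inj₁ s = settled-sound n a pos len res s
    ... | inj₂ l with double res
      where
      double : ∀ {vs rs} → Pointwise (λ v r → Residue (suc n) r (+ v ℤ.* + a)) vs rs →
        ∃[ ss ] Pointwise (λ r s → s ≡ r ⊎ s ≡ suc n + r) rs ss ×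
                Pointwise (λ v s → Residue (suc n + suc n) s (+ v ℤ.* + a)) vs ss
      double [] = [] , [] , []
      double (r ∷ rs) with residue-double r | double rs
      ... | s , s≡ , sr | ss , ss≡ , srs = s ∷ ss , s≡ ∷ ss≡ , sr ∷ srs
    ... | ss , ss≡ , res′ with ∨⇒ {all (λ s → s ℕ.% 2 ≡ᵇ 0) ss} (lifts-sound (suc n) (λ ss → all (λ s → s ℕ.% 2 ≡ᵇ 0) ss ∨ resolve d (n + suc n) ss) l ss≡)
    ...   | inj₁ even = contradiction (evens res′ (All.all⁺ _ ss even)) odd
      where
      evens : ∀ {vs ss} → Pointwise (λ v s → Residue (suc n + suc n) s (+ v ℤ.* + a)) vs ss →
              All (λ s → T (s ℕ.% 2 ≡ᵇ 0)) ss → All (λ v → 2 ∣ v * a) vs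
      evens [] [] = []
      evens {v ∷ _} {s ∷ _} (r ∷ rs) (e ∷ es) = residue-even {suc n} {s} {v} {a} (ℕ.≡ᵇ⇒≡ (s ℕ.% 2) 0 e) r ∷ evens rs es
    ...   | inj₂ h′ = resolve-sound d (n + suc n) a pos len odd res′ h′

    module Runners (n a : ℕ) where

      record Runner : Set where
        constructor runner
        field
          speed res : ℕ
          positive  : 0 < speed
          residue   : Residue (suc n) res (+ speed ℤ.* + a)
      open Runner

      pointwise : ∀ xs → Pointwise (λ v r → Residue (suc n) r (+ v ℤ.* + a)) (map speed xs) (map res xs)
      pointwise [] = []
      pointwise (x ∷ xs) = residue x ∷ pointwise xs

      FarAt : ℕ → Runner → Set
      FarAt j x = T (far (2 + k) n (res x * j))

      allFar⇒strictlyLonely : ∀ j {xs} → All (FarAt j) xs → StrictlyLonely (2 + k) (map speed xs)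
      allFar⇒strictlyLonely j f = suc n , + a ℤ.* + j , s≤s z≤n , All.map⁺ (All.map (λ {x} fx →
        subst (Away (2 + n) (2 + k) (suc n)) (ℤ.*-assoc (+ speed x) (+ a) (+ j))
          (far⇒away fx (residue-* j (residue x)))) f)

      allFar-or-extract : ∀ j ys → All (FarAt j) ys ⊎ ∃[ y ] ∃[ zs ] ys ↭ y ∷ zs × ¬ FarAt j y
      allFar-or-extract j [] = inj₁ []
      allFar-or-extract j (y ∷ ys) with T? (far (2 + k) n (res y * j)) | allFar-or-extract j ys
      ... | no ¬f | _ = inj₂ (y , ys , ↭-refl , ¬f)
      ... | yes f | inj₁ fs = inj₁ (f ∷ fs)
      ... | yes f | inj₂ (z , zs , perm , ¬f) = inj₂ (z , y ∷ zs , ↭-trans (prep y perm) (swap y z ↭-refl) , ¬f)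

      -- `xs` are the runners already placed and `ys` the others. The next runner to place is one of
      -- `ys` that is not far at time j, so the proof chooses the order of the runners and carries
      -- permutations along; if there is none, j itself is a strictly lonely time.
      search-sound : ∀ m js xs ys → length ys ≡ m → length (ys ++ xs) ≡ suc k →
        All (λ y → res y ∈ range ⌊ suc n /2⌋) ys → ¬ All (λ v → 2 ∣ v * a) (map speed (ys ++ xs)) →
        All (λ j → All (FarAt j) xs) js → T (search n m js (map res xs)) → Outcome (map speed (ys ++ xs))
      search-sound zero [] xs [] _ len _ odd _ h =
        resolve-sound 5 n a (All.map⁺ (All.universal positive xs)) (trans (length-map speed xs) len) odd (pointwise xs) h
      search-sound zero (j ∷ js) xs [] _ _ _ _ (f ∷ _) _ = inj₁ (allFar⇒strictlyLonely j f)
      search-sound (suc m) [] xs (y ∷ ys) len len′ (y∈ ∷ ys∈) odd _ h =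
        outcome-resp-↭ (Perm.map⁺ speed perm) (search-sound m [] (y ∷ xs) ys (ℕ.suc-injective len)
          (trans (↭-length perm) len′) ys∈ (odd ∘ All-resp-↭ (Perm.map⁺ speed perm)) []
          (All.lookup (All.all⁺ _ (range ⌊ suc n /2⌋) h) y∈))
        where
        perm : ys ++ y ∷ xs ↭ y ∷ ys ++ xs
        perm = Perm.shift y ys xs
      search-sound (suc m) (j ∷ js) xs ys len len′ ys∈ odd (f ∷ fs) h with allFar-or-extract j ys
      ... | inj₁ fy = inj₁ (allFar⇒strictlyLonely j (All.++⁺ fy f))
      ... | inj₂ (y , zs , ys↭ , ¬f) with All-resp-↭ ys↭ ys∈
      ...   | y∈ ∷ zs∈ with ∨⇒ {far (2 + k) n (res y * j)} (All.lookup (All.all⁺ _ (range ⌊ suc n /2⌋) h) y∈)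
      ...     | inj₁ fy = contradiction fy ¬f
      ...     | inj₂ h′ = outcome-resp-↭ (Perm.map⁺ speed perm) (search-sound m _ (y ∷ xs) zs
          (ℕ.suc-injective (trans (sym (↭-length ys↭)) len)) (trans (↭-length perm) len′) zs∈
          (odd ∘ All-resp-↭ (Perm.map⁺ speed perm))
          (All.map (λ (p , q) → p ∷ q) (All.zip (All.all-filter isFar? js , All.filter⁺ isFar? fs))) h′)
        where
        isFar? = λ i → T? (far (2 + k) n (res y * i))
        perm : zs ++ y ∷ xs ↭ ys ++ xs
        perm = ↭-trans (Perm.shift y zs xs) (Perm.++⁺ʳ xs (↭-sym ys↭))

    sieve-sound : ∀ {n} → Prime (suc n) → ¬ 2 ∣ suc n → ∀ vs → All (0 <_) vs → length vs ≡ suc k →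
      gcdₗ vs ≡ 1 → All (λ v → ¬ suc n ∣ v) vs → T (sieve n) → Outcome vs
    sieve-sound {n} pr 2∤p (v ∷ vs) (0<v ∷ pos) len gcd≡1 (p∤v ∷ p∤vs) h
      with odd-inverse {v} 2∤p (Coprime.sym (prime∤⇒coprime pr p∤v))
    ... | a , 2∤a , res₁ = subst Outcome eq (outcome-resp-↭ (Perm.map⁺ speed perm)
          (search-sound k _ (x ∷ []) (proj₁ ys) (ℕ.suc-injective (trans (cong suc len-ys) len))
            (trans (↭-length perm) (trans (cong suc len-ys) len))
            (proj₂ (proj₂ ys))
            (λ even → 2∤a (∣-a (subst (All (λ v → 2 ∣ v * a)) eq (All-resp-↭ (Perm.map⁺ speed perm) even))))
            (All.map (_∷ []) (All.all-filter (λ i → T? (far (2 + k) n (1 * i))) (range ⌊ suc n /2⌋))) h))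
      where
      open Runners n a
      open Runner
      1<p : 1 < suc n
      1<p = ℕ.nonTrivial⇒n>1 (suc n) {{prime⇒nonTrivial pr}}
      x : Runner
      x = runner v 1 0<v res₁
      others : ∀ {vs} → All (0 <_) vs → All (λ v → ¬ suc n ∣ v) vs →
        ∃[ ys ] map speed ys ≡ vs × All (λ y → res y ∈ range ⌊ suc n /2⌋) ys
      others [] [] = [] , refl , []
      others {u ∷ _} (0<u ∷ pos) (p∤u ∷ p∤us) with others pos p∤us | small-residue n (u * a)
        (Sum.[ p∤u , residue-1⇒∤ {v} 1<p res₁ ]′ ∘ euclidsLemma u a pr)
      ... | ys , refl , ys∈ | r , r∈ , res = runner u r 0<u (subst (Residue (suc n) r) (ℤ.pos-* u a) res) ∷ ys , refl , r∈ ∷ ys∈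
      ys = others pos p∤vs
      len-ys : length (proj₁ ys) ≡ length vs
      len-ys = trans (sym (length-map speed (proj₁ ys))) (cong length (proj₁ (proj₂ ys)))
      perm : proj₁ ys ++ x ∷ [] ↭ x ∷ proj₁ ys
      perm = Perm.++-comm (proj₁ ys) (x ∷ [])
      eq : map speed (x ∷ proj₁ ys) ≡ v ∷ vs
      eq = cong (v ∷_) (proj₁ (proj₂ ys))
      ∣-a : All (λ v → 2 ∣ v * a) (v ∷ vs) → 2 ∣ a
      ∣-a all2 = subst (2 ∣_) (trans (cong (_* a) gcd≡1) (ℕ.*-identityˡ a)) (∣-gcdₗ* {vs = v ∷ vs} all2)

-- Classification of tight speeds

gcdₗ-∣ : ∀ vs → All (gcdₗ vs ∣_) vs
gcdₗ-∣ [] = []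
gcdₗ-∣ (v ∷ vs) = gcd[m,n]∣m v (gcdₗ vs) ∷ All.map (∣.∣-trans (gcd[m,n]∣n v (gcdₗ vs))) (gcdₗ-∣ vs)

∣-gcdₗ : ∀ {d vs} → All (d ∣_) vs → d ∣ gcdₗ vs
∣-gcdₗ {d} [] = d ∣.∣0
∣-gcdₗ (h ∷ hs) = gcd-greatest h (∣-gcdₗ hs)

gcdₗ-resp-↭ : ∀ {vs ws} → vs ↭ ws → gcdₗ vs ≡ gcdₗ ws
gcdₗ-resp-↭ {vs} {ws} perm = ∣.∣-antisym (∣-gcdₗ (All-resp-↭ perm (gcdₗ-∣ vs)))
  (∣-gcdₗ (All-resp-↭ (↭-sym perm) (gcdₗ-∣ ws)))

gcdₗ-map : ∀ g us → gcdₗ (map (g *_) us) ≡ g * gcdₗ us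
gcdₗ-map g [] = sym (ℕ.*-zeroʳ g)
gcdₗ-map g (u ∷ us) = trans (cong (gcd (g * u)) (gcdₗ-map g us)) (sym (c*gcd[m,n]≡gcd[cm,cn] g u (gcdₗ us)))

divide-out : ∀ {g vs} → All (g ∣_) vs → ∃[ us ] vs ≡ map (g *_) us
divide-out [] = [] , refl
divide-out {g} (divides q refl ∷ hs) with divide-out hs
... | us , refl = q ∷ us , cong (_∷ map (g *_) us) (ℕ.*-comm q g)

∤⇒away : ∀ {n c} → ¬ n ∣ c → Away n n n (+ c)
∤⇒away {n} {c} n∤c = away λ z → subst (_≤ n * ℤ.∣ + c ℤ.- z ℤ.* + n ∣) (ℕ.*-identityʳ n)
  (ℕ.*-monoʳ-≤ n (ℕ.n≢0⇒n>0 λ eq → n∤c (divides ℤ.∣ z ∣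
    (trans (cong ℤ.∣_∣ (ℤ.i-j≡0⇒i≡j (+ c) (z ℤ.* + n) (ℤ.∣i∣≡0⇒i≡0 eq))) (ℤ.abs-* z (+ n))))))

-- At time 1/(g n) the runner g c stands at c/n, which is not an integer.
multiples-lonely : ∀ {n g cs vs} → 0 < n → 0 < g → All (λ c → ¬ n ∣ c) cs → All (_∈ map (g *_) cs) vs → Lonely n vs
multiples-lonely {n} {g} {cs} 0<n 0<g n∤cs vs∈ = g * n , + 1 , ℕ.*-mono-< 0<g 0<n , All.map awayᵥ vs∈
  where
  awayᵥ : ∀ {v} → v ∈ map (g *_) cs → Away (g * n) n (g * n) (+ v ℤ.* + 1)
  awayᵥ v∈ with ∈-map⁻ (g *_) v∈
  ... | c , c∈ , refl = subst (Away (g * n) n (g * n)) (trans (sym (ℤ.pos-* g c)) (sym (ℤ.*-identityʳ (+ (g * c)))))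
    (away-scale g (∤⇒away (All.lookup n∤cs c∈)))

away-weaken : ∀ {c c′ q N x} → c′ ≤ c → Away c q N x → Away c′ q N x
away-weaken c′≤c (away h) = away λ z → ℕ.≤-trans c′≤c (h z)

lonelyRunner-1 : LonelyRunner 1
lonelyRunner-1 (v ∷ []) _ (0<v ∷ []) =
  multiples-lonely (s≤s z≤n) 0<v (from-yes (¬? (2 ∣? 1)) ∷ []) (here (sym (ℕ.*-identityʳ v)) ∷ [])

product≤ : ∀ {b vs} → All (_≤ b) vs → product vs ≤ b ^ length vs
product≤ [] = s≤s z≤n
product≤ (h ∷ hs) = ℕ.*-mono-≤ h (product≤ hs)

product>0 : ∀ {vs} → All (0 <_) vs → 0 < product vs
product>0 [] = s≤s z≤n
product>0 (h ∷ hs) = ℕ.*-mono-< h (product>0 hs)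

extract : ∀ {P : ℕ → Set} {vs} → Any P vs → ∃[ v ] ∃[ us ] vs ↭ v ∷ us × P v
extract {vs = v ∷ vs} (here p) = v , vs , ↭-refl , p
extract {vs = v ∷ vs} (there i) with extract i
... | u , us , perm , p = u , v ∷ us , ↭-trans (prep v perm) (swap v u ↭-refl) , p

∣product : ∀ {p vs} → Any (p ∣_) vs → p ∣ product vs
∣product {vs = v ∷ vs} (here p∣v) = ∣.∣m⇒∣m*n (product vs) p∣v
∣product {vs = v ∷ vs} (there i) = ∣.∣n⇒∣m*n v (∣product i)

DistinctOddPrimes : List ℕ → Set
DistinctOddPrimes [] = ⊤
DistinctOddPrimes (p ∷ ps) = Prime p × ¬ 2 ∣ p × ¬ p ∣ product ps × DistinctOddPrimes ps

product-∣ : ∀ {ps m} → DistinctOddPrimes ps → All (_∣ m) ps → product ps ∣ m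
product-∣ {m = m} _ [] = ∣.1∣ m
product-∣ {p ∷ ps} (pr , _ , p∤ps , distinct) (p∣m ∷ ps∣m) with product-∣ distinct ps∣m
... | divides q refl with coprime-divisor (prime∤⇒coprime pr p∤ps) (subst (p ∣_) (ℕ.*-comm q (product ps)) p∣m)
...   | divides r refl = divides r (ℕ.*-assoc r p (product ps))

module Classification (k : ℕ) (excs : List (List ℕ)) (lr : LonelyRunner k) where
  open Sieve k excs

  outcome-scale : ∀ {g us} → 0 < g → Outcome us → Outcome (map (g *_) us)
  outcome-scale {g} {us} 0<g (inj₁ (N , t , 0<N , h)) = inj₁ (g * N , t , ℕ.*-mono-< 0<g 0<N , All.map⁺ (All.map scale h))
    where
    scale : ∀ {u} → Away (suc N) (2 + k) N (+ u ℤ.* t) → Away (suc (g * N)) (2 + k) (g * N) (+ (g * u) ℤ.* t)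
    scale {u} h = subst (Away (suc (g * N)) (2 + k) (g * N))
      (trans (sym (ℤ.*-assoc (+ g) (+ u) t)) (cong (ℤ._* t) (sym (ℤ.pos-* g u))))
      (away-weaken (subst (suc (g * N) ≤_) (sym (ℕ.*-suc g N)) (ℕ.+-monoˡ-≤ (g * N) 0<g)) (away-scale g h))
  outcome-scale {g} {us} 0<g (inj₂ (cs , cs∈ , h , 0<h , in₁ , in₂)) =
    inj₂ (cs , cs∈ , g * h , ℕ.*-mono-< 0<g 0<h ,
      All.map (λ {c} i → subst (_∈ map (g *_) us) (sym (ℕ.*-assoc g h c)) (∈-map⁺ (g *_) i)) in₁ ,
      All.map⁺ (All.map scale in₂))
    where
    scale : ∀ {u} → u ∈ map (h *_) cs → g * u ∈ map (g * h *_) cs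
    scale i with ∈-map⁻ (h *_) i
    ... | c , c∈ , refl = subst (_∈ map (g * h *_) cs) (ℕ.*-assoc g h c) (∈-map⁺ (g * h *_) c∈)

  module _ (D : ℕ) (eqD : 2 * D ≡ suc k * suc (suc k)) (ps : List ℕ) (distinct : DistinctOddPrimes ps)
           (sift : Sifted ps) (many : (D ^ k) ^ suc k < product ps) where

    divides-or-outcome : ∀ {vs} → All (0 <_) vs → length vs ≡ suc k → gcdₗ vs ≡ 1 →
      ∀ {ps} → DistinctOddPrimes ps → All (T ∘ sieve ∘ pred) ps → All (_∣ product vs) ps ⊎ Outcome vs
    divides-or-outcome pos len gcd≡1 {[]} _ [] = inj₁ []
    divides-or-outcome {vs} pos len gcd≡1 {zero ∷ ps} (() , _) _
    divides-or-outcome {vs} pos len gcd≡1 {suc n ∷ ps} (pr , odd , _ , distinct) (s ∷ ss) with Any.any? (suc n ∣?_) vs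
    ... | no none = inj₂ (sieve-sound lr pr odd vs pos len gcd≡1 (All.¬Any⇒All¬ vs none) s)
    ... | yes some = Sum.map₁ (∣product some ∷_) (divides-or-outcome pos len gcd≡1 distinct ss)

    coprime-outcome : ∀ vs → All (0 <_) vs → length vs ≡ suc k → gcdₗ vs ≡ 1 → Outcome vs
    coprime-outcome vs pos len gcd≡1 with Any.any? (D ^ k ℕ.<?_) vs
    ... | yes large with extract large
    ...   | V , us , perm , D^<V = inj₁ (strictlyLonely-resp-↭ (↭-sym perm) (largeSpeed⇒strictlyLonely k D eqD lr
            (All-resp-↭ perm pos) (ℕ.suc-injective (trans (sym (↭-length perm)) len))
            (trans (sym (gcdₗ-resp-↭ perm)) gcd≡1) D^<V))
    coprime-outcome vs pos len gcd≡1 | no none with divides-or-outcome pos len gcd≡1 distinct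
            (All.all⁺ (sieve ∘ pred) ps (subst T (sym (Sifted.runs sift)) tt))
    ... | inj₂ out = out
    ... | inj₁ ps∣ = contradiction many (ℕ.≤⇒≯ (ℕ.≤-trans
            (∣⇒≤ {{ℕ.>-nonZero (product>0 pos)}} (product-∣ distinct ps∣))
            (subst (λ l → product vs ≤ (D ^ k) ^ l) len (product≤ (All.map ℕ.≮⇒≥ (All.¬Any⇒All¬ vs none))))))

    outcome : ∀ vs → All (0 <_) vs → length vs ≡ suc k → Outcome vs
    outcome [] [] ()
    outcome (v ∷ vs) pos@(0<v ∷ _) len with divide-out (gcdₗ-∣ (v ∷ vs))
    ... | us , eq = subst Outcome (sym eq) (outcome-scale 0<g (coprime-outcome us
            (All.map (λ {u} 0<gu → ℕ.>-nonZero⁻¹ u {{ℕ.m*n≢0⇒n≢0 g {{ℕ.>-nonZero 0<gu}}}}) (All.map⁻ (subst (All (0 <_)) eq pos)))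
            (trans (sym (length-map (g *_) us)) (trans (cong length (sym eq)) len))
            (ℕ.*-cancelˡ-≡ _ _ g (trans (sym (gcdₗ-map g us)) (trans (cong gcdₗ (sym eq)) (sym (ℕ.*-identityʳ g)))))))
      where
      g = gcdₗ (v ∷ vs)
      0<g : 0 < g
      0<g = ℕ.n≢0⇒n>0 λ g≡0 → ℕ.<⇒≢ 0<v (sym (∣.0∣⇒≡0 (subst (_∣ v) g≡0 (All.head (gcdₗ-∣ (v ∷ vs))))))
      instance
        g≢0 : ℕ.NonZero g
        g≢0 = ℕ.>-nonZero 0<g

    lonelyRunner-suc : All (All (λ c → ¬ 2 + k ∣ c)) excs → LonelyRunner (suc k)
    lonelyRunner-suc n∤excs vs len pos with outcome vs pos len
    ... | inj₁ (N , t , 0<N , h) = N , t , 0<N , All.map (away-weaken (ℕ.n≤1+n N)) h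
    ... | inj₂ (cs , cs∈ , g , 0<g , _ , vs∈) = multiples-lonely (s≤s z≤n) 0<g (All.lookup n∤excs cs∈) vs∈

distinctOddPrimes? : ∀ ps → Dec (DistinctOddPrimes ps)
distinctOddPrimes? [] = yes tt
distinctOddPrimes? (p ∷ ps) = prime? p ×-dec ¬? (2 ∣? p) ×-dec ¬? (p ∣? product ps) ×-dec distinctOddPrimes? ps

noneDivisible? : ∀ n excs → Dec (All (All (λ c → ¬ n ∣ c)) excs)
noneDivisible? n = All.all? (All.all? (λ c → ¬? (n ∣? c)))

-- Besides 1, ..., k these contain the sporadic tight tuples (1,3,4,7) and (1,3,4,5,9). That nothing
-- else is tight is an outcome of the search, not an assumption.
tight₂ tight₃ tight₄ tight₅ : List (List ℕ)
tight₂ = (1 ∷ 2 ∷ []) ∷ []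
tight₃ = (1 ∷ 2 ∷ 3 ∷ []) ∷ []
tight₄ = (1 ∷ 2 ∷ 3 ∷ 4 ∷ []) ∷ (1 ∷ 3 ∷ 4 ∷ 7 ∷ []) ∷ []
tight₅ = (1 ∷ 2 ∷ 3 ∷ 4 ∷ 5 ∷ []) ∷ (1 ∷ 3 ∷ 4 ∷ 5 ∷ 9 ∷ []) ∷ []

-- The search succeeds for each of these primes, and the products exceed (D^k)^(k+1) with D = (k +
-- 1)(k + 2)/2, namely 9, 36^3, 1000^4 and (15^4)^5.
primes₂ primes₃ primes₄ primes₅ : List ℕ
primes₂ = 11 ∷ []
primes₃ = 47 ∷ 53 ∷ 59 ∷ []
primes₄ = 29 ∷ 43 ∷ 47 ∷ 59 ∷ 79 ∷ 83 ∷ 89 ∷ []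
primes₅ = 11 ∷ 23 ∷ 29 ∷ 41 ∷ 47 ∷ 53 ∷ 59 ∷ 61 ∷ 67 ∷ 71 ∷ 73 ∷ 79 ∷ 83 ∷ 89 ∷ []

lonelyRunner-2 : LonelyRunner 2
lonelyRunner-2 = lonelyRunner-suc 3 refl primes₂ (from-yes (distinctOddPrimes? primes₂))
  (Sieve.sifted refl) (from-yes (9 ℕ.<? product primes₂)) (from-yes (noneDivisible? 3 tight₂))
  where open Classification 1 tight₂ lonelyRunner-1

module Three = Classification 2 tight₃ lonelyRunner-2

sifted₃ : Sieve.Sifted 2 tight₃ primes₃
sifted₃ = Sieve.sifted refl

lonelyRunner-3 : LonelyRunner 3
lonelyRunner-3 = Three.lonelyRunner-suc 6 refl primes₃ (from-yes (distinctOddPrimes? primes₃))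
  sifted₃ (from-yes ((6 ^ 2) ^ 3 ℕ.<? product primes₃)) (from-yes (noneDivisible? 4 tight₃))

module Four = Classification 3 tight₄ lonelyRunner-3

sifted₄ : Sieve.Sifted 3 tight₄ primes₄
sifted₄ = Sieve.sifted refl

lonelyRunner-4 : LonelyRunner 4
lonelyRunner-4 = Four.lonelyRunner-suc 10 refl primes₄ (from-yes (distinctOddPrimes? primes₄))
  sifted₄ (from-yes ((10 ^ 3) ^ 4 ℕ.<? product primes₄)) (from-yes (noneDivisible? 5 tight₄))

module Five = Classification 4 tight₅ lonelyRunner-4

sifted₅ : Sieve.Sifted 4 tight₅ primes₅
sifted₅ = Sieve.sifted refl

-- Adding a fast runner

-- x / N lies in [k + e/(nN), k + 1 − e/(nN)].
Between : (e n N : ℕ) (x k : ℤ) → Set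
Between e n N x k = + n ℤ.* k ℤ.* + N ℤ.+ + e ℤ.≤ + n ℤ.* x ×
                    + n ℤ.* x ℤ.+ + e ℤ.≤ + n ℤ.* (k ℤ.+ + 1) ℤ.* + N

≤⇒≤∣∣ : ∀ {N x} → + N ℤ.≤ x → N ≤ ℤ.∣ x ∣
≤⇒≤∣∣ {x = + _} (ℤ.+≤+ N≤x) = N≤x

i≤∣i∣ : ∀ i → i ℤ.≤ + ℤ.∣ i ∣
i≤∣i∣ (+ _) = ℤ.≤-refl
i≤∣i∣ -[1+ _ ] = ℤ.-≤+

between⇒away : ∀ {e n N x} k → Between e n N x k → Away e n N x
between⇒away {e} {n} {N} {x} k (lo , hi) = away bounds
  where
  e₁ : ∀ a e → e ≡ (a ℤ.+ e) ℤ.- a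
  e₁ = solve-∀
  bounds : ∀ z → e ≤ n * ℤ.∣ x ℤ.- z ℤ.* + N ∣
  bounds z with z ℤ.≤? k
  ... | yes z≤k = subst (e ≤_) (ℤ.abs-* (+ n) (x ℤ.- z ℤ.* + N)) (≤⇒≤∣∣ (begin
    + e                                                          ≡⟨ e₁ (+ n ℤ.* k ℤ.* + N) (+ e) ⟩
    (+ n ℤ.* k ℤ.* + N ℤ.+ + e) ℤ.- + n ℤ.* k ℤ.* + N
      ≤⟨ ℤ.+-mono-≤ lo (ℤ.neg-mono-≤ (ℤ.*-monoʳ-≤-nonNeg (+ N) (ℤ.*-monoˡ-≤-nonNeg (+ n) z≤k))) ⟩
    + n ℤ.* x ℤ.- + n ℤ.* z ℤ.* + N                              ≡⟨ e₂ (+ n) x z (+ N) ⟩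
    + n ℤ.* (x ℤ.- z ℤ.* + N)                                    ∎))
    where
    open ℤ.≤-Reasoning
    e₂ : ∀ n x z N → n ℤ.* x ℤ.- n ℤ.* z ℤ.* N ≡ n ℤ.* (x ℤ.- z ℤ.* N)
    e₂ = solve-∀
  ... | no z≰k = subst (e ≤_) (trans (ℤ.abs-* (+ n) (z ℤ.* + N ℤ.- x)) (cong (n *_) (ℤ.∣i-j∣≡∣j-i∣ (z ℤ.* + N) x))) (≤⇒≤∣∣ (begin
    + e                                                          ≡⟨ e₁ (+ n ℤ.* x) (+ e) ⟩
    (+ n ℤ.* x ℤ.+ + e) ℤ.- + n ℤ.* x
      ≤⟨ ℤ.+-monoˡ-≤ (ℤ.- (+ n ℤ.* x)) (ℤ.≤-trans hi (ℤ.*-monoʳ-≤-nonNeg (+ N) (ℤ.*-monoˡ-≤-nonNeg (+ n) k+1≤z))) ⟩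
    + n ℤ.* z ℤ.* + N ℤ.- + n ℤ.* x                              ≡⟨ e₂ (+ n) x z (+ N) ⟩
    + n ℤ.* (z ℤ.* + N ℤ.- x)                                    ∎))
    where
    open ℤ.≤-Reasoning
    k+1≤z : k ℤ.+ + 1 ℤ.≤ z
    k+1≤z = subst (ℤ._≤ z) (ℤ.+-comm (+ 1) k) (ℤ.i<j⇒suc[i]≤j (ℤ.≰⇒> z≰k))
    e₂ : ∀ n x z N → n ℤ.* z ℤ.* N ℤ.- n ℤ.* x ≡ n ℤ.* (z ℤ.* N ℤ.- x)
    e₂ = solve-∀

between-or-close : ∀ e n N x → 0 < N → (∃[ k ] Between e n N x k) ⊎ ∃[ z ] n * ℤ.∣ x ℤ.- z ℤ.* + N ∣ < e
between-or-close e n N@(suc _) x _ with e ℕ.≤? n * ℤ.∣ x ℤ.- x ℤ./ℕ N ℤ.* + N ∣ | e ℕ.≤? n * ℤ.∣ x ℤ.- ℤ.suc (x ℤ./ℕ N) ℤ.* + N ∣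
... | no close | _ = inj₂ (x ℤ./ℕ N , ℕ.≰⇒> close)
... | yes _ | no close = inj₂ (ℤ.suc (x ℤ./ℕ N) , ℕ.≰⇒> close)
... | yes h₁ | yes h₂ = inj₁ (k , lo , hi)
  where
  k : ℤ
  k = x ℤ./ℕ N
  r : ℕ
  r = x ℤ.%ℕ N
  x≡ : x ≡ + r ℤ.+ k ℤ.* + N
  x≡ = ℤ.a≡a%ℕn+[a/ℕn]*n x N
  r≤N : + r ℤ.≤ + N
  r≤N = ℤ.+≤+ (ℕ.<⇒≤ (ℤ.n%ℕd<d x N))
  d₁ : ∀ r k N → (r ℤ.+ k ℤ.* N) ℤ.- k ℤ.* N ≡ r
  d₁ = solve-∀
  d₂ : ∀ r k N → (r ℤ.+ k ℤ.* N) ℤ.- (+ 1 ℤ.+ k) ℤ.* N ≡ r ℤ.- N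
  d₂ = solve-∀
  e₁ : ∀ n r k N → n ℤ.* r ℤ.+ n ℤ.* k ℤ.* N ≡ n ℤ.* (r ℤ.+ k ℤ.* N)
  e₁ = solve-∀
  e₂ : ∀ n r k N → n ℤ.* (r ℤ.+ k ℤ.* N) ℤ.+ n ℤ.* (N ℤ.- r) ≡ n ℤ.* (k ℤ.+ + 1) ℤ.* N
  e₂ = solve-∀
  lo : + n ℤ.* k ℤ.* + N ℤ.+ + e ℤ.≤ + n ℤ.* x
  lo = begin
    + n ℤ.* k ℤ.* + N ℤ.+ + e                                    ≤⟨ ℤ.+-monoʳ-≤ (+ n ℤ.* k ℤ.* + N) (ℤ.+≤+ h₁) ⟩
    + n ℤ.* k ℤ.* + N ℤ.+ + (n * ℤ.∣ x ℤ.- k ℤ.* + N ∣)          ≡⟨ cong (λ y → + n ℤ.* k ℤ.* + N ℤ.+ + (n * ℤ.∣ y ∣)) (trans (cong (ℤ._- k ℤ.* + N) x≡) (d₁ (+ r) k (+ N))) ⟩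
    + n ℤ.* k ℤ.* + N ℤ.+ + (n * r)                              ≡⟨ cong (λ y → + n ℤ.* k ℤ.* + N ℤ.+ y) (ℤ.pos-* n r) ⟩
    + n ℤ.* k ℤ.* + N ℤ.+ + n ℤ.* + r                            ≡⟨ ℤ.+-comm (+ n ℤ.* k ℤ.* + N) (+ n ℤ.* + r) ⟩
    + n ℤ.* + r ℤ.+ + n ℤ.* k ℤ.* + N                            ≡⟨ e₁ (+ n) (+ r) k (+ N) ⟩
    + n ℤ.* (+ r ℤ.+ k ℤ.* + N)                                  ≡⟨ cong (λ y → + n ℤ.* y) x≡ ⟨
    + n ℤ.* x                                                    ∎
    where open ℤ.≤-Reasoning
  gap : + ℤ.∣ x ℤ.- ℤ.suc k ℤ.* + N ∣ ≡ + N ℤ.- + r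
  gap = trans (cong (λ y → + ℤ.∣ y ∣) (trans (cong (ℤ._- ℤ.suc k ℤ.* + N) x≡) (d₂ (+ r) k (+ N)))) (ℤ.∣-∣-≤ r≤N)
  hi : + n ℤ.* x ℤ.+ + e ℤ.≤ + n ℤ.* (k ℤ.+ + 1) ℤ.* + N
  hi = begin
    + n ℤ.* x ℤ.+ + e                                            ≤⟨ ℤ.+-monoʳ-≤ (+ n ℤ.* x) (ℤ.+≤+ h₂) ⟩
    + n ℤ.* x ℤ.+ + (n * ℤ.∣ x ℤ.- ℤ.suc k ℤ.* + N ∣)            ≡⟨ cong (λ y → + n ℤ.* x ℤ.+ y) (trans (ℤ.pos-* n ℤ.∣ x ℤ.- ℤ.suc k ℤ.* + N ∣) (cong (λ y → + n ℤ.* y) gap)) ⟩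
    + n ℤ.* x ℤ.+ + n ℤ.* (+ N ℤ.- + r)                          ≡⟨ cong (λ y → + n ℤ.* y ℤ.+ + n ℤ.* (+ N ℤ.- + r)) x≡ ⟩
    + n ℤ.* (+ r ℤ.+ k ℤ.* + N) ℤ.+ + n ℤ.* (+ N ℤ.- + r)        ≡⟨ e₂ (+ n) (+ r) k (+ N) ⟩
    + n ℤ.* (k ℤ.+ + 1) ℤ.* + N                                  ∎
    where open ℤ.≤-Reasoning

away⇒between : ∀ {e n N x} → 0 < N → Away e n N x → ∃[ k ] Between e n N x k
away⇒between {e} {n} {N} {x} 0<N (away h) with between-or-close e n N x 0<N
... | inj₁ b = b
... | inj₂ (z , close) = contradiction (h z) (ℕ.<⇒≱ close)

-- An interval [a, c] around τ such that ‖ v x / (m + 1) ‖ ≥ 1/n for every v in vs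
-- whenever n x / (m + 1) lies in [a, c].
Window : (n V : ℕ) → ℚᵘ → List ℕ → Set
Window n V τ vs = ∃[ a ] ∃[ c ] a ℚᵘ.< τ × τ ℚᵘ.< c × ↧ₙ a ≤ V × ↧ₙ c ≤ V ×
  (∀ x m → a ℚᵘ.≤ mkℚᵘ (+ n ℤ.* x) m → mkℚᵘ (+ n ℤ.* x) m ℚᵘ.≤ c →
    All (λ v → Away (suc m) n (suc m) (+ v ℤ.* x)) vs)

-- Within lap k the runner v is at distance at least 1/n while n x / N lies between (n k + 1)/v and
-- (n (k + 1) - 1)/v. Measuring time in units of 1/n keeps the denominators of these ends equal to v
-- ≤ V; strict loneliness puts the given time in the interior.
window-single : ∀ {n V v m t} → v ≤ V → 0 < v → Away (2 + m) n (suc m) (+ v ℤ.* t) →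
                Window n V (mkℚᵘ (+ n ℤ.* t) m) (v ∷ [])
window-single {n} {V} {v@(suc u)} {m} {t} v≤V _ h with away⇒between {x = + v ℤ.* t} (s≤s z≤n) h
... | k , lo , hi = mkℚᵘ (+ n ℤ.* k ℤ.+ + 1) u , mkℚᵘ (+ n ℤ.* (k ℤ.+ + 1) ℤ.- + 1) u ,
  *<* lo′ , *<* hi′ , v≤V , v≤V , λ x m p q → between⇒away k (in₁ x m (ℚᵘ.drop-*≤* p) , in₂ x m (ℚᵘ.drop-*≤* q)) ∷ []
  where
  vnt : ∀ n t v → n ℤ.* (v ℤ.* t) ≡ n ℤ.* t ℤ.* v
  vnt = solve-∀
  e₁ : ∀ n k N → (n ℤ.* k ℤ.* N ℤ.+ (+ 1 ℤ.+ N)) ≡ + 1 ℤ.+ (n ℤ.* k ℤ.+ + 1) ℤ.* N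
  e₁ = solve-∀
  lo′ : (+ n ℤ.* k ℤ.+ + 1) ℤ.* + suc m ℤ.< + n ℤ.* t ℤ.* + v
  lo′ = ℤ.suc[i]≤j⇒i<j (subst₂ ℤ._≤_ (e₁ (+ n) k (+ suc m)) (vnt (+ n) t (+ v)) lo)
  e₂ : ∀ y N → y ℤ.+ (+ 1 ℤ.+ N) ℤ.- N ≡ + 1 ℤ.+ y
  e₂ = solve-∀
  e₃ : ∀ n k N → n ℤ.* (k ℤ.+ + 1) ℤ.* N ℤ.- N ≡ (n ℤ.* (k ℤ.+ + 1) ℤ.- + 1) ℤ.* N
  e₃ = solve-∀
  hi′ : + n ℤ.* t ℤ.* + v ℤ.< (+ n ℤ.* (k ℤ.+ + 1) ℤ.- + 1) ℤ.* + suc m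
  hi′ = ℤ.suc[i]≤j⇒i<j (subst₂ ℤ._≤_
    (trans (e₂ (+ n ℤ.* (+ v ℤ.* t)) (+ suc m)) (cong (λ y → + 1 ℤ.+ y) (vnt (+ n) t (+ v))))
    (e₃ (+ n) k (+ suc m)) (ℤ.+-monoˡ-≤ (ℤ.- + suc m) hi))
  e₄ : ∀ n k N → (n ℤ.* k ℤ.+ + 1) ℤ.* N ≡ n ℤ.* k ℤ.* N ℤ.+ N
  e₄ = solve-∀
  in₁ : ∀ x m → (+ n ℤ.* k ℤ.+ + 1) ℤ.* + suc m ℤ.≤ + n ℤ.* x ℤ.* + v → + n ℤ.* k ℤ.* + suc m ℤ.+ + suc m ℤ.≤ + n ℤ.* (+ v ℤ.* x)
  in₁ x m a≤ = subst₂ ℤ._≤_ (e₄ (+ n) k (+ suc m)) (sym (vnt (+ n) x (+ v))) a≤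
  e₅ : ∀ n k N → (n ℤ.* (k ℤ.+ + 1) ℤ.- + 1) ℤ.* N ℤ.+ N ≡ n ℤ.* (k ℤ.+ + 1) ℤ.* N
  e₅ = solve-∀
  in₂ : ∀ x m → + n ℤ.* x ℤ.* + v ℤ.≤ (+ n ℤ.* (k ℤ.+ + 1) ℤ.- + 1) ℤ.* + suc m → + n ℤ.* (+ v ℤ.* x) ℤ.+ + suc m ℤ.≤ + n ℤ.* (k ℤ.+ + 1) ℤ.* + suc m
  in₂ x m ≤c = subst₂ ℤ._≤_ (cong (ℤ._+ + suc m) (sym (vnt (+ n) x (+ v)))) (e₅ (+ n) k (+ suc m)) (ℤ.+-monoˡ-≤ (+ suc m) ≤c)

window-∷ : ∀ {n V τ v vs} → Window n V τ (v ∷ []) → Window n V τ vs → Window n V τ (v ∷ vs)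
window-∷ (a , c , a<τ , τ<c , a≤V , c≤V , h) (a′ , c′ , a′<τ , τ<c′ , a′≤V , c′≤V , h′)
  with a ℚᵘ.≤? a′ | c ℚᵘ.≤? c′
... | yes a≤a′ | yes c≤c′ = a′ , c , a′<τ , τ<c , a′≤V , c≤V , λ x m p q →
      All.head (h x m (ℚᵘ.≤-trans a≤a′ p) q) ∷ h′ x m p (ℚᵘ.≤-trans q c≤c′)
... | yes a≤a′ | no c≰c′ = a′ , c′ , a′<τ , τ<c′ , a′≤V , c′≤V , λ x m p q →
      All.head (h x m (ℚᵘ.≤-trans a≤a′ p) (ℚᵘ.≤-trans q (ℚᵘ.<⇒≤ (ℚᵘ.≰⇒> c≰c′)))) ∷ h′ x m p q
... | no a≰a′ | yes c≤c′ = a , c , a<τ , τ<c , a≤V , c≤V , λ x m p q →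
      All.head (h x m p q) ∷ h′ x m (ℚᵘ.≤-trans (ℚᵘ.<⇒≤ (ℚᵘ.≰⇒> a≰a′)) p) (ℚᵘ.≤-trans q c≤c′)
... | no a≰a′ | no c≰c′ = a , c′ , a<τ , τ<c′ , a≤V , c′≤V , λ x m p q →
      All.head (h x m p (ℚᵘ.≤-trans q (ℚᵘ.<⇒≤ (ℚᵘ.≰⇒> c≰c′)))) ∷
      h′ x m (ℚᵘ.≤-trans (ℚᵘ.<⇒≤ (ℚᵘ.≰⇒> a≰a′)) p) q

window : ∀ {n V m t v vs} → All (λ v → v ≤ V × 0 < v) (v ∷ vs) →
         All (λ v → Away (2 + m) n (suc m) (+ v ℤ.* t)) (v ∷ vs) → Window n V (mkℚᵘ (+ n ℤ.* t) m) (v ∷ vs)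
window {t = t} ((v≤V , 0<v) ∷ []) (h ∷ []) = window-single {t = t} v≤V 0<v h
window {t = t} ((v≤V , 0<v) ∷ b ∷ bs) (h ∷ hs) = window-∷ (window-single {t = t} v≤V 0<v h) (window {t = t} (b ∷ bs) hs)

-- Two window ends A/B < C/E with B, E ≤ V are at least 1/V² apart, so the fast runner W has
-- time to leave the arc of length 2/n around the starting point.
add-fast-runner : ∀ {n V W v vs} → 1 < n → All (λ v → v ≤ V × 0 < v) (v ∷ vs) → 0 < W → 2 * (V * V) ≤ W →
                  StrictlyLonely n (v ∷ vs) → Lonely n (W ∷ v ∷ vs)
add-fast-runner {n@(suc n′)} {V} {W@(suc W′)} 1<n bounds _ 2V²≤W (suc m , t , _ , h)
  with window {t = t} bounds h
... | a@(mkℚᵘ A b) , c@(mkℚᵘ C e) , a<τ , τ<c , B≤V , E≤V , inside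
  -- The fast runner is tested at the left end of the window, time A/(n B): it is at distance at
  -- least 1/n there, or closer than that to some integer z.
  with between-or-close (n * B) n (n * B) (+ W ℤ.* A) (s≤s z≤n)
  where B = suc b
...   | inj₁ (k , btw) = n * suc b , A , s≤s z≤n , between⇒away k btw ∷ inside A (pred (n * suc b))
          (ℚᵘ.≤-reflexive (ℚᵘ.≃-sym same)) (ℚᵘ.≤-respˡ-≃ (ℚᵘ.≃-sym same) (ℚᵘ.<⇒≤ (ℚᵘ.<-trans a<τ τ<c)))
  where
  eq : ∀ n A B → n ℤ.* A ℤ.* B ≡ A ℤ.* (n ℤ.* B)
  eq = solve-∀
  same : mkℚᵘ (+ n ℤ.* A) (pred (n * suc b)) ≃ mkℚᵘ A b
  same = *≡* (trans (eq (+ n) A (+ suc b)) (cong (A ℤ.*_) (sym (ℤ.pos-* n (suc b)))))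
...   | inj₂ (z , close) = n * W , x , s≤s z≤n , W-away ∷ inside x (pred (n * W)) (*≤* above) (*≤* below)
  where
  B E : ℕ
  B = suc b
  E = suc e
  -- At time x/(n W) the fast runner is at z + 1/n. From the left end of the window it covers less
  -- than 2/n to get there, so it arrives before the right end.
  x : ℤ
  x = z ℤ.* + n ℤ.+ + 1
  d : ℤ
  d = + W ℤ.* A ℤ.- z ℤ.* + (n * B)
  ∣d∣<B : ℤ.∣ d ∣ < B
  ∣d∣<B = ℕ.*-cancelˡ-< n _ _ close
  d≤B : d ℤ.≤ + B
  d≤B = ℤ.≤-trans (i≤∣i∣ d) (ℤ.+≤+ (ℕ.<⇒≤ ∣d∣<B))
  -d≤B : ℤ.- d ℤ.≤ + B
  -d≤B = ℤ.≤-trans (i≤∣i∣ (ℤ.- d)) (ℤ.+≤+ (subst (_≤ B) (sym (ℤ.∣-i∣≡∣i∣ d)) (ℕ.<⇒≤ ∣d∣<B)))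
  W-away : Away (n * W) n (n * W) (+ W ℤ.* x)
  W-away = subst₂ (λ c y → Away c n c y) (ℕ.*-comm W n)
    (trans (cong (λ y → + W ℤ.* + 1 ℤ.+ z ℤ.* y) (ℤ.pos-* W n)) (eq (+ W) z (+ n)))
    (away-cong z (away-scale W (∤⇒away λ n∣1 → ℕ.<⇒≱ 1<n (∣⇒≤ n∣1))))
    where
    eq : ∀ w z n → w ℤ.* + 1 ℤ.+ z ℤ.* (w ℤ.* n) ≡ w ℤ.* (z ℤ.* n ℤ.+ + 1)
    eq = solve-∀
  WA≡ : + W ℤ.* A ≡ d ℤ.+ z ℤ.* (+ n ℤ.* + B)
  WA≡ = trans (e₁ (+ W ℤ.* A) (z ℤ.* + (n * B))) (cong (λ y → d ℤ.+ z ℤ.* y) (ℤ.pos-* n B))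
    where
    e₁ : ∀ a b → a ≡ (a ℤ.- b) ℤ.+ b
    e₁ = solve-∀
  above : A ℤ.* + (n * W) ℤ.≤ + n ℤ.* x ℤ.* + B
  above = begin
    A ℤ.* + (n * W)                             ≡⟨ cong (A ℤ.*_) (ℤ.pos-* n W) ⟩
    A ℤ.* (+ n ℤ.* + W)                         ≡⟨ e₁ A (+ n) (+ W) ⟩
    + n ℤ.* (+ W ℤ.* A)                         ≡⟨ cong (+ n ℤ.*_) WA≡ ⟩
    + n ℤ.* (d ℤ.+ z ℤ.* (+ n ℤ.* + B))         ≤⟨ ℤ.*-monoˡ-≤-nonNeg (+ n) (ℤ.+-monoˡ-≤ (z ℤ.* (+ n ℤ.* + B)) d≤B) ⟩
    + n ℤ.* (+ B ℤ.+ z ℤ.* (+ n ℤ.* + B))       ≡⟨ e₂ (+ n) z (+ B) ⟩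
    + n ℤ.* x ℤ.* + B                           ∎
    where
    open ℤ.≤-Reasoning
    e₁ : ∀ a n w → a ℤ.* (n ℤ.* w) ≡ n ℤ.* (w ℤ.* a)
    e₁ = solve-∀
    e₂ : ∀ n z b → n ℤ.* (b ℤ.+ z ℤ.* (n ℤ.* b)) ≡ n ℤ.* (z ℤ.* n ℤ.+ + 1) ℤ.* b
    e₂ = solve-∀
  AE<CB : A ℤ.* + E ℤ.< C ℤ.* + B
  AE<CB = ℚᵘ.drop-*<* (ℚᵘ.<-trans a<τ τ<c)
  2BE≤W : + 2 ℤ.* (+ B ℤ.* + E) ℤ.≤ + W
  2BE≤W = subst (ℤ._≤ + W) (trans (ℤ.pos-* 2 (B * E)) (cong (+ 2 ℤ.*_) (ℤ.pos-* B E)))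
    (ℤ.+≤+ (ℕ.≤-trans (ℕ.*-monoʳ-≤ 2 (ℕ.*-mono-≤ B≤V E≤V)) 2V²≤W))
  below : + n ℤ.* x ℤ.* + E ℤ.≤ C ℤ.* + (n * W)
  below = ℤ.*-cancelʳ-≤-pos (+ n ℤ.* x ℤ.* + E) (C ℤ.* + (n * W)) (+ B) (begin
    + n ℤ.* x ℤ.* + E ℤ.* + B                                          ≡⟨ e₁ (+ n) z (+ E) (+ B) d ⟩
    + n ℤ.* ((d ℤ.+ z ℤ.* (+ n ℤ.* + B)) ℤ.+ ((ℤ.- d) ℤ.+ + B)) ℤ.* + E  ≡⟨ cong (λ y → + n ℤ.* (y ℤ.+ ((ℤ.- d) ℤ.+ + B)) ℤ.* + E) WA≡ ⟨
    + n ℤ.* (+ W ℤ.* A ℤ.+ ((ℤ.- d) ℤ.+ + B)) ℤ.* + E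
      ≤⟨ ℤ.*-monoʳ-≤-nonNeg (+ E) (ℤ.*-monoˡ-≤-nonNeg (+ n) (ℤ.+-monoʳ-≤ (+ W ℤ.* A) (ℤ.+-monoˡ-≤ (+ B) -d≤B))) ⟩
    + n ℤ.* (+ W ℤ.* A ℤ.+ (+ B ℤ.+ + B)) ℤ.* + E                      ≡⟨ e₂ (+ n) (+ W) A (+ B) (+ E) ⟩
    + n ℤ.* (+ W ℤ.* (A ℤ.* + E) ℤ.+ + 2 ℤ.* (+ B ℤ.* + E))            ≤⟨ ℤ.*-monoˡ-≤-nonNeg (+ n) (ℤ.+-monoʳ-≤ (+ W ℤ.* (A ℤ.* + E)) 2BE≤W) ⟩
    + n ℤ.* (+ W ℤ.* (A ℤ.* + E) ℤ.+ + W)                              ≡⟨ e₃ (+ n) (+ W) (A ℤ.* + E) ⟩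
    + n ℤ.* + W ℤ.* (+ 1 ℤ.+ A ℤ.* + E)
      ≤⟨ subst (λ y → y ℤ.* (+ 1 ℤ.+ A ℤ.* + E) ℤ.≤ y ℤ.* (C ℤ.* + B)) (ℤ.pos-* n W) (ℤ.*-monoˡ-≤-nonNeg (+ (n * W)) (ℤ.i<j⇒suc[i]≤j AE<CB)) ⟩
    + n ℤ.* + W ℤ.* (C ℤ.* + B)                                        ≡⟨ e₄ (+ n ℤ.* + W) C (+ B) ⟩
    C ℤ.* (+ n ℤ.* + W) ℤ.* + B                                        ≡⟨ cong (λ y → C ℤ.* y ℤ.* + B) (ℤ.pos-* n W) ⟨
    C ℤ.* + (n * W) ℤ.* + B                                            ∎)
    where
    open ℤ.≤-Reasoning
    e₁ : ∀ n z e b d → n ℤ.* (z ℤ.* n ℤ.+ + 1) ℤ.* e ℤ.* b ≡ n ℤ.* ((d ℤ.+ z ℤ.* (n ℤ.* b)) ℤ.+ ((ℤ.- d) ℤ.+ b)) ℤ.* e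
    e₁ = solve-∀
    e₂ : ∀ n w a b e → n ℤ.* (w ℤ.* a ℤ.+ (b ℤ.+ b)) ℤ.* e ≡ n ℤ.* (w ℤ.* (a ℤ.* e) ℤ.+ + 2 ℤ.* (b ℤ.* e))
    e₂ = solve-∀
    e₃ : ∀ n w a → n ℤ.* (w ℤ.* a ℤ.+ w) ≡ n ℤ.* w ℤ.* (+ 1 ℤ.+ a)
    e₃ = solve-∀
    e₄ : ∀ a c b → a ℤ.* (c ℤ.* b) ≡ c ℤ.* a ℤ.* b
    e₄ = solve-∀

-- Tight slow speeds and a fast speed that is not a multiple of g

coprime-quotients : ∀ a b → 0 < b → ∃[ c ] ∃[ w ] ∃[ d ] 0 < c × a ≡ c * w × b ≡ c * d × Coprime w d
coprime-quotients a b 0<b with gcd[m,n]∣m a b | gcd[m,n]∣n a b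
... | divides w eq₁ | divides d eq₂ = c , w , d , 0<c ,
    trans eq₁ (ℕ.*-comm w c) , trans eq₂ (ℕ.*-comm d c) , λ {i} (i∣w , i∣d) →
      ∣.∣1⇒≡1 (∣.*-cancelˡ-∣ c {{ℕ.>-nonZero 0<c}} (subst (c * i ∣_) (sym (ℕ.*-identityʳ c))
        (gcd-greatest (subst (c * i ∣_) (sym (trans eq₁ (ℕ.*-comm w c))) (∣.*-monoʳ-∣ c i∣w))
                      (subst (c * i ∣_) (sym (trans eq₂ (ℕ.*-comm d c))) (∣.*-monoʳ-∣ c i∣d)))))
  where
  c = gcd a b
  0<c : 0 < c
  0<c = ℕ.n≢0⇒n>0 (gcd[m,n]≢0 a b (inj₂ λ { refl → ℕ.<-irrefl refl 0<b }))

solve-congruence : ∀ {w d} → Coprime w d → ∀ i → ∃[ j ] ∃[ l ] j ℤ.* + w ≡ i ℤ.+ l ℤ.* + d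
solve-congruence {w} {d} cop i with inverse cop
... | a , res = go res refl
  where
  e : ∀ a i w → a ℤ.* i ℤ.* w ≡ i ℤ.* (w ℤ.* a)
  e = solve-∀
  e₁ : ∀ i z d → i ℤ.* (z ℤ.* d ℤ.+ + 1) ≡ i ℤ.+ i ℤ.* z ℤ.* d
  e₁ = solve-∀
  e₂ : ∀ i z d → (ℤ.- i) ℤ.* (z ℤ.* d ℤ.- + 1) ≡ i ℤ.+ (ℤ.- i) ℤ.* z ℤ.* d
  e₂ = solve-∀
  go : ∀ {y} → Residue d 1 y → y ≡ + w ℤ.* + a → ∃[ j ] ∃[ l ] j ℤ.* + w ≡ i ℤ.+ l ℤ.* + d
  go (plus z)  eq = + a ℤ.* i , i ℤ.* z , trans (e (+ a) i (+ w)) (trans (cong (i ℤ.*_) (sym eq)) (e₁ i z (+ d)))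
  go (minus z) eq = + a ℤ.* (ℤ.- i) , (ℤ.- i) ℤ.* z ,
    trans (e (+ a) (ℤ.- i) (+ w)) (trans (cong ((ℤ.- i) ℤ.*_) (sym eq)) (e₂ i z (+ d)))

-- Times (1 + n j) / (n g) keep the multiples of g where they are at time 1 / (n g), while the
-- extra runner can be put at any point congruent to its original position modulo 1/d.
add-nonmultiple : ∀ {n g cs vs W} → 2 < n → 0 < g → All (λ c → ¬ n ∣ c) cs → All (_∈ map (g *_) cs) vs →
                  ¬ g ∣ W → Lonely n (W ∷ vs)
add-nonmultiple {n@(suc _)} {g} {cs} {vs} {W} 2<n 0<g n∤cs vs∈ g∤W with coprime-quotients W g 0<g
... | c , w , d , 0<c , refl , refl , cop
  -- The extra runner is sent to (d + ρ)/(d n), where ρ is the remainder of w - d modulo n: d + ρ is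
  -- the first number from d on that is congruent to w modulo n. Since d ≥ 2, n ≥ 3 and ρ < n, it is
  -- at most (n - 1) d.
  with solve-congruence cop (ℤ.- ((+ w ℤ.- + d) ℤ./ℕ n))
...   | j , l , jw≡ = c * d * n , t , ℕ.*-mono-< 0<g (ℕ.<-trans (s≤s z≤n) 2<n) , W-away ∷ All.map v-away vs∈
  where
  t : ℤ
  t = + 1 ℤ.+ + n ℤ.* j
  v-away : ∀ {v} → v ∈ map (c * d *_) cs → Away (c * d * n) n (c * d * n) (+ v ℤ.* t)
  v-away v∈ with ∈-map⁻ (c * d *_) v∈
  ... | b , b∈ , refl = subst (Away (c * d * n) n (c * d * n)) (trans
      (cong (λ y → + (c * d) ℤ.* + b ℤ.+ + b ℤ.* j ℤ.* y) (ℤ.pos-* (c * d) n))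
      (trans (e (+ (c * d)) (+ b) j (+ n)) (cong (ℤ._* t) (sym (ℤ.pos-* (c * d) b)))))
      (away-cong (+ b ℤ.* j) (away-scale (c * d) (∤⇒away (All.lookup n∤cs b∈))))
    where
    e : ∀ g b j n → g ℤ.* b ℤ.+ b ℤ.* j ℤ.* (g ℤ.* n) ≡ g ℤ.* b ℤ.* (+ 1 ℤ.+ n ℤ.* j)
    e = solve-∀
  ρ : ℕ
  ρ = (+ w ℤ.- + d) ℤ.%ℕ n
  q : ℤ
  q = (+ w ℤ.- + d) ℤ./ℕ n
  2≤d : 2 ≤ d
  2≤d = large d 0<g g∤W
    where
    large : ∀ d → 0 < c * d → ¬ c * d ∣ c * w → 2 ≤ d
    large 0 0<cd _ = contradiction 0<cd (subst (λ y → ¬ 0 < y) (sym (ℕ.*-zeroʳ c)) λ ())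
    large 1 _ c∤W = contradiction (subst (_∣ c * w) (sym (ℕ.*-identityʳ c)) (∣.m∣m*n w)) c∤W
    large (suc (suc _)) _ _ = s≤s (s≤s z≤n)
  y≤ : d + ρ + d ≤ n * d
  y≤ = begin
    d + ρ + d              ≡⟨ e₁ d ρ ⟩
    ρ + 2 * d              ≤⟨ ℕ.+-monoˡ-≤ (2 * d) ρ≤ ⟩
    (n ∸ 2) * d + 2 * d    ≡⟨ ℕ.*-distribʳ-+ d (n ∸ 2) 2 ⟨
    (n ∸ 2 + 2) * d        ≡⟨ cong (_* d) (ℕ.m∸n+n≡m (ℕ.<⇒≤ 2<n)) ⟩
    n * d                  ∎
    where
    open ℕ.≤-Reasoning
    e₁ : ∀ d ρ → d + ρ + d ≡ ρ + 2 * d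
    e₁ = ℕRing.solve-∀
    below : ∀ {n ρ} → 2 < n → ρ < n → ρ ≤ (n ∸ 2) * 2
    below {suc (suc (suc n))} {ρ} _ (s≤s ρ≤) = ℕ.≤-trans ρ≤ (ℕ.≤-trans (ℕ.m≤m+n (2 + n) n) (ℕ.≤-reflexive (e₂ n)))
      where
      e₂ : ∀ n → 2 + n + n ≡ suc n * 2
      e₂ = ℕRing.solve-∀
    below {1} (s≤s ()) _
    below {2} (s≤s (s≤s ())) _
    ρ≤ : ρ ≤ (n ∸ 2) * d
    ρ≤ = ℕ.≤-trans (below 2<n (ℤ.n%ℕd<d (+ w ℤ.- + d) n)) (ℕ.*-monoʳ-≤ (n ∸ 2) 2≤d)
  base : Away (d * n) n (d * n) (+ (d + ρ))
  base = residue-away (subst (d + ρ ≤_) (ℕ.*-comm n d) (ℕ.≤-trans (ℕ.m≤m+n (d + ρ) d) y≤))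
    (subst (_≤ n * (d + ρ)) (ℕ.*-comm n d) (ℕ.*-monoʳ-≤ n (ℕ.m≤m+n d ρ)))
    (subst (_≤ n * (d * n ∸ (d + ρ))) (ℕ.*-comm n d) (ℕ.*-monoʳ-≤ n
      (subst (λ y → d ≤ y ∸ (d + ρ)) (ℕ.*-comm n d) (ℕ.m+n≤o⇒m≤o∸n d (subst (_≤ n * d) (ℕ.+-comm (d + ρ) d) y≤)))))
  pos : + (d + ρ) ≡ + w ℤ.+ + n ℤ.* (ℤ.- q)
  pos = trans (e₁ (+ d) (+ ρ) (q ℤ.* + n)) (trans (cong (λ y → + d ℤ.+ y ℤ.- q ℤ.* + n) (sym (ℤ.a≡a%ℕn+[a/ℕn]*n (+ w ℤ.- + d) n))) (e₂ (+ w) (+ d) q (+ n)))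
    where
    e₁ : ∀ d r y → d ℤ.+ r ≡ d ℤ.+ (r ℤ.+ y) ℤ.- y
    e₁ = solve-∀
    e₂ : ∀ w d q n → d ℤ.+ (w ℤ.- d) ℤ.- q ℤ.* n ≡ w ℤ.+ n ℤ.* (ℤ.- q)
    e₂ = solve-∀
  W-away : Away (c * d * n) n (c * d * n) (+ (c * w) ℤ.* t)
  W-away = subst₂ (λ m y → Away m n m y) (sym (ℕ.*-assoc c d n)) final
    (away-cong l (away-scale c base))
    where
    e₁ : ∀ c w n q l d → c ℤ.* (w ℤ.+ n ℤ.* q) ℤ.+ l ℤ.* (c ℤ.* (d ℤ.* n)) ≡ c ℤ.* (w ℤ.+ n ℤ.* (q ℤ.+ l ℤ.* d))
    e₁ = solve-∀
    e₂ : ∀ c w n j → c ℤ.* (w ℤ.+ n ℤ.* (j ℤ.* w)) ≡ c ℤ.* w ℤ.* (+ 1 ℤ.+ n ℤ.* j)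
    e₂ = solve-∀
    final : + c ℤ.* + (d + ρ) ℤ.+ l ℤ.* + (c * (d * n)) ≡ + (c * w) ℤ.* t
    final = trans (cong₂ (λ y z → + c ℤ.* y ℤ.+ l ℤ.* z) pos (trans (ℤ.pos-* c (d * n)) (cong (+ c ℤ.*_) (ℤ.pos-* d n))))
      (trans (e₁ (+ c) (+ w) (+ n) (ℤ.- q) l (+ d)) (trans (cong (λ y → + c ℤ.* (+ w ℤ.+ + n ℤ.* y)) (sym jw≡))
        (trans (e₂ (+ c) (+ w) (+ n) j) (cong (ℤ._* t) (sym (ℤ.pos-* c w))))))

-- Exact loneliness when the fast speed is a multiple of g n

-- Reducing time modulo 1 and reflecting it preserve all distances to the integers.
reduce-to-half : ∀ {e M N ds} → 0 < N →
  (∀ x → 2 * x ≤ N → All (λ c → Away e M N (+ c ℤ.* + x)) ds → ⊥) →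
  ∀ x → All (λ c → Away e M N (+ c ℤ.* x)) ds → ⊥
reduce-to-half {e} {M} {N@(suc _)} {ds} _ h x aways with 2 * r ℕ.≤? N
  where r = x ℤ.%ℕ N
... | yes 2r≤N = h r 2r≤N (All.map (λ {c} a → subst (Away e M N) (eq c) (away-cong (ℤ.- (+ c ℤ.* q)) a)) aways)
  where
  r = x ℤ.%ℕ N
  q = x ℤ./ℕ N
  e₁ : ∀ c r q n → c ℤ.* (r ℤ.+ q ℤ.* n) ℤ.+ (ℤ.- (c ℤ.* q)) ℤ.* n ≡ c ℤ.* r
  e₁ = solve-∀
  eq : ∀ c → + c ℤ.* x ℤ.+ (ℤ.- (+ c ℤ.* q)) ℤ.* + N ≡ + c ℤ.* + r
  eq c = trans (cong (λ y → + c ℤ.* y ℤ.+ (ℤ.- (+ c ℤ.* q)) ℤ.* + N) (ℤ.a≡a%ℕn+[a/ℕn]*n x N)) (e₁ (+ c) (+ r) q (+ N))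
... | no 2r≰N = h (N ∸ r) 2[N∸r]≤N (All.map (λ {c} a → subst (Away e M N) (eq c) (away-cong (+ c ℤ.* (+ 1 ℤ.+ q)) (away-neg a))) aways)
  where
  r = x ℤ.%ℕ N
  q = x ℤ./ℕ N
  r≤N : r ≤ N
  r≤N = ℕ.<⇒≤ (ℤ.n%ℕd<d x N)
  2[N∸r]≤N : 2 * (N ∸ r) ≤ N
  2[N∸r]≤N = ℕ.+-cancelʳ-≤ (2 * r) _ _ (begin
    2 * (N ∸ r) + 2 * r   ≡⟨ ℕ.*-distribˡ-+ 2 (N ∸ r) r ⟨
    2 * (N ∸ r + r)       ≡⟨ cong (2 *_) (ℕ.m∸n+n≡m r≤N) ⟩
    2 * N                 ≡⟨ cong (λ m → N + m) (ℕ.+-identityʳ N) ⟩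
    N + N                 ≤⟨ ℕ.+-monoʳ-≤ N (ℕ.<⇒≤ (ℕ.≰⇒> 2r≰N)) ⟩
    N + 2 * r             ∎)
    where open ℕ.≤-Reasoning
  e₁ : ∀ c r q n → ℤ.- (c ℤ.* (r ℤ.+ q ℤ.* n)) ℤ.+ (c ℤ.* (+ 1 ℤ.+ q)) ℤ.* n ≡ c ℤ.* (n ℤ.- r)
  e₁ = solve-∀
  eq : ∀ c → ℤ.- (+ c ℤ.* x) ℤ.+ (+ c ℤ.* (+ 1 ℤ.+ q)) ℤ.* + N ≡ + c ℤ.* + (N ∸ r)
  eq c = trans (cong (λ y → ℤ.- (+ c ℤ.* y) ℤ.+ (+ c ℤ.* (+ 1 ℤ.+ q)) ℤ.* + N) (ℤ.a≡a%ℕn+[a/ℕn]*n x N))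
    (trans (e₁ (+ c) (+ r) q (+ N)) (cong (+ c ℤ.*_) (trans (ℤ.[+m]-[+n]≡m⊖n N r) (ℤ.⊖-≥ r≤N))))

away-split : ∀ {e M N c x} → Away e M N (+ c ℤ.* + x) → ∀ z → e + M * (z * N) ≤ M * (c * x) ⊎ e + M * (c * x) ≤ M * (z * N)
away-split {e} {M} {N} {c} {x} (away h) z with ℕ.≤-total (z * N) (c * x)
... | inj₁ le = inj₁ (begin
    e + M * (z * N)                        ≤⟨ ℕ.+-monoˡ-≤ (M * (z * N)) (subst (λ y → e ≤ M * y) eq (h (+ z))) ⟩
    M * (c * x ∸ z * N) + M * (z * N)      ≡⟨ ℕ.*-distribˡ-+ M (c * x ∸ z * N) (z * N) ⟨
    M * (c * x ∸ z * N + z * N)            ≡⟨ cong (M *_) (ℕ.m∸n+n≡m le) ⟩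
    M * (c * x)                            ∎)
  where
  open ℕ.≤-Reasoning
  eq : ℤ.∣ + c ℤ.* + x ℤ.- + z ℤ.* + N ∣ ≡ c * x ∸ z * N
  eq = trans (cong₂ (λ a b → ℤ.∣ a ℤ.- b ∣) (sym (ℤ.pos-* c x)) (sym (ℤ.pos-* z N)))
    (cong ℤ.∣_∣ (trans (ℤ.[+m]-[+n]≡m⊖n (c * x) (z * N)) (ℤ.⊖-≥ le)))
... | inj₂ le = inj₂ (begin
    e + M * (c * x)                        ≤⟨ ℕ.+-monoˡ-≤ (M * (c * x)) (subst (λ y → e ≤ M * y) eq (h (+ z))) ⟩
    M * (z * N ∸ c * x) + M * (c * x)      ≡⟨ ℕ.*-distribˡ-+ M (z * N ∸ c * x) (c * x) ⟨
    M * (z * N ∸ c * x + c * x)            ≡⟨ cong (M *_) (ℕ.m∸n+n≡m le) ⟩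
    M * (z * N)                            ∎)
  where
  open ℕ.≤-Reasoning
  eq : ℤ.∣ + c ℤ.* + x ℤ.- + z ℤ.* + N ∣ ≡ z * N ∸ c * x
  eq = trans (cong₂ (λ a b → ℤ.∣ a ℤ.- b ∣) (sym (ℤ.pos-* c x)) (sym (ℤ.pos-* z N)))
    (trans (cong ℤ.∣_∣ (ℤ.[+m]-[+n]≡m⊖n (c * x) (z * N))) (ℤ.∣⊖∣-≤ le))

coarsen : ∀ a b {m M N X Y} → 0 < a → 0 < m → a * M ≤ b * m → m * N + M * Y < M * X → a * N + b * Y < b * X
coarsen a@(suc _) b {m@(suc _)} {M} {N} {X} {Y} _ _ aM≤bm h = ℕ.*-cancelˡ-< m _ _ (begin-strict
    m * (a * N + b * Y)              ≡⟨ e₁ m a N b Y ⟩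
    a * (m * N) + b * m * Y          <⟨ ℕ.+-monoˡ-< (b * m * Y) (ℕ.*-monoʳ-< a mN<Mδ) ⟩
    a * (M * δ) + b * m * Y          ≡⟨ cong (_+ b * m * Y) (ℕ.*-assoc a M δ) ⟨
    a * M * δ + b * m * Y            ≤⟨ ℕ.+-monoˡ-≤ (b * m * Y) (ℕ.*-monoˡ-≤ δ aM≤bm) ⟩
    b * m * δ + b * m * Y            ≡⟨ e₂ b m δ Y ⟩
    m * (b * (δ + Y))                ≡⟨ cong (λ y → m * (b * y)) δ+Y≡X ⟩
    m * (b * X)                      ∎)
  where
  open ℕ.≤-Reasoning
  e₁ : ∀ m a N b Y → m * (a * N + b * Y) ≡ a * (m * N) + b * m * Y
  e₁ = ℕRing.solve-∀
  e₂ : ∀ b m d Y → b * m * d + b * m * Y ≡ m * (b * (d + Y))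
  e₂ = ℕRing.solve-∀
  δ : ℕ
  δ = X ∸ Y
  Y<X : Y < X
  Y<X = ℕ.*-cancelˡ-< M Y X (ℕ.≤-<-trans (ℕ.m≤n+m (M * Y) (m * N)) h)
  δ+Y≡X : δ + Y ≡ X
  δ+Y≡X = ℕ.m∸n+n≡m (ℕ.<⇒≤ Y<X)
  mN<Mδ : m * N < M * δ
  mN<Mδ = ℕ.+-cancelʳ-< (M * Y) (m * N) (M * δ)
    (subst (m * N + M * Y <_) (trans (cong (M *_) (sym δ+Y≡X)) (ℕ.*-distribˡ-+ M δ Y)) h)

linear-absurd : ∀ {A B C D} p q s → A < B → C ≤ D → suc p * A + q * C ≡ suc p * B + q * D + s → ⊥
linear-absurd {A} {B} {C} {D} p q s A<B C≤D eq = ℕ.<-irrefl refl (begin-strict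
  suc p * A + q * C       <⟨ ℕ.+-mono-<-≤ (ℕ.*-monoʳ-< (suc p) A<B) (ℕ.*-monoʳ-≤ q C≤D) ⟩
  suc p * B + q * D       ≤⟨ ℕ.m≤m+n _ s ⟩
  suc p * B + q * D + s   ≡⟨ eq ⟨
  suc p * A + q * C       ∎)
  where open ℕ.≤-Reasoning

pinched : ∀ n m {N x} → 0 < m → let M = suc ((2 + n) * m) in
  m * N < M * x → m * N + M * (suc n * x) < M * (1 * N) →
  Away (suc (m * N)) M N (+ ((2 + n) * m) ℤ.* + x) → ⊥
pinched n m@(suc _) {N} {x} _ lo hi w with away-split {c = (2 + n) * m} {x} w m
... | inj₁ h = linear-absurd n (2 + n) (n * N) above (ℕ.<⇒≤ hi) (e n m N x)
  where
  e₁ : ∀ n m N x → m * N + suc ((2 + n) * m) * (m * N) ≡ m * (N + suc ((2 + n) * m) * N)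
  e₁ = ℕRing.solve-∀
  e₂ : ∀ n m x → suc ((2 + n) * m) * ((2 + n) * m * x) ≡ m * (suc ((2 + n) * m) * ((2 + n) * x))
  e₂ = ℕRing.solve-∀
  above : N + suc ((2 + n) * m) * N < suc ((2 + n) * m) * ((2 + n) * x)
  above = ℕ.*-cancelˡ-< m _ _ (subst₂ _<_ (e₁ n m N x) (e₂ n m x) h)
  e : ∀ n m N x → suc n * (N + suc ((2 + n) * m) * N) + (2 + n) * (m * N + suc ((2 + n) * m) * (suc n * x))
    ≡ suc n * (suc ((2 + n) * m) * ((2 + n) * x)) + (2 + n) * (suc ((2 + n) * m) * (1 * N)) + n * N
  e = ℕRing.solve-∀
... | inj₂ h = linear-absurd (suc n) 1 0 lo (ℕ.<⇒≤ below) (e n m N x)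
  where
  e₁ : ∀ n m N x → m * N + suc ((2 + n) * m) * ((2 + n) * m * x) ≡ m * (N + suc ((2 + n) * m) * ((2 + n) * x))
  e₁ = ℕRing.solve-∀
  e₂ : ∀ n m N → suc ((2 + n) * m) * (m * N) ≡ m * (suc ((2 + n) * m) * N)
  e₂ = ℕRing.solve-∀
  below : N + suc ((2 + n) * m) * ((2 + n) * x) < suc ((2 + n) * m) * N
  below = ℕ.*-cancelˡ-< m _ _ (subst₂ _<_ (e₁ n m N x) (e₂ n m N) h)
  e : ∀ n m N x → (2 + n) * (m * N) + 1 * (N + suc ((2 + n) * m) * ((2 + n) * x))
    ≡ (2 + n) * (suc ((2 + n) * m) * x) + 1 * (suc ((2 + n) * m) * N) + 0
  e = ℕRing.solve-∀

-- Adding a runner of speed n m to cs gives ML = m / (n m + 1), attained at time m / (n m + 1).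
Extremal : ℕ → List ℕ → Set
Extremal n cs = ∀ m → 2 ≤ m → let M = suc (n * m) in
  All (λ c → Away (m * M) M M (+ c ℤ.* + m)) cs ×
  (∀ N x → 0 < N → All (λ c → Away (suc (m * N)) M N (+ c ℤ.* x)) (n * m ∷ cs) → ⊥)

slow-attains : ∀ {n m c} → 0 < c → c < n → let M = suc (n * m) in Away (m * M) M M (+ c ℤ.* + m)
slow-attains {n} {m} {c} 0<c c<n = subst (Away (m * M) M M) (ℤ.pos-* c m) (residue-away cm≤M
  (subst (_≤ M * (c * m)) (ℕ.*-comm M m) (ℕ.*-monoʳ-≤ M (subst (_≤ c * m) (ℕ.*-identityˡ m) (ℕ.*-monoˡ-≤ m 0<c))))
  (subst (_≤ M * (M ∸ c * m)) (ℕ.*-comm M m) (ℕ.*-monoʳ-≤ M (ℕ.m+n≤o⇒m≤o∸n m m+cm≤M))))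
  where
  M = suc (n * m)
  m+cm≤M : m + c * m ≤ M
  m+cm≤M = ℕ.m≤n⇒m≤1+n (ℕ.*-monoˡ-≤ m c<n)
  cm≤M : c * m ≤ M
  cm≤M = ℕ.≤-trans (ℕ.m≤n+m (c * m) m) m+cm≤M

away-unit : ∀ {m M N x} → Away (suc (m * N)) M N (+ 1 ℤ.* + x) → m * N < M * x
away-unit {m} {M} {N} {x} h with away-split {c = 1} {x} h 0
... | inj₁ le = subst₂ (λ a b → suc a ≤ M * b) (trans (cong (λ y → m * N + y) (ℕ.*-zeroʳ M)) (ℕ.+-identityʳ (m * N))) (ℕ.+-identityʳ x) le
... | inj₂ le = contradiction (subst (suc (m * N + M * (1 * x)) ≤_) (ℕ.*-zeroʳ M) le) λ ()

-- A record, so that the coefficients can be read off from the types when inequalities are combined.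
record Less (N x i j k l : ℕ) : Set where
  constructor less
  field strict : i * N + j * x < k * N + l * x

record AtMost (N x i j k l : ℕ) : Set where
  constructor atMost
  field holds : i * N + j * x ≤ k * N + l * x

relax : ∀ {N x i j k l} → Less N x i j k l → AtMost N x i j k l
relax (less h) = atMost (ℕ.<⇒≤ h)

-- A Farkas certificate: with the multipliers `suc p` and `q` the coefficients of x cancel and those
-- of N have the wrong order. The two numerical conditions are decided by evaluation.
inconsistent : ∀ {N x i j k l i′ j′ k′ l′} p q → Less N x i j k l → AtMost N x i′ j′ k′ l′ →
  {_ : True (suc p * j + q * j′ ℕ.≟ suc p * l + q * l′)} → {_ : True (suc p * k + q * k′ ℕ.≤? suc p * i + q * i′)} → ⊥
inconsistent {N} {x} {i} {j} {k} {l} {i′} {j′} {k′} {l′} p q (less h) (atMost h′) {eq} {le} = ℕ.<-irrefl refl (begin-strict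
  suc p * (i * N + j * x) + q * (i′ * N + j′ * x)          <⟨ ℕ.+-mono-<-≤ (ℕ.*-monoʳ-< (suc p) h) (ℕ.*-monoʳ-≤ q h′) ⟩
  suc p * (k * N + l * x) + q * (k′ * N + l′ * x)          ≡⟨ e (suc p) q k l k′ l′ N x ⟩
  (suc p * k + q * k′) * N + (suc p * l + q * l′) * x      ≤⟨ ℕ.+-mono-≤ (ℕ.*-monoˡ-≤ N (toWitness le)) (ℕ.≤-reflexive (cong (_* x) (sym (toWitness eq)))) ⟩
  (suc p * i + q * i′) * N + (suc p * j + q * j′) * x      ≡⟨ e (suc p) q i j i′ j′ N x ⟨
  suc p * (i * N + j * x) + q * (i′ * N + j′ * x)          ∎)
  where
  open ℕ.≤-Reasoning
  e : ∀ p q i j i′ j′ N x → p * (i * N + j * x) + q * (i′ * N + j′ * x) ≡ (p * i + q * i′) * N + (p * j + q * j′) * x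
  e = ℕRing.solve-∀

-- Comparing ‖ c x / N ‖ with a threshold a / b ≤ m / M that does not depend on m.
module Coarse {m M N x : ℕ} (a b : ℕ) (0<a : 0 < a) (0<m : 0 < m) (aM≤bm : a * M ≤ b * m) where

  Above Below : (c z : ℕ) → Set
  Above c z = Less N x (a + b * z) 0 0 (b * c)
  Below c z = Less N x a (b * c) (b * z) 0

  above : ∀ c z → m * N + M * (z * N) < M * (c * x) → Above c z
  above c z h = less (subst₂ _<_ (e₁ a b z N x) (e₂ b c N x) (coarsen a b 0<a 0<m aM≤bm h))
    where
    e₁ : ∀ a b z N x → a * N + b * (z * N) ≡ (a + b * z) * N + 0 * x
    e₁ = ℕRing.solve-∀
    e₂ : ∀ b c N x → b * (c * x) ≡ 0 * N + b * c * x
    e₂ = ℕRing.solve-∀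

  below : ∀ c z → m * N + M * (c * x) < M * (z * N) → Below c z
  below c z h = less (subst₂ _<_ (e₁ a b c N x) (e₂ b z N x) (coarsen a b 0<a 0<m aM≤bm h))
    where
    e₁ : ∀ a b c N x → a * N + b * (c * x) ≡ a * N + b * c * x
    e₁ = ℕRing.solve-∀
    e₂ : ∀ b z N x → b * (z * N) ≡ b * z * N + 0 * x
    e₂ = ℕRing.solve-∀

  split : ∀ c z → Away (suc (m * N)) M N (+ c ℤ.* + x) → Above c z ⊎ Below c z
  split c z h = Sum.map (above c z) (below c z) (away-split {c = c} {x} h z)

half : ∀ {N x} → 2 * x ≤ N → AtMost N x 0 2 1 0
half {N} {x} h = atMost (subst (2 * x ≤_) (sym (e N x)) h)
  where
  e : ∀ N x → 1 * N + 0 * x ≡ N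
  e = ℕRing.solve-∀

-- The weaker threshold 1/5 already excludes later laps: runner 2 gives x < 2 N/5, while runner 3
-- beyond its first lap needs x > 2 N/5. The conclusion keeps the exact threshold m/M.
first-lap-123 : ∀ {m M N x} → 0 < m → 1 * M ≤ 5 * m → 2 * x ≤ N →
  All (λ c → Away (suc (m * N)) M N (+ c ℤ.* + x)) (1 ∷ 2 ∷ 3 ∷ []) → m * N + M * (3 * x) < M * (1 * N)
first-lap-123 {m} {M} {N} {x} 0<m M≤5m 2x≤N (_ ∷ a₂ ∷ a₃ ∷ []) = go (split 2 1 a₂) (away-split {c = 3} {x} a₃ 1)
  where
  open Coarse {m} {M} {N} {x} 1 5 (s≤s z≤n) 0<m M≤5m
  go : Above 2 1 ⊎ Below 2 1 → _ ⊎ _ → _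
  go (inj₁ h) _          = ⊥-elim (inconsistent 0 5 h (half 2x≤N))
  go (inj₂ h₂) (inj₁ h)  = ⊥-elim (inconsistent 1 3 (above 3 1 h) (relax h₂))
  go (inj₂ _)  (inj₂ h₃) = h₃

-- With threshold 1/7 the runners 2, 5, 3, 4 successively bound x/N by 3/7, 13/35, 2/7 and 3/14;
-- each bound prevents the next runner from having passed the integer in question, and the last one
-- keeps runner 5 in its first lap.
first-lap-12345 : ∀ {m M N x} → 0 < m → 1 * M ≤ 7 * m → 2 * x ≤ N →
  All (λ c → Away (suc (m * N)) M N (+ c ℤ.* + x)) (1 ∷ 2 ∷ 3 ∷ 4 ∷ 5 ∷ []) → m * N + M * (5 * x) < M * (1 * N)
first-lap-12345 {m} {M} {N} {x} 0<m M≤7m 2x≤N (_ ∷ a₂ ∷ a₃ ∷ a₄ ∷ a₅ ∷ []) =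
  go (split 2 1 a₂) (split 5 2 a₅) (split 3 1 a₃) (split 4 1 a₄) (away-split {c = 5} {x} a₅ 1)
  where
  open Coarse {m} {M} {N} {x} 1 7 (s≤s z≤n) 0<m M≤7m
  go : Above 2 1 ⊎ Below 2 1 → Above 5 2 ⊎ Below 5 2 → Above 3 1 ⊎ Below 3 1 → Above 4 1 ⊎ Below 4 1 → _ ⊎ _ → _
  go (inj₁ h)  _         _         _         _        = ⊥-elim (inconsistent 0 7 h (half 2x≤N))
  go (inj₂ h₂) (inj₁ h)  _         _         _        = ⊥-elim (inconsistent 1 5 h (relax h₂))
  go (inj₂ _)  (inj₂ h₅) (inj₁ h)  _         _        = ⊥-elim (inconsistent 4 3 h (relax h₅))
  go (inj₂ _)  (inj₂ _)  (inj₂ h₃) (inj₁ h)  _        = ⊥-elim (inconsistent 2 4 h (relax h₃))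
  go (inj₂ _)  (inj₂ _)  (inj₂ _)  (inj₂ h₄) (inj₁ h) = ⊥-elim (inconsistent 3 5 (above 5 1 h) (relax h₄))
  go (inj₂ _)  (inj₂ _)  (inj₂ _)  (inj₂ _)  (inj₂ h) = h

-- The threshold 2/13 is m/(6 m + 1) at m = 2, and it is just enough: if runner 4 has completed a
-- lap, runner 9 is pushed past 4, so x > 6 N/13, whereas runner 4 short of 2 needs x < 6 N/13. With
-- 1/7 the two inequalities would be compatible, since 29/63 < 13/28; hence the restriction to m ≥ 2
-- in `Extremal`.
first-lap-13459 : ∀ {m M N x} → 0 < m → 2 * M ≤ 13 * m → 2 * x ≤ N →
  All (λ c → Away (suc (m * N)) M N (+ c ℤ.* + x)) (1 ∷ 3 ∷ 4 ∷ 5 ∷ 9 ∷ []) → m * N + M * (5 * x) < M * (1 * N)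
first-lap-13459 {m} {M} {N} {x} 0<m 2M≤13m 2x≤N (_ ∷ a₃ ∷ a₄ ∷ a₅ ∷ a₉ ∷ []) =
  go (split 4 1 a₄) (split 3 1 a₃) (split 5 2 a₅) (split 9 4 a₉) (split 4 2 a₄)
  where
  open Coarse {m} {M} {N} {x} 2 13 (s≤s z≤n) 0<m 2M≤13m
  slow : Below 4 1 → m * N + M * (5 * x) < M * (1 * N)
  slow h₄ with away-split {c = 5} {x} a₅ 1
  ... | inj₁ h = ⊥-elim (inconsistent 3 5 (above 5 1 h) (relax h₄))
  ... | inj₂ h = h
  go : Above 4 1 ⊎ Below 4 1 → Above 3 1 ⊎ Below 3 1 → Above 5 2 ⊎ Below 5 2 → Above 9 4 ⊎ Below 9 4 →
       Above 4 2 ⊎ Below 4 2 → m * N + M * (5 * x) < M * (1 * N)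
  go (inj₂ h₄) _         _         _         _        = slow h₄
  go (inj₁ h₄) (inj₂ h)  _         _         _        = ⊥-elim (inconsistent 2 4 h₄ (relax h))
  go (inj₁ _)  (inj₁ h₃) (inj₂ h)  _         _        = ⊥-elim (inconsistent 4 3 h₃ (relax h))
  go (inj₁ _)  (inj₁ _)  (inj₁ h₅) (inj₂ h)  _        = ⊥-elim (inconsistent 8 5 h₅ (relax h))
  go (inj₁ _)  (inj₁ _)  (inj₁ _)  (inj₁ _)  (inj₁ h) = ⊥-elim (inconsistent 0 26 h (half 2x≤N))
  go (inj₁ _)  (inj₁ _)  (inj₁ _)  (inj₁ h₉) (inj₂ h) = ⊥-elim (inconsistent 3 9 h₉ (relax h))

-- 9 m = M + r with M = 6 m + 1 and r = 3 m − 1.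
nine-attains : ∀ {m M r} → r + M ≡ 9 * m → m ≤ r → m + r ≤ M → Away (m * M) M M (+ 9 ℤ.* + m)
nine-attains {m} {M} {r} eq m≤r m+r≤M = subst (Away (m * M) M M)
  (trans (cong (λ y → + r ℤ.+ y) (ℤ.*-identityˡ (+ M))) (trans (cong +_ eq) (ℤ.pos-* 9 m)))
  (away-cong (+ 1) (residue-away (ℕ.≤-trans (ℕ.m≤n+m r m) m+r≤M)
    (subst (_≤ M * r) (ℕ.*-comm M m) (ℕ.*-monoʳ-≤ M m≤r))
    (subst (_≤ M * (M ∸ r)) (ℕ.*-comm M m) (ℕ.*-monoʳ-≤ M (ℕ.m+n≤o⇒m≤o∸n m m+r≤M)))))

extremal-123 : Extremal 4 (1 ∷ 2 ∷ 3 ∷ [])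
extremal-123 m@(suc m′) _ = (slow 1 ∷ slow 2 ∷ slow 3 ∷ []) , λ N x 0<N → reduce-to-half 0<N (bounded N) x
  where
  slow : ∀ c {_ : True (0 ℕ.<? c)} {_ : True (c ℕ.<? 4)} → Away (m * suc (4 * m)) (suc (4 * m)) (suc (4 * m)) (+ c ℤ.* + m)
  slow c {p} {q} = slow-attains (toWitness p) (toWitness q)
  e : ∀ m → 1 * suc (4 * suc m) + m ≡ 5 * suc m
  e = ℕRing.solve-∀
  bounded : ∀ N x → 2 * x ≤ N → All (λ c → Away (suc (m * N)) (suc (4 * m)) N (+ c ℤ.* + x)) (4 * m ∷ 1 ∷ 2 ∷ 3 ∷ []) → ⊥
  bounded N x 2x≤N (aW ∷ as) = pinched 2 m {N} {x} (s≤s z≤n) (away-unit {m} {suc (4 * m)} {N} {x} (All.head as))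
    (first-lap-123 {m} {suc (4 * m)} {N} {x} (s≤s z≤n) (subst (1 * suc (4 * m) ≤_) (e m′) (ℕ.m≤m+n _ m′)) 2x≤N as) aW

extremal-12345 : Extremal 6 (1 ∷ 2 ∷ 3 ∷ 4 ∷ 5 ∷ [])
extremal-12345 m@(suc m′) _ = (slow 1 ∷ slow 2 ∷ slow 3 ∷ slow 4 ∷ slow 5 ∷ []) , λ N x 0<N → reduce-to-half 0<N (bounded N) x
  where
  slow : ∀ c {_ : True (0 ℕ.<? c)} {_ : True (c ℕ.<? 6)} → Away (m * suc (6 * m)) (suc (6 * m)) (suc (6 * m)) (+ c ℤ.* + m)
  slow c {p} {q} = slow-attains (toWitness p) (toWitness q)
  e : ∀ m → 1 * suc (6 * suc m) + m ≡ 7 * suc m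
  e = ℕRing.solve-∀
  bounded : ∀ N x → 2 * x ≤ N → All (λ c → Away (suc (m * N)) (suc (6 * m)) N (+ c ℤ.* + x)) (6 * m ∷ 1 ∷ 2 ∷ 3 ∷ 4 ∷ 5 ∷ []) → ⊥
  bounded N x 2x≤N (aW ∷ as) = pinched 4 m {N} {x} (s≤s z≤n) (away-unit {m} {suc (6 * m)} {N} {x} (All.head as))
    (first-lap-12345 {m} {suc (6 * m)} {N} {x} (s≤s z≤n) (subst (1 * suc (6 * m) ≤_) (e m′) (ℕ.m≤m+n _ m′)) 2x≤N as) aW

extremal-13459 : Extremal 6 (1 ∷ 3 ∷ 4 ∷ 5 ∷ 9 ∷ [])
extremal-13459 (suc zero) (s≤s ())
extremal-13459 m@(suc (suc m′)) _ =
  (slow 1 ∷ slow 3 ∷ slow 4 ∷ slow 5 ∷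
    nine-attains (e₁ m′) (subst (m ≤_) (e₂ m′) (ℕ.m≤m+n m _)) (subst (m + (3 * m′ + 5) ≤_) (e₃ m′) (ℕ.m≤m+n (m + (3 * m′ + 5)) _)) ∷ []) ,
  λ N x 0<N → reduce-to-half 0<N (bounded N) x
  where
  slow : ∀ c {_ : True (0 ℕ.<? c)} {_ : True (c ℕ.<? 6)} → Away (m * suc (6 * m)) (suc (6 * m)) (suc (6 * m)) (+ c ℤ.* + m)
  slow c {p} {q} = slow-attains (toWitness p) (toWitness q)
  e : ∀ m → 2 * suc (6 * (2 + m)) + m ≡ 13 * (2 + m)
  e = ℕRing.solve-∀
  e₁ : ∀ m → 3 * m + 5 + suc (6 * (2 + m)) ≡ 9 * (2 + m)
  e₁ = ℕRing.solve-∀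
  e₂ : ∀ m → 2 + m + (2 * m + 3) ≡ 3 * m + 5
  e₂ = ℕRing.solve-∀
  e₃ : ∀ m → 2 + m + (3 * m + 5) + (2 * m + 6) ≡ suc (6 * (2 + m))
  e₃ = ℕRing.solve-∀
  bounded : ∀ N x → 2 * x ≤ N → All (λ c → Away (suc (m * N)) (suc (6 * m)) N (+ c ℤ.* + x)) (6 * m ∷ 1 ∷ 3 ∷ 4 ∷ 5 ∷ 9 ∷ []) → ⊥
  bounded N x 2x≤N (aW ∷ as) = pinched 4 m {N} {x} (s≤s z≤n) (away-unit {m} {suc (6 * m)} {N} {x} (All.head as))
    (first-lap-13459 {m} {suc (6 * m)} {N} {x} (s≤s z≤n) (subst (2 * suc (6 * m) ≤_) (e m′) (ℕ.m≤m+n _ m′)) 2x≤N as) aW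

-- Rational times and the maximum

-- Kept abstract: unfolding _/_ makes the type checker compute greatest common divisors.
abstract
  ι : ℤ → ℚ
  ι z = z / 1

  -- frac x n is x / (n + 1).
  frac : ℤ → ℕ → ℚ
  frac x n = x / suc n

  ι-def : ∀ z → ι z ≡ z / 1
  ι-def z = refl

  frac-def : ∀ x n → frac x n ≡ x / suc n
  frac-def x n = refl

  ι-+ : ∀ a b → ι (a ℤ.+ b) ≡ ι a ℚ.+ ι b
  ι-+ a b rewrite /1-def a | /1-def b = cong (_/ 1) (sym (cong₂ ℤ._+_ (ℤ.*-identityʳ a) (ℤ.*-identityʳ b)))

  ι-* : ∀ a b → ι (a ℤ.* b) ≡ ι a ℚ.* ι b
  ι-* a b rewrite /1-def a | /1-def b = refl

  ι-neg : ∀ a → ι (ℤ.- a) ≡ ℚ.- ι a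
  ι-neg a rewrite /1-def a | /1-def (ℤ.- a) with a
  ... | + 0       = refl
  ... | + suc _   = refl
  ... | -[1+ _ ]  = refl

  ι-abs : ∀ a → ℚ.∣ ι a ∣ ≡ ι (+ ℤ.∣ a ∣)
  ι-abs a rewrite /1-def a | /1-def (+ ℤ.∣ a ∣) = refl

  ι-mono-≤ : ∀ {a b} → a ℤ.≤ b → ι a ℚ.≤ ι b
  ι-mono-≤ = /1-mono

  ι-mono-< : ∀ {a b} → a ℤ.< b → ι a ℚ.< ι b
  ι-mono-< {a} {b} a<b rewrite /1-def a | /1-def b = ℚ.*<* (ℤ.*-monoʳ-<-pos (+ 1) a<b)

  ι-positive : ∀ n → ℚ.Positive (ι (+ suc n))
  ι-positive n = ℚ.positive (ι-mono-< {+ 0} {+ suc n} (ℤ.+<+ (s≤s z≤n)))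

  ι-nonNegative : ∀ n → ℚ.NonNegative (ι (+ n))
  ι-nonNegative n = ℚ.nonNegative (/1-mono {+ 0} {+ n} (ℤ.+≤+ z≤n))

  frac-* : ∀ x n → frac x n ℚ.* ι (+ suc n) ≡ ι x
  frac-* x n = ℚ.toℚᵘ-injective (ℚᵘ.≃-trans (ℚ.toℚᵘ-homo-* (x / suc n) (+ suc n / 1))
    (ℚᵘ.≃-trans (ℚᵘ.*-cong (ℚ.toℚᵘ-fromℚᵘ (mkℚᵘ x n)) (ℚ.toℚᵘ-fromℚᵘ (mkℚᵘ (+ suc n) 0)))
      (ℚᵘ.≃-trans (*≡* (e x (+ suc n))) (ℚᵘ.≃-sym (ℚ.toℚᵘ-fromℚᵘ (mkℚᵘ x 0))))))
    where
    e : ∀ x n → x ℤ.* n ℤ.* + 1 ≡ x ℤ.* (n ℤ.* + 1)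
    e = solve-∀

  nearest-ι : ∀ p → ∃[ z ] ‖ p ‖ℚ ≡ ℚ.∣ p ℚ.- ι z ∣
  nearest-ι = nearest

  ‖‖-≤-∣-ι∣ : ∀ p z → ‖ p ‖ℚ ℚ.≤ ℚ.∣ p ℚ.- ι z ∣
  ‖‖-≤-∣-ι∣ = ‖‖ℚ-minimal

  ι-floor-≤ : ∀ p → ι (ℚ.floor p) ℚ.≤ p
  ι-floor-≤ = floor-≤

  ≤-ι-suc-floor : ∀ p → p ℚ.≤ ι (ℤ.suc (ℚ.floor p))
  ≤-ι-suc-floor = ≤-suc-floor

ι-sub : ∀ a b → ι (a ℤ.- b) ≡ ι a ℚ.- ι b
ι-sub a b = trans (ι-+ a (ℤ.- b)) (cong (λ y → ι a ℚ.+ y) (ι-neg b))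

ι-cancel-< : ∀ {a b} → ι a ℚ.< ι b → a ℤ.< b
ι-cancel-< {a} {b} a<b = ℤ.≰⇒> λ b≤a → ℚ.<-irrefl refl (ℚ.<-≤-trans a<b (ι-mono-≤ b≤a))

distance-scaled : ∀ v x n z → ℚ.∣ ι (+ v) ℚ.* (frac x n) ℚ.- ι z ∣ ℚ.* ι (+ suc n) ≡ ι (+ ℤ.∣ + v ℤ.* x ℤ.- z ℤ.* + suc n ∣)
distance-scaled v x n z = begin
  ℚ.∣ p ∣ ℚ.* N                                        ≡⟨ cong (ℚ.∣ p ∣ ℚ.*_) (ι-abs (+ suc n)) ⟨
  ℚ.∣ p ∣ ℚ.* ℚ.∣ N ∣                                  ≡⟨ ℚ.∣p*q∣≡∣p∣*∣q∣ p N ⟨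
  ℚ.∣ p ℚ.* N ∣                                        ≡⟨ cong ℚ.∣_∣ (e (ι (+ v)) (frac x n) (ι z) N) ⟩
  ℚ.∣ ι (+ v) ℚ.* ((frac x n) ℚ.* N) ℚ.- ι z ℚ.* N ∣  ≡⟨ cong (λ y → ℚ.∣ ι (+ v) ℚ.* y ℚ.- ι z ℚ.* N ∣) (frac-* x n) ⟩
  ℚ.∣ ι (+ v) ℚ.* ι x ℚ.- ι z ℚ.* N ∣                  ≡⟨ cong₂ (λ a b → ℚ.∣ a ℚ.- b ∣) (ι-* (+ v) x) (ι-* z (+ suc n)) ⟨
  ℚ.∣ ι (+ v ℤ.* x) ℚ.- ι (z ℤ.* + suc n) ∣            ≡⟨ cong ℚ.∣_∣ (ι-sub (+ v ℤ.* x) (z ℤ.* + suc n)) ⟨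
  ℚ.∣ ι (+ v ℤ.* x ℤ.- z ℤ.* + suc n) ∣                ≡⟨ ι-abs _ ⟩
  ι (+ ℤ.∣ + v ℤ.* x ℤ.- z ℤ.* + suc n ∣)              ∎
  where
  open ≡-Reasoning
  open +-*-Solver
  N p : ℚ
  N = ι (+ suc n)
  p = ι (+ v) ℚ.* (frac x n) ℚ.- ι z
  e : ∀ v t z n → (v ℚ.* t ℚ.- z) ℚ.* n ≡ v ℚ.* (t ℚ.* n) ℚ.- z ℚ.* n
  e = solve 4 (λ v t z n → (v :* t :- z) :* n := v :* (t :* n) :- z :* n) refl

scale-left : ∀ a b n → ((frac (+ a) b) ℚ.* ι (+ suc b)) ℚ.* ι (+ suc n) ≡ ι (+ (a * suc n))
scale-left a b n = trans (cong (ℚ._* ι (+ suc n)) (frac-* (+ a) b)) (trans (sym (ι-* (+ a) (+ suc n))) (cong ι (sym (ℤ.pos-* a (suc n)))))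

scale-right : ∀ X b n w → X ℚ.* ι (+ suc n) ≡ ι (+ w) → (X ℚ.* ι (+ suc b)) ℚ.* ι (+ suc n) ≡ ι (+ (suc b * w))
scale-right X b n w eq = trans (e X (ι (+ suc b)) (ι (+ suc n))) (trans (cong (ι (+ suc b) ℚ.*_) eq)
  (trans (sym (ι-* (+ suc b) (+ w))) (cong ι (sym (ℤ.pos-* (suc b) w)))))
  where
  open +-*-Solver
  e : ∀ x b n → x ℚ.* b ℚ.* n ≡ b ℚ.* (x ℚ.* n)
  e = solve 3 (λ x b n → x :* b :* n := b :* (x :* n)) refl

away⇒≤‖‖ : ∀ {a b n v x} → Away (a * suc n) (suc b) (suc n) (+ v ℤ.* x) → (frac (+ a) b) ℚ.≤ ‖ ι (+ v) ℚ.* (frac x n) ‖ℚ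
away⇒≤‖‖ {a} {b} {n} {v} {x} (away h) with nearest-ι (ι (+ v) ℚ.* (frac x n))
... | z , eq = subst ((frac (+ a) b) ℚ.≤_) (sym eq)
  (ℚ.*-cancelʳ-≤-pos (ι (+ suc b)) {{ι-positive b}} (ℚ.*-cancelʳ-≤-pos (ι (+ suc n)) {{ι-positive n}}
    (subst₂ ℚ._≤_ (sym (scale-left a b n)) (sym (scale-right ℚ.∣ ι (+ v) ℚ.* (frac x n) ℚ.- ι z ∣ b n ℤ.∣ + v ℤ.* x ℤ.- z ℤ.* + suc n ∣ (distance-scaled v x n z)))
      (ι-mono-≤ {+ (a * suc n)} {+ (suc b * ℤ.∣ + v ℤ.* x ℤ.- z ℤ.* + suc n ∣)} (ℤ.+≤+ (h z))))))

<‖‖⇒away : ∀ {a b n v x} → (frac (+ a) b) ℚ.< ‖ ι (+ v) ℚ.* (frac x n) ‖ℚ → Away (suc (a * suc n)) (suc b) (suc n) (+ v ℤ.* x)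
<‖‖⇒away {a} {b} {n} {v} {x} h = away λ z → ℤ.drop‿+<+ (ι-cancel-< {+ (a * suc n)} {+ (suc b * ℤ.∣ + v ℤ.* x ℤ.- z ℤ.* + suc n ∣)}
  (subst₂ ℚ._<_ (scale-left a b n) (scale-right ℚ.∣ ι (+ v) ℚ.* (frac x n) ℚ.- ι z ∣ b n ℤ.∣ + v ℤ.* x ℤ.- z ℤ.* + suc n ∣ (distance-scaled v x n z))
    (ℚ.*-monoˡ-<-pos (ι (+ suc n)) {{ι-positive n}} (ℚ.*-monoˡ-<-pos (ι (+ suc b)) {{ι-positive b}}
      (ℚ.<-≤-trans h (‖‖-≤-∣-ι∣ (ι (+ v) ℚ.* (frac x n)) z))))))

loneliness : ∀ {k} → (Fin (suc k) → ℕ) → ℚ → ℚ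
loneliness {zero}  v p = ‖ ι (+ v zero) ℚ.* p ‖ℚ
loneliness {suc k} v p = ‖ ι (+ v zero) ℚ.* p ‖ℚ ℚ.⊓ loneliness (v ∘ suc) p

seq-minimum : ∀ {k} (v : Fin (suc k) → ℕ) t n → seq (minimum (λ i → ‖ v i · t ‖)) n ≡ loneliness v (seq t n)
seq-minimum {zero}  v t n = cong (λ c → ‖ c ℚ.* seq t n ‖ℚ) (sym (ι-def (+ v zero)))
seq-minimum {suc k} v t n = cong₂ (λ c m → ‖ c ℚ.* seq t n ‖ℚ ℚ.⊓ m) (sym (ι-def (+ v zero))) (seq-minimum (v ∘ suc) t n)

loneliness-≤ : ∀ {k} (v : Fin (suc k) → ℕ) p i → loneliness v p ℚ.≤ ‖ ι (+ v i) ℚ.* p ‖ℚ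
loneliness-≤ {zero}  v p zero    = ℚ.≤-refl
loneliness-≤ {suc k} v p zero    = ℚ.p⊓q≤p _ _
loneliness-≤ {suc k} v p (suc i) = ℚ.≤-trans (ℚ.p⊓q≤q ‖ ι (+ v zero) ℚ.* p ‖ℚ _) (loneliness-≤ (v ∘ suc) p i)

loneliness-attained : ∀ {k} (v : Fin (suc k) → ℕ) p → ∃[ i ] loneliness v p ≡ ‖ ι (+ v i) ℚ.* p ‖ℚ
loneliness-attained {zero}  v p = zero , refl
loneliness-attained {suc k} v p with ℚ.⊓-sel ‖ ι (+ v zero) ℚ.* p ‖ℚ (loneliness (v ∘ suc) p) | loneliness-attained (v ∘ suc) p
... | inj₁ eq | _      = zero , eq
... | inj₂ eq | i , eq′ = suc i , trans eq eq′

≤-loneliness : ∀ {k} (v : Fin (suc k) → ℕ) p {ρ} → (∀ i → ρ ℚ.≤ ‖ ι (+ v i) ℚ.* p ‖ℚ) → ρ ℚ.≤ loneliness v p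
≤-loneliness v p {ρ} h with loneliness-attained v p
... | i , eq = subst (ρ ℚ.≤_) (sym eq) (h i)

commonMultiple : ∀ {n} (f : Fin n → ℕ) → (∀ i → 0 < f i) → ∃[ Q ] 0 < Q × (∀ i → f i ∣ Q)
commonMultiple {zero}  f pos = 1 , s≤s z≤n , λ ()
commonMultiple {suc n} f pos with commonMultiple (f ∘ suc) (pos ∘ suc)
... | Q , 0<Q , h = f zero * Q , ℕ.*-mono-< (pos zero) 0<Q , λ { zero → ∣.m∣m*n Q ; (suc i) → ∣.∣n⇒∣m*n (f zero) (h i) }

argmax : ∀ (f : ℕ → ℚ) n → ∃[ j ] ∀ i → i ≤ n → f i ℚ.≤ f j
argmax f zero = 0 , λ { zero z≤n → ℚ.≤-refl }
argmax f (suc n) with argmax f n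
... | j , h with ℚ.≤-total (f j) (f (suc n))
...   | inj₁ le = suc n , λ i i≤ → Sum.[ (λ i<sn → ℚ.≤-trans (h i (ℕ.≤-pred i<sn)) le) , (λ { refl → ℚ.≤-refl }) ]′ (ℕ.m≤n⇒m<n∨m≡n i≤)
...   | inj₂ ge = j , λ i i≤ → Sum.[ (λ i<sn → h i (ℕ.≤-pred i<sn)) , (λ { refl → ge }) ]′ (ℕ.m≤n⇒m<n∨m≡n i≤)

-- Moving right on the left of z only brings a point closer to z, so the arc of radius ρ around z
-- must be left on its right side. `entering` is the mirror image.
leaving : ∀ {ρ y y′} z → y ℚ.≤ y′ → ℚ.∣ y ℚ.- ι z ∣ ℚ.< ρ → ρ ℚ.≤ ℚ.∣ y′ ℚ.- ι z ∣ → y ℚ.< ι z ℚ.+ ρ × ι z ℚ.+ ρ ℚ.≤ y′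
leaving {ρ} {y} {y′} z y≤y′ near far = ℚ.≤-<-trans (p≤q+∣p-q∣ y (ι z)) (ℚ.+-monoʳ-< (ι z) near) , out
  where
  open +-*-Solver
  out : ι z ℚ.+ ρ ℚ.≤ y′
  out with ℚ.≤-total y′ (ι z)
  ... | inj₁ y′≤z = contradiction (ℚ.<-≤-trans near (ℚ.≤-trans far
          (subst₂ ℚ._≤_ (∣p-q∣≡∣q-p∣ (ι z) y′) (∣p-q∣≡∣q-p∣ (ι z) y) (dist-mono y≤y′ y′≤z)))) (ℚ.<-irrefl refl)
  ... | inj₂ z≤y′ = subst (ι z ℚ.+ ρ ℚ.≤_) (solve 2 (λ a b → a :+ (b :- a) := b) refl (ι z) y′)
          (ℚ.+-monoʳ-≤ (ι z) (subst (ρ ℚ.≤_) (ℚ.0≤p⇒∣p∣≡p (subst (ℚ._≤ y′ ℚ.- ι z) (ℚ.+-inverseʳ (ι z)) (ℚ.+-monoˡ-≤ (ℚ.- ι z) z≤y′))) far))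

entering : ∀ {ρ y y′} z → y ℚ.≤ y′ → ρ ℚ.≤ ℚ.∣ y ℚ.- ι z ∣ → ℚ.∣ y′ ℚ.- ι z ∣ ℚ.< ρ → y ℚ.+ ρ ℚ.≤ ι z × ι z ℚ.< y′ ℚ.+ ρ
entering {ρ} {y} {y′} z y≤y′ far near = out ,
  ℚ.≤-<-trans (p≤q+∣p-q∣ (ι z) y′) (ℚ.+-monoʳ-< y′ (subst (ℚ._< ρ) (∣p-q∣≡∣q-p∣ y′ (ι z)) near))
  where
  open +-*-Solver
  out : y ℚ.+ ρ ℚ.≤ ι z
  out with ℚ.≤-total y (ι z)
  ... | inj₂ z≤y = contradiction (ℚ.<-≤-trans near (ℚ.≤-trans far
          (subst₂ ℚ._≤_ (∣p-q∣≡∣q-p∣ (ι z) y) (∣p-q∣≡∣q-p∣ (ι z) y′) (dist-mono′ z≤y y≤y′)))) (ℚ.<-irrefl refl)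
  ... | inj₁ y≤z = subst (y ℚ.+ ρ ℚ.≤_) (solve 2 (λ a b → a :+ (b :- a) := b) refl y (ι z))
          (ℚ.+-monoʳ-≤ y (subst (ρ ℚ.≤_) (trans (∣p-q∣≡∣q-p∣ y (ι z)) (ℚ.0≤p⇒∣p∣≡p (subst (ℚ._≤ ι z ℚ.- y) (ℚ.+-inverseʳ y) (ℚ.+-monoˡ-≤ (ℚ.- y) y≤z)))) far))

-- If the loneliness drops on both sides of p inside a cell [ j/Q , (j+1)/Q ], then runner i meets
-- ρ on the way up and runner d on the way down, so an integer lies strictly inside (vᵢ + v_d) times the cell.
module Grid {k} (v : Fin (suc k) → ℕ) (q : ℕ) (common : ∀ i j → v i + v j ∣ suc q) where
  private
    Q : ℕ
    Q = suc q

  no-integer-inside : ∀ {s} j Z → s ∣ Q → ι (+ s) ℚ.* (frac j q) ℚ.< ι Z → ι Z ℚ.< ι (+ s) ℚ.* (frac (ℤ.suc j) q) → ⊥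
  no-integer-inside {s} j Z (divides m eq) lo hi = ℤ.<-irrefl refl (ℤ.<-≤-trans hi′ (ℤ.i<j⇒suc[i]≤j lo′))
    where
    instance
      posQ = ι-positive q
      nonNeg-s : ℤ.NonNegative (+ s)
      nonNeg-s = _
    cleared : ∀ x → ι (+ s) ℚ.* (frac x q) ℚ.* ι (+ Q) ≡ ι (+ s ℤ.* x)
    cleared x = trans (ℚ.*-assoc (ι (+ s)) (frac x q) (ι (+ Q))) (trans (cong (ι (+ s) ℚ.*_) (frac-* x q)) (sym (ι-* (+ s) x)))
    ZQ : ι Z ℚ.* ι (+ Q) ≡ ι (+ s ℤ.* (Z ℤ.* + m))
    ZQ = trans (sym (ι-* Z (+ Q))) (cong ι (trans (cong (λ y → Z ℤ.* y) (trans (cong +_ eq) (ℤ.pos-* m s))) (e Z (+ m) (+ s))))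
      where
      e : ∀ z m s → z ℤ.* (m ℤ.* s) ≡ s ℤ.* (z ℤ.* m)
      e = solve-∀
    lo′ : j ℤ.< Z ℤ.* + m
    lo′ = ℤ.*-cancelˡ-<-nonNeg (+ s) (ι-cancel-< (subst₂ ℚ._<_ (cleared j) ZQ (ℚ.*-monoˡ-<-pos (ι (+ Q)) lo)))
    hi′ : Z ℤ.* + m ℤ.< ℤ.suc j
    hi′ = ℤ.*-cancelˡ-<-nonNeg (+ s) (ι-cancel-< (subst₂ ℚ._<_ ZQ (cleared (ℤ.suc j)) (ℚ.*-monoˡ-<-pos (ι (+ Q)) hi)))

  grid : ∀ p → ∃[ j ] loneliness v p ℚ.≤ loneliness v (frac j q)
  grid p with loneliness v p ℚ.≤? loneliness v (frac j q) | loneliness v p ℚ.≤? loneliness v (frac (ℤ.suc j) q)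
    where j = ℚ.floor (p ℚ.* ι (+ Q))
  ... | yes le | _      = ℚ.floor (p ℚ.* ι (+ Q)) , le
  ... | no _   | yes le = ℤ.suc (ℚ.floor (p ℚ.* ι (+ Q))) , le
  ... | no ¬l  | no ¬r  with loneliness-attained v (frac (ℚ.floor (p ℚ.* ι (+ Q))) q) | loneliness-attained v (frac (ℤ.suc (ℚ.floor (p ℚ.* ι (+ Q)))) q)
  ...   | i , eqᵢ | d , eq_d with nearest-ι (ι (+ v i) ℚ.* (frac (ℚ.floor (p ℚ.* ι (+ Q))) q)) | nearest-ι (ι (+ v d) ℚ.* (frac (ℤ.suc (ℚ.floor (p ℚ.* ι (+ Q)))) q))
  ...     | z , eqz | y , eqy = ⊥-elim (no-integer-inside j (z ℤ.+ y) (common i d) lo hi)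
    where
    open +-*-Solver
    j : ℤ
    j = ℚ.floor (p ℚ.* ι (+ Q))
    ρ A B a b : ℚ
    ρ = loneliness v p
    A = frac j q
    B = frac (ℤ.suc j) q
    a = ι (+ v i)
    b = ι (+ v d)
    instance
      posQ = ι-positive q
      nn-a = ι-nonNegative (v i)
      nn-b = ι-nonNegative (v d)
    A≤p : A ℚ.≤ p
    A≤p = ℚ.*-cancelʳ-≤-pos (ι (+ Q)) (subst (ℚ._≤ p ℚ.* ι (+ Q)) (sym (frac-* j q)) (ι-floor-≤ (p ℚ.* ι (+ Q))))
    p≤B : p ℚ.≤ B
    p≤B = ℚ.*-cancelʳ-≤-pos (ι (+ Q)) (subst (p ℚ.* ι (+ Q) ℚ.≤_) (sym (frac-* (ℤ.suc j) q)) (≤-ι-suc-floor (p ℚ.* ι (+ Q))))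
    up : a ℚ.* A ℚ.< ι z ℚ.+ ρ × ι z ℚ.+ ρ ℚ.≤ a ℚ.* p
    up = leaving z (ℚ.*-monoˡ-≤-nonNeg a A≤p) (subst (ℚ._< ρ) (trans eqᵢ eqz) (ℚ.≰⇒> ¬l))
      (ℚ.≤-trans (loneliness-≤ v p i) (‖‖-≤-∣-ι∣ (a ℚ.* p) z))
    down : b ℚ.* p ℚ.+ ρ ℚ.≤ ι y × ι y ℚ.< b ℚ.* B ℚ.+ ρ
    down = entering y (ℚ.*-monoˡ-≤-nonNeg b p≤B) (ℚ.≤-trans (loneliness-≤ v p d) (‖‖-≤-∣-ι∣ (b ℚ.* p) y))
      (subst (ℚ._< ρ) (trans eq_d eqy) (ℚ.≰⇒> ¬r))
    cancel-ρ : ∀ {x x′} → x ℚ.+ ρ ℚ.< x′ ℚ.+ ρ → x ℚ.< x′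
    cancel-ρ {x} {x′} h = subst₂ ℚ._<_ (e x ρ) (e x′ ρ) (ℚ.+-monoˡ-< (ℚ.- ρ) h)
      where
      e : ∀ x r → x ℚ.+ r ℚ.- r ≡ x
      e = solve 2 (λ x r → x :+ r :- r := x) refl
    sum-speed : ι (+ (v i + v d)) ≡ a ℚ.+ b
    sum-speed = ι-+ (+ v i) (+ v d)
    -- The bound for runner i has ρ on the side of z, the bound for runner d has it on the side of
    -- the runner, so ρ cancels in the sum.
    lo : ι (+ (v i + v d)) ℚ.* A ℚ.< ι (z ℤ.+ y)
    lo = subst₂ ℚ._<_ (cong (ℚ._* A) (sym sum-speed)) (sym (ι-+ z y)) (cancel-ρ (subst₂ ℚ._<_
      (solve 4 (λ a b t r → a :* t :+ (b :* t :+ r) := (a :+ b) :* t :+ r) refl a b A ρ)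
      (solve 3 (λ z y r → z :+ r :+ y := z :+ y :+ r) refl (ι z) (ι y) ρ)
      (ℚ.+-mono-<-≤ (proj₁ up) (ℚ.≤-trans (ℚ.+-monoˡ-≤ ρ (ℚ.*-monoˡ-≤-nonNeg b A≤p)) (proj₁ down)))))
    hi : ι (z ℤ.+ y) ℚ.< ι (+ (v i + v d)) ℚ.* B
    hi = subst₂ ℚ._<_ (sym (ι-+ z y)) (cong (ℚ._* B) (sym sum-speed)) (cancel-ρ (subst₂ ℚ._<_
      (solve 3 (λ z y r → z :+ r :+ y := z :+ y :+ r) refl (ι z) (ι y) ρ)
      (solve 4 (λ a b t r → a :* t :+ (b :* t :+ r) := (a :+ b) :* t :+ r) refl a b B ρ)
      (ℚ.+-mono-≤-< (ℚ.≤-trans (proj₂ up) (ℚ.*-monoˡ-≤-nonNeg a p≤B)) (proj₂ down))))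

  periodic : ∀ j → loneliness v (frac j q) ℚ.≤ loneliness v (frac (+ (j ℤ.%ℕ Q)) q)
  periodic j = ≤-loneliness v (frac r q) λ i → case i
    where
    open +-*-Solver
    instance posQ = ι-positive q
    r : ℤ
    r = + (j ℤ.%ℕ Q)
    c : ℤ
    c = j ℤ./ℕ Q
    cancelQ : ∀ {x y} → x ℚ.* ι (+ Q) ≡ y ℚ.* ι (+ Q) → x ≡ y
    cancelQ eq = ℚ.≤-antisym (ℚ.*-cancelʳ-≤-pos (ι (+ Q)) (ℚ.≤-reflexive eq)) (ℚ.*-cancelʳ-≤-pos (ι (+ Q)) (ℚ.≤-reflexive (sym eq)))
    j≡ : frac j q ≡ frac r q ℚ.+ ι c
    j≡ = cancelQ (trans (frac-* j q) (trans (cong ι (ℤ.a≡a%ℕn+[a/ℕn]*n j Q)) (trans (ι-+ r (c ℤ.* + Q))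
      (trans (cong₂ ℚ._+_ (sym (frac-* r q)) (ι-* c (+ Q))) (sym (ℚ.*-distribʳ-+ (ι (+ Q)) (frac r q) (ι c)))))))
    case : ∀ i → loneliness v (frac j q) ℚ.≤ ‖ ι (+ v i) ℚ.* (frac r q) ‖ℚ
    case i with nearest-ι (ι (+ v i) ℚ.* (frac r q))
    ... | z , eq = ℚ.≤-trans (loneliness-≤ v (frac j q) i) (ℚ.≤-trans (‖‖-≤-∣-ι∣ (ι (+ v i) ℚ.* (frac j q)) (z ℤ.+ + v i ℤ.* c))
      (ℚ.≤-reflexive (trans (cong ℚ.∣_∣ (trans (cong₂ (λ a b → ι (+ v i) ℚ.* a ℚ.- b) j≡
          (trans (ι-+ z (+ v i ℤ.* c)) (cong (λ y → ι z ℚ.+ y) (ι-* (+ v i) c))))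
        (solve 4 (λ v r c z → v :* (r :+ c) :- (z :+ v :* c) := v :* r :- z) refl (ι (+ v i)) (frac r q) (ι c) (ι z)))) (sym eq))))

  maximum : ∃[ p ] ∀ p′ → loneliness v p′ ℚ.≤ loneliness v p
  maximum with argmax (λ r → loneliness v (frac (+ r) q)) q
  ... | r , h = frac (+ r) q , λ p → let j , le = grid p in
    ℚ.≤-trans le (ℚ.≤-trans (periodic j) (h (j ℤ.%ℕ Q) (ℕ.≤-pred (ℤ.n%ℕd<d j Q))))

loneliness-maximum : ∀ {k} (v : Fin (suc k) → ℕ) → (∀ i → 0 < v i) → ∃[ p ] ∀ p′ → loneliness v p′ ℚ.≤ loneliness v p
loneliness-maximum v pos with commonMultiple (λ i → proj₁ (row i)) (λ i → proj₁ (proj₂ (row i)))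
  where
  row : ∀ i → ∃[ Q ] 0 < Q × (∀ j → v i + v j ∣ Q)
  row i = commonMultiple (λ j → v i + v j) (λ j → ℕ.≤-trans (pos i) (ℕ.m≤m+n (v i) (v j)))
... | suc q , _ , h = Grid.maximum v q λ i j → ∣.∣-trans (proj₂ (proj₂ (row i)) j) (h i)
  where
  row : ∀ i → ∃[ Q ] 0 < Q × (∀ j → v i + v j ∣ Q)
  row i = commonMultiple (λ j → v i + v j) (λ j → ℕ.≤-trans (pos i) (ℕ.m≤m+n (v i) (v j)))

pointwise-≤ᵣ : ∀ x y → (∀ n → seq x n ℚ.≤ seq y n) → x ≤ᵣ y
pointwise-≤ᵣ x y h ε ε>0 = 0 , λ n _ → ℚ.≤-trans (h n)
  (subst (ℚ._≤ seq y n ℚ.+ ε) (ℚ.+-identityʳ (seq y n)) (ℚ.+-monoʳ-≤ (seq y n) (ℚ.<⇒≤ ε>0)))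

-- Each term of the sequence for a real time t is the loneliness at the rational time `seq t n`, so
-- the rational maximum bounds it without any passage to the limit.
isML-fromℚ : ∀ {k} (v : Fin (suc k) → ℕ) p → (∀ p′ → loneliness v p′ ℚ.≤ loneliness v p) → IsML v (fromℚ (loneliness v p))
isML-fromℚ v p max = (fromℚ p ,
    pointwise-≤ᵣ (f (fromℚ p)) (fromℚ (loneliness v p)) (λ n → ℚ.≤-reflexive (seq-minimum v (fromℚ p) n)) ,
    pointwise-≤ᵣ (fromℚ (loneliness v p)) (f (fromℚ p)) (λ n → ℚ.≤-reflexive (sym (seq-minimum v (fromℚ p) n)))) ,
  λ t → pointwise-≤ᵣ (f t) (fromℚ (loneliness v p))
    (λ n → subst (ℚ._≤ loneliness v p) (sym (seq-minimum v t n)) (max (seq t n)))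
  where
  f : ℝ → ℝ
  f t = minimum (λ i → ‖ v i · t ‖)

≃ᵣ-refl : ∀ x → x ≃ᵣ x
≃ᵣ-refl x = pointwise-≤ᵣ x x (λ _ → ℚ.≤-refl) , pointwise-≤ᵣ x x (λ _ → ℚ.≤-refl)

-- Assembling the cases

module _ {k : ℕ} (v : Fin (2 + k) → ℕ) (pos : ∀ i → 0 < v i) where

  private
    n W : ℕ
    n = 2 + k
    W = v (fromℕ (suc k))
    slow : List ℕ
    slow = tabulate (v ∘ inject₁)

  -- Abstract, so that with-abstraction does not normalise the statement.
  abstract
    Conclusion : Set
    Conclusion = ∃[ m ] IsML v m ×
      ((∃[ s ] 0 < s × m ≃ᵣ fromℚ (+ s / suc (n * s))) ⊎ fromℚ (+ 1 / n) ≤ᵣ m)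

    conclude-extremal : ∀ {p s} → (∀ p′ → loneliness v p′ ℚ.≤ loneliness v p) → 0 < s →
      loneliness v p ≡ + s / suc (n * s) → Conclusion
    conclude-extremal {p} {s} max 0<s eq = fromℚ (loneliness v p) , isML-fromℚ v p max ,
      inj₁ (s , 0<s , subst (λ y → fromℚ (loneliness v p) ≃ᵣ fromℚ y) eq (≃ᵣ-refl (fromℚ (loneliness v p))))

    conclude-lonely : ∀ {p} → (∀ p′ → loneliness v p′ ℚ.≤ loneliness v p) → + 1 / n ℚ.≤ loneliness v p → Conclusion
    conclude-lonely {p} max le = fromℚ (loneliness v p) , isML-fromℚ v p max ,
      inj₂ (pointwise-≤ᵣ (fromℚ (+ 1 / n)) (fromℚ (loneliness v p)) λ _ → le)

    conclusion : Conclusion → ∃[ m ] IsML v m ×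
      ((∃[ s ] 0 < s × m ≃ᵣ fromℚ (+ s / suc (n * s))) ⊎ fromℚ (+ 1 / n) ≤ᵣ m)
    conclusion c = c

  speed∈ : ∀ i → v i ∈ W ∷ slow
  speed∈ i with view i
  ... | ‵fromℕ     = here refl
  ... | ‵inject₁ j = there (∈-tabulate⁺ {f = v ∘ inject₁} j)

  lonely⇒conclusion : Lonely n (W ∷ slow) → Conclusion
  lonely⇒conclusion (suc N , t , _ , h) with loneliness-maximum v pos
  ... | p , max = conclude-lonely max (subst (ℚ._≤ loneliness v p) (frac-def (+ 1) (suc k))
    (ℚ.≤-trans (≤-loneliness v (frac t N) λ i → away⇒≤‖‖ {1} {suc k} {N} {v i} {t}
      (subst (λ c → Away c n (suc N) (+ v i ℤ.* t)) (sym (ℕ.*-identityˡ (suc N))) (All.lookup h (speed∈ i)))) (max (frac t N))))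

  extremal⇒conclusion : ∀ {cs g m} → Extremal n cs → 0 < g → 2 ≤ m → All (λ c → g * c ∈ slow) cs →
    All (_∈ map (g *_) cs) slow → W ≡ g * (n * m) → Conclusion
  extremal⇒conclusion {cs} {g@(suc g′)} {m} ext 0<g 2≤m cs∈ slow∈ W≡ =
    conclude-extremal (λ p′ → subst (loneliness v p′ ℚ.≤_) (sym value) (upper p′)) (ℕ.<-trans (s≤s z≤n) 2≤m)
      (trans value (frac-def (+ m) (n * m)))
    where
    M N′ : ℕ
    M = suc (n * m)
    -- `suc N′` computes to g M, so `p` below is the time m/(g M).
    N′ = n * m + g′ * M
    p : ℚ
    p = frac (+ m) N′
    ρ : ℚ
    ρ = frac (+ m) (n * m)
    lower-bounds : All (λ c → Away (m * M) M M (+ c ℤ.* + m)) (n * m ∷ cs)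
    -- As n m ≡ -1 modulo M, the fast runner is the mirror image of a runner of speed 1.
    lower-bounds = subst (Away (m * M) M M) (e (+ (n * m)) (+ m))
        (away-cong (+ m) (away-neg (slow-attains {n} {m} {1} (s≤s z≤n) (s≤s (s≤s z≤n))))) ∷ proj₁ (ext m 2≤m)
      where
      e : ∀ y m → ℤ.- (+ 1 ℤ.* m) ℤ.+ m ℤ.* (+ 1 ℤ.+ y) ≡ y ℤ.* m
      e = solve-∀
    multiple : ∀ i → v i ∈ map (g *_) (n * m ∷ cs)
    multiple i with speed∈ i
    ... | here eq = here (trans eq W≡)
    ... | there j = there (All.lookup slow∈ j)
    lower : ρ ℚ.≤ loneliness v p
    lower = ≤-loneliness v p λ i → away⇒≤‖‖ {m} {n * m} {N′} {v i} {+ m} (at i)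
      where
      swap* : ∀ g m M → g * (m * M) ≡ m * (g * M)
      swap* = ℕRing.solve-∀
      at : ∀ i → Away (m * suc N′) M (suc N′) (+ v i ℤ.* + m)
      at i with ∈-map⁻ (g *_) (multiple i)
      ... | c , c∈ , eq = subst₂ (λ a y → Away a M (suc N′) y) (swap* g m M)
        (trans (sym (ℤ.*-assoc (+ g) (+ c) (+ m))) (cong (ℤ._* + m) (trans (sym (ℤ.pos-* g c)) (cong +_ (sym eq)))))
        (away-scale g (All.lookup lower-bounds c∈))
    upper : ∀ p′ → loneliness v p′ ℚ.≤ ρ
    upper p′ = ℚ.≮⇒≥ λ ρ<L → proj₂ (ext m 2≤m) (suc d) (+ g ℤ.* x) (s≤s z≤n) 
      (farᵢ ρ<L (fromℕ (suc k)) (n * m) W≡ ∷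
        All.map (λ {c} c∈ → let i , eq = ∈-tabulate⁻ {f = v ∘ inject₁} c∈ in farᵢ ρ<L (inject₁ i) c (sym eq)) cs∈)
      where
      x : ℤ
      x = ℚ.↥ p′
      d : ℕ
      d = ℚ.ℚ.denominator-1 p′
      farᵢ : ρ ℚ.< loneliness v p′ → ∀ i c → v i ≡ g * c → Away (suc (m * suc d)) M (suc d) (+ c ℤ.* (+ g ℤ.* x))
      farᵢ ρ<L i c eq = subst (Away (suc (m * suc d)) M (suc d)) (trans (cong (λ y → + y ℤ.* x) eq) (trans (cong (ℤ._* x) (ℤ.pos-* g c)) (e (+ g) (+ c) x)))
        (<‖‖⇒away {m} {n * m} {d} {v i} {x} (ℚ.<-≤-trans ρ<L (subst (λ y → loneliness v p′ ℚ.≤ ‖ ι (+ v i) ℚ.* y ‖ℚ) (sym (trans (frac-def x d) (ℚ.↥p/↧p≡p p′))) (loneliness-≤ v p′ i))))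
        where
        e : ∀ g c x → g ℤ.* c ℤ.* x ≡ c ℤ.* (g ℤ.* x)
        e = solve-∀
    value : loneliness v p ≡ ρ
    value = ℚ.≤-antisym (upper p) lower

-- The field large makes a fast speed of the form g n m satisfy m ≥ 2.
record Extendable (n : ℕ) (cs : List ℕ) : Set where
  constructor extendable
  field
    extremal : Extremal n cs
    nondivisible : All (λ c → ¬ n ∣ c) cs
    large : Any (λ c → n ≤ 4 * c) cs

module _ {k : ℕ} (2<n : 2 < 2 + k) {excs : List (List ℕ)} (ext : All (Extendable (2 + k)) excs)
  (classify : ∀ vs → All (0 <_) vs → length vs ≡ suc k → StrictlyLonely (2 + k) vs ⊎ Tight excs vs) where

  fast-runner : (v : Fin (2 + k) → ℕ) (pos : ∀ i → 0 < v i) → (∀ i j → i <ᶠ j → v i < v j) →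
    4 * v (inject₁ (fromℕ k)) ^ 4 < v (fromℕ (suc k)) → Conclusion v pos
  fast-runner v pos inc fast = go (classify slow (All.tabulate⁺ (pos ∘ inject₁)) (length-tabulate (v ∘ inject₁)))
    where
    n V W : ℕ
    n = 2 + k
    V = v (inject₁ (fromℕ k))
    W = v (fromℕ (suc k))
    slow : List ℕ
    slow = tabulate (v ∘ inject₁)
    instance
      V≢0 : ℕ.NonZero V
      V≢0 = ℕ.>-nonZero (pos (inject₁ (fromℕ k)))
    ≤V : ∀ i → v (inject₁ i) ≤ V
    ≤V i with view i
    ... | ‵fromℕ     = ℕ.≤-refl
    ... | ‵inject₁ j = ℕ.<⇒≤ (inc (inject₁ (inject₁ j)) (inject₁ (fromℕ k))
      (subst₂ _<_ (sym (trans (Fin.toℕ-inject₁ (inject₁ j)) (Fin.toℕ-inject₁ j))) (sym (trans (Fin.toℕ-inject₁ (fromℕ k)) (Fin.toℕ-fromℕ k))) (Fin.toℕ<n j)))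
    V≤V⁴ : V ≤ V ^ 4
    V≤V⁴ = subst (_≤ V ^ 4) (ℕ.^-identityʳ V) (ℕ.^-monoʳ-≤ V {1} {4} (s≤s z≤n))
    2V²≤W : 2 * (V * V) ≤ W
    2V²≤W = ℕ.≤-trans (ℕ.*-mono-≤ {2} {4} (s≤s (s≤s z≤n)) (subst (_≤ V ^ 4) (cong (V *_) (ℕ.*-identityʳ V)) (ℕ.^-monoʳ-≤ V {2} {4} (s≤s (s≤s z≤n))))) (ℕ.<⇒≤ fast)
    go : StrictlyLonely n slow ⊎ Tight excs slow → Conclusion v pos
    go (inj₁ strict) = lonely⇒conclusion v pos (add-fast-runner {V = V} (s≤s (s≤s z≤n))
      (All.tabulate⁺ {f = v ∘ inject₁} (λ i → ≤V i , pos (inject₁ i))) (pos (fromℕ (suc k))) 2V²≤W strict)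
    go (inj₂ (cs , cs∈excs , g , 0<g , cs∈ , slow∈)) with All.lookup ext cs∈excs | g ∣? W
    ... | extendable extremal n∤cs large | no g∤W = lonely⇒conclusion v pos (add-nonmultiple 2<n 0<g n∤cs slow∈ g∤W)
    ... | extendable extremal n∤cs large | yes (divides w W≡wg) with n ∣? w
    ...   | no n∤w = lonely⇒conclusion v pos (multiples-lonely (s≤s z≤n) 0<g (n∤w ∷ n∤cs)
              (here (trans W≡wg (ℕ.*-comm w g)) ∷ All.map there slow∈))
    ...   | yes (divides m w≡mn) = extremal⇒conclusion v pos extremal 0<g 2≤m cs∈ slow∈ W≡
      where
      W≡ : W ≡ g * (n * m)
      W≡ = trans W≡wg (trans (ℕ.*-comm w g) (cong (g *_) (trans w≡mn (ℕ.*-comm m n))))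
      gn<W : g * n < W
      gn<W with Any.satisfied (zipAny large cs∈)
        where
        zipAny : ∀ {cs} → Any (λ c → n ≤ 4 * c) cs → All (λ c → g * c ∈ slow) cs → Any (λ c → n ≤ 4 * c × g * c ∈ slow) cs
        zipAny (here p) (q ∷ _) = here (p , q)
        zipAny (there p) (_ ∷ q) = there (zipAny p q)
      ... | c , n≤4c , gc∈ with ∈-tabulate⁻ {f = v ∘ inject₁} gc∈
      ...   | i , gc≡ = begin-strict
        g * n              ≤⟨ ℕ.*-monoʳ-≤ g n≤4c ⟩
        g * (4 * c)        ≡⟨ e g c ⟩
        4 * (g * c)        ≤⟨ ℕ.*-monoʳ-≤ 4 (ℕ.≤-trans (subst (_≤ V) (sym gc≡) (≤V i)) V≤V⁴) ⟩
        4 * V ^ 4          <⟨ fast ⟩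
        W                  ∎
        where
        open ℕ.≤-Reasoning
        e : ∀ g c → g * (4 * c) ≡ 4 * (g * c)
        e = ℕRing.solve-∀
      2≤m : 2 ≤ m
      2≤m = ℕ.*-cancelˡ-< (g * n) 1 m (subst₂ _<_ (sym (ℕ.*-identityʳ (g * n))) (trans W≡ (sym (ℕ.*-assoc g n m))) gn<W)

extendable₃ : All (Extendable 4) tight₃
extendable₃ = extendable extremal-123 (All.head (from-yes (noneDivisible? 4 tight₃))) (there (there (here (from-yes (4 ℕ.≤? 12))))) ∷ []

extendable₅ : All (Extendable 6) tight₅
extendable₅ =
  extendable extremal-12345 (All.head nondivisible) (there (there (here (from-yes (6 ℕ.≤? 12))))) ∷
  extendable extremal-13459 (All.head (All.tail nondivisible)) (there (here (from-yes (6 ℕ.≤? 12)))) ∷ []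
  where
  nondivisible : All (All (λ c → ¬ 6 ∣ c)) tight₅
  nondivisible = from-yes (noneDivisible? 6 tight₅)

theorem2p2 : ∀ (k : ℕ) → let n = 2 + k in
    (n ≡ 4 ⊎ n ≡ 6) →
    (v : Fin n → ℕ) →
    (∀ i → 0 < v i) →
    (∀ i j → i <ᶠ j → v i < v j) →
    4 * v (inject₁ (fromℕ k)) ^ 4 < v (fromℕ (suc k)) →
    ∃[ m ] IsML v m ×
    ((∃[ s ] 0 < s × m ≃ᵣ fromℚ (+ s / suc (n * s))) ⊎
    fromℚ (+ 1 / n) ≤ᵣ m)
theorem2p2 k (inj₁ refl) v pos inc fast = conclusion v pos (fast-runner (s≤s (s≤s (s≤s z≤n))) extendable₃
  (Three.outcome 6 refl primes₃ (from-yes (distinctOddPrimes? primes₃)) sifted₃ (from-yes ((6 ^ 2) ^ 3 ℕ.<? product primes₃)))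
  v pos inc fast)
theorem2p2 k (inj₂ refl) v pos inc fast = conclusion v pos (fast-runner (s≤s (s≤s (s≤s z≤n))) extendable₅
  (Five.outcome 15 refl primes₅ (from-yes (distinctOddPrimes? primes₅)) sifted₅ (from-yes ((15 ^ 4) ^ 5 ℕ.<? product primes₅)))
  v pos inc fast)
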